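{- For all integers $k\ge 3$ and $n\ge 0$, \begin{align*} c\phi_{9}\Big(3^{2k+1}n+\tfrac{7\cdot 3^{2k+1}+3}{8} \Big) &\equiv 0 \pmod{3^{4k+5}},\\ c\phi_{9}\Big(3^{2k+2}n+\tfrac{5\cdot 3^{2k+2}+3}{8} \Big) &\equiv 0 \pmod{3^{4k+6}},\\ c\phi_{9}\Big(3^{2k+2}n+\tfrac{23\cdot 3^{2k+1}+3}{8}\Big) &\equiv 0 \pmod{3^{4k+7}},\\ c\phi_{9}\Big(3^{2k+3}n+\tfrac{13\cdot 3^{2k+2}+3}{8}\Big) &\equiv 0 \pmod{3^{4k+8}}. \end{align*}
   Context: For a positive integer $k$, color each nonnegative integer with each of $k$ colors $1,\dots,k$, writing $a_c$ for $a$ with color $c$, and order colored integers by $0_1\prec 0_2\prec\cdots\prec 0_k\prec 1_1\prec\cdots\prec 1_k\prec 2_1\prec\cdots$. A $k$-colored generalized Frobenius partition of $n$ is a two-row array $\begin{pmatrix} a_1,\dots,a_r\\ b_1,\dots,b_r\end{pmatrix}$ of colored integers with $a_r\prec a_{r-1}\prec\cdots\prec a_1$ and $b_r\prec\cdots\prec b_1$ and $n=r+\sum_{i=1}^r(a_i+b_i)$ (the sum using the underlying integers). $c\phi_k(n)$ denotes the number of $k$-colored generalized Frobenius partitions of $n$. Equivalently, $\sum_{n\ge0}c\phi_k(n)q^n=\frac{1}{(q;q)_\infty^k}\sum_{m_1,\dots,m_{k-1}\in\mathbb{Z}}q^{\sum_i m_i^2+\sum_{i<j}m_im_j}$, where $(q;q)_\infty=\prod_{n\ge1}(1-q^n)$.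 -}

module Defs where

open import Data.Bool using (Bool; true; false; _∧_; _∨_)
open import Data.Nat using (ℕ; zero; suc; _+_; _≡ᵇ_; _<ᵇ_)
open import Data.Fin using (Fin; toℕ)
open import Data.Product using (_×_; _,_; proj₁)
open import Data.Nat.ListAction using (sum)
open import Data.List using (List; []; _∷_; length; map; concatMap; upTo; allFin; filterᵇ; cartesianProduct)

-- A k-colored integer a_c : underlying integer a together with a colour c ∈ {1..k}
-- (colour c is represented by the element c-1 of Fin k).
ColInt : ℕ → Set
ColInt k = ℕ × Fin k

_≺ᵇ_ : ∀ {k} → ColInt k → ColInt k → Bool
(a , c) ≺ᵇ (b , d) = (a <ᵇ b) ∨ ((a ≡ᵇ b) ∧ (toℕ c <ᵇ toℕ d))

strictDecᵇ : ∀ {k} → List (ColInt k) → Bool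
strictDecᵇ []             = true
strictDecᵇ (x ∷ [])       = true
strictDecᵇ (x ∷ y ∷ rest) = (y ≺ᵇ x) ∧ strictDecᵇ (y ∷ rest)

weight : ∀ {k} → List (ColInt k) → ℕ
weight row = sum (map proj₁ row)

colsUpTo : (k n : ℕ) → List (ColInt k)
colsUpTo k n = concatMap (λ a → map (λ c → (a , c)) (allFin k)) (upTo (suc n))

listsOfLength : ∀ {A : Set} → ℕ → List A → List (List A)
listsOfLength zero    xs = [] ∷ []
listsOfLength (suc r) xs = concatMap (λ x → map (x ∷_) (listsOfLength r xs)) xs

-- All candidate rows for a partition of n: strictly decreasing rows of length ≤ n
-- with all entries having underlying integer ≤ n.  (Any row of a k-colored
-- generalized Frobenius partition of n satisfies these bounds, since
-- n = r + Σ (a_i + b_i).)  Distinct rows appear exactly once.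
rows : (k n : ℕ) → List (List (ColInt k))
rows k n = filterᵇ strictDecᵇ (concatMap (λ r → listsOfLength r (colsUpTo k n)) (upTo (suc n)))

isCFP : ∀ {k} → ℕ → List (ColInt k) × List (ColInt k) → Bool
isCFP n (top , bot) = (length top ≡ᵇ length bot) ∧ ((length top + weight top + weight bot) ≡ᵇ n)

cφ : ℕ → ℕ → ℕ
cφ k n = length (filterᵇ (isCFP n) (cartesianProduct (rows k n) (rows k n)))

{-# OPTIONS --safe #-}
-- Put C = 1/(q;q)∞ and let a(q) and c(q) = 3 q^{1/3} κ(q) be the cubic theta functions of the hexagonal lattice.
-- Jacobi's triple product, as a charge-shifting bijection on pairs of rows, turns the generating function of cφ₉
-- into C⁹ times the theta series of A₈, and grouping ℤ⁹ into three triples expresses that series through a, κ and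
-- their images under q ↦ q³. Two further bijections, reading positions modulo 3 and rotating three colours, give
-- C = C(q³)³ κ and C³ (a(q³) − 3q κ(q³)) = C(q³); with a = a(q³) + 6q κ(q³) these imply all the cubic identities.
-- For y = q κ(q³), b = a(q³) − 3y, t = y/b and s = q κ³/b³ they yield s = t + 9t² + 27t³ and the modular equation
-- t³ = s(q³) (1 + 9t + 27t²). With τ = 3t and σ = 27s everything is integral, and extracting the exponents divisible
-- by 3 maps a σ ℤ[σ] into 81 a σ ℤ[σ] and t a σ ℤ[σ] into 3 a σ ℤ[σ]. Two extractions thus gain 3⁵, and the powers
-- 3^(5k+2), 3^(5k+3), 3^(5k+4), 3^(5k+5) so obtained are at least the claimed ones exactly when k ≥ 3.
module Submission where

open import Defs
open import Level using (0ℓ)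
open import Data.Nat using (ℕ; zero; suc; _+_; _*_; _^_; _≤_; _<_; _/_; z≤n; s≤s)
import Data.Nat.Properties as ℕₚ
import Data.Nat.DivMod as DM
open import Data.Nat.Divisibility using (_∣_; divides; ∣-trans; n∣m*n)
open import Data.Integer using (ℤ; +_; -[1+_]; 0ℤ; 1ℤ; ∣_∣) renaming (_+_ to _+ᶻ_; _*_ to _*ᶻ_; -_ to -ᶻ_; _-_ to _-ᶻ_)
import Data.Integer.Properties as ℤₚ
open import Data.Integer.Tactic.RingSolver using () renaming (solve-∀ to ring-ℤ)
open import Data.Nat.Tactic.RingSolver using () renaming (solve-∀ to ring-ℕ)
open import Data.Fin using (Fin; zero; suc; toℕ; fromℕ<)
open import Data.Product using (Σ; Σ-syntax; _×_; _,_; proj₁; proj₂)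
open import Data.Sum using (_⊎_; inj₁; inj₂; [_,_]′)
open import Data.Unit using (⊤; tt)
open import Data.Empty using (⊥; ⊥-elim)
open import Relation.Nullary using (Dec; yes; no)
open import Relation.Nullary.Decidable using (recompute)
open import Relation.Binary.PropositionalEquality using (_≡_; refl; sym; trans; cong; cong₂; subst)

-- No product formula for C is used: C is the series of `cφ 1`, and what enters about it is its
-- constant term 1 and identities obtained by counting one weighted set in two ways. The cubic
-- identity a³ = b³ + 27 q κ³ is not assumed either. Its defect ε satisfies ε = 27 q (κ(q³)/b)
-- ε(q³), and only 0 solves this equation. The delicate point is the factor 81. Since σ = 9τ (1 + 3τ
-- + 3τ²), each σ yields a visible 9, so every multiple of σ² yields 81 at once; the single term
-- that falls short is the image of σ itself. That image is computed exactly, and there 3 + 12 + 3 =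
-- 18 supplies the second 9. Moving the exponents 2 modulo 3 to 0 modulo 3 costs a factor q, and
-- this factor is absorbed by q C³ = C(q⁹)³ t. Hence a σ ℤ[σ] and t a σ ℤ[σ] are met alternately,
-- and hence the gain alternates between 81 and 3.

module PowerSeries where
  open import Data.Maybe using (Maybe; just; nothing)
  open import Algebra.Bundles using (CommutativeRing)
  open import Algebra.Solver.Ring.AlmostCommutativeRing using (fromCommutativeRing; _-Raw-AlmostCommutative⟶_)
  import Algebra.Solver.Ring

  -- The ring of formal power series with integer coefficients.

  Series : Set
  Series = ℕ → ℤ

  infix 4 _≈_
  infixl 6 _⊕_ _⊝_
  infixl 7 _⊛_
  infix 8 ⊖_

  _≈_ : Series → Series → Set
  f ≈ g = ∀ n → f n ≡ g n

  tail : Series → Series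
  tail f n = f (suc n)

  const : ℤ → Series
  const c zero    = c
  const c (suc n) = 0ℤ

  opaque
    _⊕_ : Series → Series → Series
    (f ⊕ g) n = f n +ᶻ g n

    ⊖_ : Series → Series
    (⊖ f) n = -ᶻ f n

  scale : ℤ → Series → Series
  scale c f n = c *ᶻ f n

  opaque
    _⊛_ : Series → Series → Series
    (f ⊛ g) zero    = f 0 *ᶻ g 0
    (f ⊛ g) (suc n) = f 0 *ᶻ g (suc n) +ᶻ (tail f ⊛ g) n

  q· : Series → Series
  q· f zero    = 0ℤ
  q· f (suc n) = f n

  q : Series
  q = q· (const 1ℤ)

  opaque
    unfolding _⊛_ _⊕_

    ⊛-cong : ∀ {f f′ g g′} → f ≈ f′ → g ≈ g′ → f ⊛ g ≈ f′ ⊛ g′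
    ⊛-cong p r zero    = cong₂ _*ᶻ_ (p 0) (r 0)
    ⊛-cong p r (suc n) = cong₂ _+ᶻ_ (cong₂ _*ᶻ_ (p 0) (r (suc n))) (⊛-cong (λ m → p (suc m)) r n)

    ⊛-zeroˡ : ∀ g n → ((λ _ → 0ℤ) ⊛ g) n ≡ 0ℤ
    ⊛-zeroˡ g zero    = refl
    ⊛-zeroˡ g (suc n) = trans (ℤₚ.+-identityˡ _) (⊛-zeroˡ g n)

    const-⊛ : ∀ c g → const c ⊛ g ≈ scale c g
    const-⊛ c g zero    = refl
    const-⊛ c g (suc n) = trans (cong (c *ᶻ g (suc n) +ᶻ_) (⊛-zeroˡ g n)) (ℤₚ.+-identityʳ _)

    ⊛-distribʳ : ∀ h f g → (f ⊕ g) ⊛ h ≈ f ⊛ h ⊕ g ⊛ h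
    ⊛-distribʳ h f g zero    = ℤₚ.*-distribʳ-+ (h 0) (f 0) (g 0)
    ⊛-distribʳ h f g (suc n) = trans (cong ((f 0 +ᶻ g 0) *ᶻ h (suc n) +ᶻ_) (⊛-distribʳ h (tail f) (tail g) n)) (lem (f 0) (g 0) (h (suc n)) _ _)
      where
      lem : ∀ a b c x y → (a +ᶻ b) *ᶻ c +ᶻ (x +ᶻ y) ≡ (a *ᶻ c +ᶻ x) +ᶻ (b *ᶻ c +ᶻ y)
      lem = ring-ℤ

    scale-⊛ : ∀ c f g → scale c f ⊛ g ≈ scale c (f ⊛ g)
    scale-⊛ c f g zero    = ℤₚ.*-assoc c (f 0) (g 0)
    scale-⊛ c f g (suc n) = trans (cong (c *ᶻ f 0 *ᶻ g (suc n) +ᶻ_) (scale-⊛ c (tail f) g n)) (lem c (f 0) (g (suc n)) _)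
      where
      lem : ∀ c a b x → c *ᶻ a *ᶻ b +ᶻ c *ᶻ x ≡ c *ᶻ (a *ᶻ b +ᶻ x)
      lem = ring-ℤ

    ⊛-tailʳ : ∀ f g n → (f ⊛ g) (suc n) ≡ f (suc n) *ᶻ g 0 +ᶻ (f ⊛ tail g) n
    ⊛-tailʳ f g zero    = ℤₚ.+-comm (f 0 *ᶻ g 1) _
    ⊛-tailʳ f g (suc n) = trans (cong (f 0 *ᶻ g (suc (suc n)) +ᶻ_) (⊛-tailʳ (tail f) g n)) (lem (f 0 *ᶻ g (suc (suc n))) (f (suc (suc n)) *ᶻ g 0) ((tail f ⊛ tail g) n))
      where
      lem : ∀ a b c → a +ᶻ (b +ᶻ c) ≡ b +ᶻ (a +ᶻ c)
      lem = ring-ℤ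

    ⊛-comm : ∀ f g → f ⊛ g ≈ g ⊛ f
    ⊛-comm f g zero    = ℤₚ.*-comm (f 0) (g 0)
    ⊛-comm f g (suc n) = trans (cong₂ _+ᶻ_ (ℤₚ.*-comm (f 0) (g (suc n))) (⊛-comm (tail f) g n)) (sym (⊛-tailʳ g f n))

    ⊛-assoc : ∀ f g h → (f ⊛ g) ⊛ h ≈ f ⊛ (g ⊛ h)
    ⊛-assoc f g h zero    = ℤₚ.*-assoc (f 0) (g 0) (h 0)
    ⊛-assoc f g h (suc n) =
      trans (cong (f 0 *ᶻ g 0 *ᶻ h (suc n) +ᶻ_)
              (trans (⊛-distribʳ h (scale (f 0) (tail g)) (tail f ⊛ g) n)
                     (cong₂ _+ᶻ_ (scale-⊛ (f 0) (tail g) h n) (⊛-assoc (tail f) g h n))))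
            (lem (f 0) (g 0) (h (suc n)) _ _)
      where
      lem : ∀ a b c x y → a *ᶻ b *ᶻ c +ᶻ (a *ᶻ x +ᶻ y) ≡ a *ᶻ (b *ᶻ c +ᶻ x) +ᶻ y
      lem = ring-ℤ

    ⊛-identityˡ : ∀ g → const 1ℤ ⊛ g ≈ g
    ⊛-identityˡ g n = trans (const-⊛ 1ℤ g n) (ℤₚ.*-identityˡ (g n))

  const0 : ∀ n → const 0ℤ n ≡ 0ℤ
  const0 zero    = refl
  const0 (suc n) = refl

  opaque
    unfolding _⊕_ ⊖_

    ⊕-cong : ∀ {f f′ g g′} → f ≈ f′ → g ≈ g′ → f ⊕ g ≈ f′ ⊕ g′
    ⊕-cong p r n = cong₂ _+ᶻ_ (p n) (r n)

    ⊖-cong : ∀ {f g} → f ≈ g → ⊖ f ≈ ⊖ g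
    ⊖-cong p n = cong -ᶻ_ (p n)

    ⊕-assoc : ∀ f g h → (f ⊕ g) ⊕ h ≈ f ⊕ (g ⊕ h)
    ⊕-assoc f g h n = ℤₚ.+-assoc (f n) (g n) (h n)

    ⊕-comm : ∀ f g → f ⊕ g ≈ g ⊕ f
    ⊕-comm f g n = ℤₚ.+-comm (f n) (g n)

    ⊕-identityˡ : ∀ f → const 0ℤ ⊕ f ≈ f
    ⊕-identityˡ f n = trans (cong (_+ᶻ f n) (const0 n)) (ℤₚ.+-identityˡ (f n))

    ⊖-inverseˡ : ∀ f → ⊖ f ⊕ f ≈ const 0ℤ
    ⊖-inverseˡ f n = trans (ℤₚ.+-inverseˡ (f n)) (sym (const0 n))

    const-⊕ : ∀ x y → const (x +ᶻ y) ≈ const x ⊕ const y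
    const-⊕ x y zero    = refl
    const-⊕ x y (suc n) = refl

    const-⊖ : ∀ x → const (-ᶻ x) ≈ ⊖ const x
    const-⊖ x zero    = refl
    const-⊖ x (suc n) = refl

  seriesRing : CommutativeRing 0ℓ 0ℓ
  seriesRing = record
    { Carrier = Series ; _≈_ = _≈_ ; _+_ = _⊕_ ; _*_ = _⊛_ ; -_ = ⊖_ ; 0# = const 0ℤ ; 1# = const 1ℤ
    ; isCommutativeRing = record
      { isRing = record
        { +-isAbelianGroup = record
          { isGroup = record
            { isMonoid = record
              { isSemigroup = record
                { isMagma = record
                  { isEquivalence = record { refl = λ _ → refl ; sym = λ p n → sym (p n) ; trans = λ p r n → trans (p n) (r n) }
                  ; ∙-cong = ⊕-cong }
                ; assoc = ⊕-assoc }
              ; identity = ⊕-identityˡ , (λ f n → trans (⊕-comm f (const 0ℤ) n) (⊕-identityˡ f n)) }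
            ; inverse = ⊖-inverseˡ , (λ f n → trans (⊕-comm f (⊖ f) n) (⊖-inverseˡ f n))
            ; ⁻¹-cong = ⊖-cong }
          ; comm = ⊕-comm }
        ; *-cong = ⊛-cong
        ; *-assoc = ⊛-assoc
        ; *-identity = ⊛-identityˡ , (λ f n → trans (⊛-comm f (const 1ℤ) n) (⊛-identityˡ f n))
        ; distrib = (λ f g h n → trans (⊛-comm f (g ⊕ h) n) (trans (⊛-distribʳ f g h n) (⊕-cong (⊛-comm g f) (⊛-comm h f) n)))
                  , ⊛-distribʳ }
      ; *-comm = ⊛-comm } }

  open CommutativeRing seriesRing public using () renaming (refl to ≈refl; sym to ≈sym; trans to ≈trans)

  _⊝_ : Series → Series → Series
  f ⊝ g = f ⊕ ⊖ g

  const-morphism : CommutativeRing.rawRing ℤₚ.+-*-commutativeRing -Raw-AlmostCommutative⟶ fromCommutativeRing seriesRing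
  const-morphism = record
    { ⟦_⟧ = const
    ; +-homo = const-⊕
    ; *-homo = λ { x y zero → sym (const-⊛ x (const y) 0) ; x y (suc n) → sym (trans (const-⊛ x (const y) (suc n)) (ℤₚ.*-zeroʳ x)) }
    ; -‿homo = const-⊖
    ; 0-homo = λ { n → refl }
    ; 1-homo = λ { n → refl } }

  private
    const≟ : ∀ x y → Maybe (const x ≈ const y)
    const≟ x y with x ℤₚ.≟ y
    ... | yes p = just (λ n → cong (λ z → const z n) p)
    ... | no _  = nothing

  open Algebra.Solver.Ring (CommutativeRing.rawRing ℤₚ.+-*-commutativeRing) (fromCommutativeRing seriesRing) const-morphism const≟
    public using (solve; ⟦_⟧; op; [+]; [*]; var; con; _:=_; _:+_; _:*_; _:-_; :-_; _:^_; Polynomial)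

-- The substitution q ↦ q³ and the extraction of exponents modulo 3.

module Trisection where
  open PowerSeries

  opaque
    unfolding _⊛_

    q⊛ : ∀ f → q ⊛ f ≈ q· f
    q⊛ f zero    = refl
    q⊛ f (suc n) = trans (ℤₚ.+-identityˡ _) (⊛-identityˡ f n)

  -- Long division by a divisor whose constant term is taken to be 1: `f 0` is never consulted, so
  -- no integer division occurs.
  quotient : Series → Series → Series
  quotient r f zero    = r 0
  quotient r f (suc n) = quotient (tail r ⊝ scale (r 0) (tail f)) f n

  opaque
    unfolding _⊛_ _⊕_ ⊖_

    quotient-⊛ : ∀ f → f 0 ≡ 1ℤ → ∀ r → quotient r f ⊛ f ≈ r
    quotient-⊛ f f₀ r zero    = trans (cong (r 0 *ᶻ_) f₀) (ℤₚ.*-identityʳ (r 0))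
    quotient-⊛ f f₀ r (suc n) =
      trans (cong (r 0 *ᶻ f (suc n) +ᶻ_) (quotient-⊛ f f₀ (tail r ⊝ scale (r 0) (tail f)) n)) (lem (r 0 *ᶻ f (suc n)) (r (suc n)))
      where
      lem : ∀ x y → x +ᶻ (y +ᶻ -ᶻ x) ≡ y
      lem = ring-ℤ

  V : Series → Series
  V f 0 = f 0
  V f 1 = 0ℤ
  V f 2 = 0ℤ
  V f (suc (suc (suc n))) = V (tail f) n

  U₀ U₁ U₂ : Series → Series
  U₀ f n = f (n * 3)
  U₁ f n = f (suc (n * 3))
  U₂ f n = f (suc (suc (n * 3)))

  by-residue : ∀ {f g} → U₀ f ≈ U₀ g → U₁ f ≈ U₁ g → U₂ f ≈ U₂ g → f ≈ g
  by-residue p₀ p₁ p₂ 0 = p₀ 0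
  by-residue p₀ p₁ p₂ 1 = p₁ 0
  by-residue p₀ p₁ p₂ 2 = p₂ 0
  by-residue {f} {g} p₀ p₁ p₂ (suc (suc (suc n))) =
    by-residue {λ m → f (3 + m)} {λ m → g (3 + m)} (λ m → p₀ (suc m)) (λ m → p₁ (suc m)) (λ m → p₂ (suc m)) n

  U₀V : ∀ f → U₀ (V f) ≈ f
  U₀V f zero    = refl
  U₀V f (suc n) = U₀V (tail f) n

  U₁V : ∀ f → U₁ (V f) ≈ const 0ℤ
  U₁V f zero    = refl
  U₁V f (suc n) = trans (U₁V (tail f) n) (const0 n)

  U₂V : ∀ f → U₂ (V f) ≈ const 0ℤ
  U₂V f zero    = refl
  U₂V f (suc n) = trans (U₂V (tail f) n) (const0 n)

  private
    skip : ∀ a b c x y → x ≡ y → a +ᶻ (0ℤ *ᶻ b +ᶻ (0ℤ *ᶻ c +ᶻ x)) ≡ a +ᶻ y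
    skip a b c x y refl = cong (a +ᶻ_) (trans (ℤₚ.+-identityˡ _) (ℤₚ.+-identityˡ x))

  opaque
    unfolding _⊛_

    -- Extraction is linear over series in q³. The two zero coefficients between consecutive
    -- coefficients of `V f` drop out of the convolution, which then advances in steps of three.
    U₀-V⊛ : ∀ f g → U₀ (V f ⊛ g) ≈ f ⊛ U₀ g
    U₀-V⊛ f g zero    = refl
    U₀-V⊛ f g (suc n) = skip (f 0 *ᶻ g (3 + n * 3)) (g (2 + n * 3)) (g (1 + n * 3)) _ _ (U₀-V⊛ (tail f) g n)

    U₁-V⊛ : ∀ f g → U₁ (V f ⊛ g) ≈ f ⊛ U₁ g
    U₁-V⊛ f g zero    = ℤₚ.+-identityʳ _
    U₁-V⊛ f g (suc n) = skip (f 0 *ᶻ g (4 + n * 3)) (g (3 + n * 3)) (g (2 + n * 3)) _ _ (U₁-V⊛ (tail f) g n)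

    U₂-V⊛ : ∀ f g → U₂ (V f ⊛ g) ≈ f ⊛ U₂ g
    U₂-V⊛ f g zero    = ℤₚ.+-identityʳ _
    U₂-V⊛ f g (suc n) = skip (f 0 *ᶻ g (5 + n * 3)) (g (4 + n * 3)) (g (3 + n * 3)) _ _ (U₂-V⊛ (tail f) g n)

  V-cong : ∀ {f g} → f ≈ g → V f ≈ V g
  V-cong p 0 = p 0
  V-cong p 1 = refl
  V-cong p 2 = refl
  V-cong p (suc (suc (suc n))) = V-cong (λ m → p (suc m)) n

  opaque
    unfolding _⊕_ ⊖_

    V-⊕ : ∀ f g → V (f ⊕ g) ≈ V f ⊕ V g
    V-⊕ f g 0 = refl
    V-⊕ f g 1 = refl
    V-⊕ f g 2 = refl
    V-⊕ f g (suc (suc (suc n))) = V-⊕ (tail f) (tail g) n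

    V-⊖ : ∀ f → V (⊖ f) ≈ ⊖ V f
    V-⊖ f 0 = refl
    V-⊖ f 1 = refl
    V-⊖ f 2 = refl
    V-⊖ f (suc (suc (suc n))) = V-⊖ (tail f) n

    U₀-⊕ : ∀ f g → U₀ (f ⊕ g) ≈ U₀ f ⊕ U₀ g
    U₀-⊕ f g n = refl

    U₁-⊕ : ∀ f g → U₁ (f ⊕ g) ≈ U₁ f ⊕ U₁ g
    U₁-⊕ f g n = refl

    U₂-⊕ : ∀ f g → U₂ (f ⊕ g) ≈ U₂ f ⊕ U₂ g
    U₂-⊕ f g n = refl

  V-const : ∀ c → V (const c) ≈ const c
  V-const c 0 = refl
  V-const c 1 = refl
  V-const c 2 = refl
  V-const c (suc (suc (suc n))) = V-0 n
    where
    V-0 : ∀ n → V (λ _ → 0ℤ) n ≡ 0ℤ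
    V-0 0 = refl
    V-0 1 = refl
    V-0 2 = refl
    V-0 (suc (suc (suc n))) = V-0 n

  ⊛-zeroʳ : ∀ f → f ⊛ const 0ℤ ≈ const 0ℤ
  ⊛-zeroʳ f = ≈trans (⊛-comm f (const 0ℤ)) (≈trans (const-⊛ 0ℤ f) (λ n → sym (const0 n)))

  V-⊛ : ∀ f g → V (f ⊛ g) ≈ V f ⊛ V g
  V-⊛ f g = by-residue
    (≈trans (U₀V (f ⊛ g)) (≈sym (≈trans (U₀-V⊛ f (V g)) (⊛-cong {f} ≈refl (U₀V g)))))
    (≈trans (U₁V (f ⊛ g)) (≈sym (≈trans (U₁-V⊛ f (V g)) (≈trans (⊛-cong {f} ≈refl (U₁V g)) (⊛-zeroʳ f)))))
    (≈trans (U₂V (f ⊛ g)) (≈sym (≈trans (U₂-V⊛ f (V g)) (≈trans (⊛-cong {f} ≈refl (U₂V g)) (⊛-zeroʳ f)))))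

  q³ : q ⊛ q ⊛ q ≈ V q
  q³ = ≈trans (⊛-assoc q q q) (≈trans (⊛-cong {q} ≈refl (q⊛ q)) (≈trans (q⊛ (q· q)) λ
    { 0 → refl ; 1 → refl ; 2 → refl ; 3 → refl ; (suc (suc (suc (suc n)))) → sym (V-const 1ℤ (suc n)) }))

  opaque
    unfolding _⊛_

    ⊛-vanish : ∀ g h n → (∀ j → j ≤ n → h j ≡ 0ℤ) → (g ⊛ h) n ≡ 0ℤ
    ⊛-vanish g h zero    p = trans (cong (g 0 *ᶻ_) (p 0 z≤n)) (ℤₚ.*-zeroʳ (g 0))
    ⊛-vanish g h (suc n) p =
      cong₂ _+ᶻ_ (trans (cong (g 0 *ᶻ_) (p (suc n) ℕₚ.≤-refl)) (ℤₚ.*-zeroʳ (g 0)))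
                 (⊛-vanish (tail g) h n (λ j j≤n → p j (ℕₚ.m≤n⇒m≤1+n j≤n)))

  V-vanish : ∀ f n → (∀ j → j ≤ n → f j ≡ 0ℤ) → V f n ≡ 0ℤ
  V-vanish f 0 p = p 0 z≤n
  V-vanish f 1 p = refl
  V-vanish f 2 p = refl
  V-vanish f (suc (suc (suc n))) p = V-vanish (tail f) n (λ j j≤n → p (suc j) (s≤s (ℕₚ.m≤n⇒m≤1+n (ℕₚ.m≤n⇒m≤1+n j≤n))))

  -- The lowest term of a nonzero solution would have to reappear on the right at a strictly larger exponent.
  fixpoint-vanish : ∀ ε g → ε ≈ q· (g ⊛ V ε) → ε ≈ const 0ℤ
  fixpoint-vanish ε g p n = trans (below n n ℕₚ.≤-refl) (sym (const0 n))
    where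
    below : ∀ n j → j ≤ n → ε j ≡ 0ℤ
    below n       zero    j≤n       = p 0
    below (suc n) (suc j) (s≤s j≤n) = trans (p (suc j)) (⊛-vanish g (V ε) j λ i i≤j →
      V-vanish ε i λ k k≤i → below n k (ℕₚ.≤-trans k≤i (ℕₚ.≤-trans i≤j j≤n)))

  -- Linear combinations of hypotheses: once the ring solver certifies x − y = m (l − r), l = r gives x = y.
  private opaque
    unfolding _⊕_ ⊖_

    diff : ∀ {x y} → x ≈ y → x ⊝ y ≈ const 0ℤ
    diff {x} {y} p n = trans (cong (λ z → z +ᶻ -ᶻ y n) (p n)) (trans (ℤₚ.+-inverseʳ (y n)) (sym (const0 n)))

    undiff : ∀ {x y} → x ⊝ y ≈ const 0ℤ → x ≈ y
    undiff {x} {y} p n = ℤₚ.i-j≡0⇒i≡j (x n) (y n) (trans (p n) (const0 n))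

    vanishing : ∀ {l r} m → l ≈ r → m ⊛ (l ⊝ r) ≈ const 0ℤ
    vanishing m p = ≈trans (⊛-cong {m} ≈refl (diff p)) (⊛-zeroʳ m)

    0⊕0 : ∀ {x y} → x ≈ const 0ℤ → y ≈ const 0ℤ → x ⊕ y ≈ const 0ℤ
    0⊕0 p r n = trans (cong₂ _+ᶻ_ (p n) (r n)) (trans (cong (_+ᶻ const 0ℤ n) (const0 n)) (ℤₚ.+-identityˡ _))

  lincomb₁ : ∀ {x y l r} m → l ≈ r → x ⊝ y ≈ m ⊛ (l ⊝ r) → x ≈ y
  lincomb₁ m p e = undiff (≈trans e (vanishing m p))

  lincomb₂ : ∀ {x y l r l′ r′} m → l ≈ r → ∀ m′ → l′ ≈ r′ → x ⊝ y ≈ m ⊛ (l ⊝ r) ⊕ m′ ⊛ (l′ ⊝ r′) → x ≈ y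
  lincomb₂ m p m′ p′ e = undiff (≈trans e (0⊕0 (vanishing m p) (vanishing m′ p′)))

  lincomb₃ : ∀ {x y l r l′ r′ l″ r″} m → l ≈ r → ∀ m′ → l′ ≈ r′ → ∀ m″ → l″ ≈ r″ →
             x ⊝ y ≈ m ⊛ (l ⊝ r) ⊕ m′ ⊛ (l′ ⊝ r′) ⊕ m″ ⊛ (l″ ⊝ r″) → x ≈ y
  lincomb₃ m p m′ p′ m″ p″ e = undiff (≈trans e (0⊕0 (0⊕0 (vanishing m p) (vanishing m′ p′)) (vanishing m″ p″)))

-- The cubic theta functions: cubic identity, modular equation and 3-dissections.

module CubicTheta where
  open PowerSeries
  open Trisection
  open import Data.Vec using (Vec; []; _∷_; lookup) renaming (map to vmap)

  cube : ∀ {n} → Polynomial n → Polynomial n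
  cube x = x :* x :* x

  infix 9 _³
  _³ : Series → Series
  x ³ = x ⊛ x ⊛ x

  infixr 8 _·_
  _·_ : ℕ → Series → Series
  n · f = const (+ n) ⊛ f

  infixr 9 _:·_
  _:·_ : ∀ {n} → ℕ → Polynomial n → Polynomial n
  m :· p = con (+ m) :* p

  1# : Series
  1# = const 1ℤ

  :1 : ∀ {n} → Polynomial n
  :1 = con 1ℤ

  ³-cong : ∀ {x y} → x ≈ y → x ³ ≈ y ³
  ³-cong p = ⊛-cong (⊛-cong p p) p

  ⊛-congʳ : ∀ x {y z} → y ≈ z → x ⊛ y ≈ x ⊛ z
  ⊛-congʳ x p = ⊛-cong {x} ≈refl p

  ⊛-congˡ : ∀ {x y} z → x ≈ y → x ⊛ z ≈ y ⊛ z
  ⊛-congˡ z p = ⊛-cong {g = z} p ≈refl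

  ⊕-congʳ : ∀ x {y z} → y ≈ z → x ⊕ y ≈ x ⊕ z
  ⊕-congʳ x p = ⊕-cong {x} ≈refl p

  unit³ : ∀ {x y} → x ⊛ y ≈ 1# → x ³ ⊛ y ³ ≈ 1#
  unit³ {x} {y} p = lincomb₁ (1# ⊕ x ⊛ y ⊕ (x ⊛ y) ⊛ (x ⊛ y)) p
    (solve 2 (λ x y → cube x :* cube y :- :1 := (:1 :+ x :* y :+ (x :* y) :* (x :* y)) :* (x :* y :- :1)) (λ _ → refl) x y)

  V³ : ∀ f → V (f ³) ≈ V f ³
  V³ f = ≈trans (V-⊛ (f ⊛ f) f) (⊛-congˡ (V f) (V-⊛ f f))

  V-· : ∀ n f → V (n · f) ≈ n · V f
  V-· n f = ≈trans (V-⊛ (const (+ n)) f) (⊛-congˡ (V f) (V-const (+ n)))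

  V-unit : ∀ {x y} → x ⊛ y ≈ 1# → V x ⊛ V y ≈ 1#
  V-unit {x} {y} p = ≈trans (≈sym (V-⊛ x y)) (≈trans (V-cong p) (V-const 1ℤ))

  module CubicTheory
    (C a κ : Series)
    (C₀ : C 0 ≡ 1ℤ)
    (C-split : C ≈ V C ³ ⊛ κ)
    (a-split : a ≈ V a ⊕ 6 · (q ⊛ V κ))
    (C³-split : C ³ ⊛ (V a ⊝ 3 · (q ⊛ V κ)) ≈ V C)
    where

    -- e = (q;q)∞ and b = e³ / e(q³); division is avoided by carrying β = 1/b.
    e b β X y Y s t σ τ : Series
    e = quotient 1# C
    b = V C ⊛ e ³
    β = V e ⊛ C ³
    X = V a
    y = q ⊛ V κ
    Y = q ⊛ κ ³
    t = y ⊛ β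
    s = Y ⊛ β ³
    -- With c = 3 q^(1/3) κ one has 3y = c(q³) and 27Y = c³, so τ = c(q³)/b and σ = c³/b³.
    τ = 3 · t
    σ = 27 · s

    eC : e ⊛ C ≈ 1#
    eC = quotient-⊛ C C₀ 1#

    e³C³ : e ³ ⊛ C ³ ≈ 1#
    e³C³ = unit³ eC

    bβ : b ⊛ β ≈ 1#
    bβ = lincomb₂ (V e ⊛ V C) e³C³ 1# (V-unit eC)
      (solve 4 (λ e c e′ c′ → (c′ :* cube e) :* (e′ :* cube c) :- :1 := e′ :* c′ :* (cube e :* cube c :- :1) :+ :1 :* (e′ :* c′ :- :1))
        (λ _ → refl) e C (V e) (V C))

    X≈ : X ≈ b ⊕ 3 · y
    X≈ = lincomb₂ (e ³) C³-split (⊖ (X ⊝ 3 · y)) e³C³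
      (solve 5 (λ e c c′ x y → x :- (c′ :* cube e :+ 3 :· y) :=
          cube e :* (cube c :* (x :- 3 :· y) :- c′) :+ (:- (x :- 3 :· y)) :* (cube e :* cube c :- :1))
        (λ _ → refl) e C (V C) X y)

    a≈ : a ≈ b ⊕ 9 · y
    a≈ = lincomb₂ 1# a-split 1# X≈
      (solve 4 (λ a x b y → a :- (b :+ 9 :· y) := :1 :* (a :- (x :+ 6 :· y)) :+ :1 :* (x :- (b :+ 3 :· y))) (λ _ → refl) a X b y)

    κ≈ : κ ≈ C ⊛ V e ³
    κ≈ = lincomb₂ (⊖ (V e ³)) C-split (⊖ κ) (unit³ (V-unit eC))
      (solve 4 (λ c k e′ c′ → k :- c :* cube e′ := (:- cube e′) :* (c :- cube c′ :* k) :+ (:- k) :* (cube e′ :* cube c′ :- :1))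
        (λ _ → refl) C κ (V e) (V C))

    Vκ≈ : V κ ≈ V C ⊛ V (V e) ³
    Vκ≈ = ≈trans (V-cong κ≈) (≈trans (V-⊛ C (V e ³)) (⊛-congʳ (V C) (V³ (V e))))

    Vb≈ : V b ≈ V (V C) ⊛ V e ³
    Vb≈ = ≈trans (V-⊛ (V C) (e ³)) (⊛-congʳ (V (V C)) (V³ e))

    -- Since κ = e(q³)³/e and b = e³/e(q³), both sides collapse to e(q³)⁸. This links `Y` with `V b`
    -- and closes the equation for `ε`.
    bκ³ : b ⊛ κ ³ ≈ V κ ⊛ V b ³
    bκ³ = ≈trans left (≈sym right)
      where
      left : b ⊛ κ ³ ≈ V C ⊛ (V e ³) ³
      left = ≈trans (⊛-congʳ b (³-cong κ≈))
        (lincomb₁ (V C ⊛ (V e ³) ³) e³C³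
          (solve 4 (λ e c c′ d → (c′ :* cube e) :* cube (c :* d) :- c′ :* cube d := (c′ :* cube d) :* (cube e :* cube c :- :1))
            (λ _ → refl) e C (V C) (V e ³)))
      right : V κ ⊛ V b ³ ≈ V C ⊛ (V e ³) ³
      right = ≈trans (⊛-cong Vκ≈ (³-cong Vb≈))
        (lincomb₁ (V C ⊛ (V e ³) ³) (unit³ (V-unit (V-unit eC)))
          (solve 4 (λ e″ c″ c′ d → (c′ :* cube e″) :* cube (c″ :* d) :- c′ :* cube d := (c′ :* cube d) :* (cube e″ :* cube c″ :- :1))
            (λ _ → refl) (V (V e)) (V (V C)) (V C) (V e ³)))

    y³ : y ³ ≈ V Y
    y³ = ≈trans (solve 2 (λ q k → cube (q :* k) := (q :* q :* q) :* cube k) (λ _ → refl) q (V κ))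
      (≈trans (⊛-cong q³ (≈sym (V³ κ))) (≈sym (V-⊛ q (κ ³))))

    -- The cofactor shared by two factorisations: as a = b + 9y and X = b + 3y, a³ - b³ = 27 y w and
    -- X³ - 27 y³ = b w.
    w : Series
    w = b ⊛ b ⊕ 9 · (b ⊛ y) ⊕ 27 · (y ⊛ y)

    -- The defect of the cubic identity: 27 ε = a³ - b³ - 27 Y.
    ε : Series
    ε = y ⊛ w ⊝ Y

    -- Apply `V` to a³ - 27Y = b³ + 27ε: a becomes X and Y becomes y³, so the left side turns into
    -- X³ - 27y³, which is b w.
    bw : b ⊛ w ≈ V b ³ ⊕ 27 · V ε
    bw = ≈trans step (≈trans (≈sym VA) (≈trans (V-cong A≈) VB))
      where
      A≈ : a ³ ⊝ 27 · Y ≈ b ³ ⊕ 27 · ε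
      A≈ = ≈trans (⊕-cong (³-cong a≈) ≈refl)
        (solve 3 (λ b y z → cube (b :+ 9 :· y) :- 27 :· z := cube b :+ 27 :· (y :* (b :* b :+ 9 :· (b :* y) :+ 27 :· (y :* y)) :- z))
          (λ _ → refl) b y Y)
      VA : V (a ³ ⊝ 27 · Y) ≈ X ³ ⊝ 27 · V Y
      VA = ≈trans (V-⊕ (a ³) (⊖ (27 · Y))) (⊕-cong (V³ a) (≈trans (V-⊖ (27 · Y)) (⊖-cong (V-· 27 Y))))
      VB : V (b ³ ⊕ 27 · ε) ≈ V b ³ ⊕ 27 · V ε
      VB = ≈trans (V-⊕ (b ³) (27 · ε)) (⊕-cong (V³ b) (V-· 27 ε))
      step : b ⊛ w ≈ X ³ ⊝ 27 · V Y
      step = ≈trans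
        (solve 2 (λ b y → b :* (b :* b :+ 9 :· (b :* y) :+ 27 :· (y :* y)) := cube (b :+ 3 :· y) :- 27 :· cube y) (λ _ → refl) b y)
        (⊕-cong (³-cong (≈sym X≈)) (⊖-cong (⊛-congʳ (const (+ 27)) y³)))

    -- In b ε = y (b w) - q (b κ³), `bw` and `bκ³` produce the same term y (V b)³ with opposite
    -- signs. What remains is b ε = 27 y V ε, an equation of the form treated by `fixpoint-vanish`.
    ε≈0 : ε ≈ const 0ℤ
    ε≈0 = fixpoint-vanish ε (27 · (β ⊛ V κ)) (≈trans
      (lincomb₃ (⊖ ε) bβ (β ⊛ y) bw (⊖ (β ⊛ q)) bκ³
        (solve 7 (λ b β q k k³ v b3 →
           let y = q :* k ; w = b :* b :+ 9 :· (b :* y) :+ 27 :· (y :* y) ; ε = y :* w :- q :* k³ in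
           ε :- q :* (27 :· (β :* k) :* v) :=
             (:- ε) :* (b :* β :- :1) :+ (β :* y) :* (b :* w :- (b3 :+ 27 :· v)) :+ (:- (β :* q)) :* (b :* k³ :- k :* b3))
          (λ _ → refl) b β q (V κ) (κ ³) (V ε) (V b ³)))
      (q⊛ (27 · (β ⊛ V κ) ⊛ V ε)))

    yw : y ⊛ w ≈ Y
    yw = lincomb₁ 1# ε≈0 (solve 2 (λ x z → x :- z := :1 :* ((x :- z) :- con 0ℤ)) (λ _ → refl) (y ⊛ w) Y)

    bw′ : b ⊛ w ≈ V b ³
    bw′ = ≈trans bw (lincomb₁ (const (+ 27)) Vε
      (solve 2 (λ x z → (x :+ 27 :· z) :- x := con (+ 27) :* (z :- con 0ℤ)) (λ _ → refl) (V b ³) (V ε)))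
      where
      Vε : V ε ≈ const 0ℤ
      Vε = ≈trans (V-cong ε≈0) (V-const 0ℤ)

    -- y^i carries exactly the exponents congruent to i modulo 3.
    U₀-q· : ∀ f → U₀ (q· (V f)) ≈ const 0ℤ
    U₀-q· f zero    = refl
    U₀-q· f (suc n) = trans (U₂V f n) (const0 n)

    y≈ : y ≈ q· (V κ)
    y≈ = q⊛ (V κ)

    y²≈ : y ⊛ y ≈ q· (q· (V (κ ⊛ κ)))
    y²≈ = ≈trans (solve 2 (λ q k → (q :* k) :* (q :* k) := q :* (q :* (k :* k))) (λ _ → refl) q (V κ))
      (≈trans (⊛-congʳ q (⊛-congʳ q (≈sym (V-⊛ κ κ)))) (≈trans (⊛-congʳ q (q⊛ _)) (q⊛ _)))

    module Dissection {g f₀ f₁ f₂ : Series} (g≈ : g ≈ V f₀ ⊕ V f₁ ⊛ y ⊕ V f₂ ⊛ (y ⊛ y)) where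
      private
        U₀y² : U₀ (y ⊛ y) ≈ const 0ℤ
        U₀y² n = trans (y²≈ (n * 3)) (U₀-q·q· n)
          where
          U₀-q·q· : ∀ n → q· (q· (V (κ ⊛ κ))) (n * 3) ≡ const 0ℤ n
          U₀-q·q· zero    = refl
          U₀-q·q· (suc n) = trans (U₁V (κ ⊛ κ) n) (const0 n)

        drop : ∀ {u} f → u ≈ const 0ℤ → f ⊛ u ≈ const 0ℤ
        drop f p = ≈trans (⊛-congʳ f p) (⊛-zeroʳ f)

        :0 : ∀ {n} → Polynomial n
        :0 = con 0ℤ

      U₀-dissect : U₀ g ≈ f₀
      U₀-dissect = ≈trans (λ n → g≈ (n * 3))
        (≈trans (≈trans (U₀-⊕ (V f₀ ⊕ V f₁ ⊛ y) (V f₂ ⊛ (y ⊛ y))) (⊕-cong (U₀-⊕ (V f₀) (V f₁ ⊛ y)) ≈refl)) (≈trans (⊕-cong (⊕-cong (U₀V f₀) (≈trans (U₀-V⊛ f₁ y) (drop f₁ (λ n → trans (y≈ (n * 3)) (U₀-q· κ n)))))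
                        (≈trans (U₀-V⊛ f₂ (y ⊛ y)) (drop f₂ U₀y²)))
          (solve 1 (λ x → x :+ :0 :+ :0 := x) (λ _ → refl) f₀)))

      U₁-dissect : U₁ g ≈ f₁ ⊛ κ
      U₁-dissect = ≈trans (λ n → g≈ (suc (n * 3)))
        (≈trans (≈trans (U₁-⊕ (V f₀ ⊕ V f₁ ⊛ y) (V f₂ ⊛ (y ⊛ y))) (⊕-cong (U₁-⊕ (V f₀) (V f₁ ⊛ y)) ≈refl)) (≈trans (⊕-cong (⊕-cong (U₁V f₀) (≈trans (U₁-V⊛ f₁ y) (⊛-congʳ f₁ (λ n → trans (y≈ (suc (n * 3))) (U₀V κ n)))))
                        (≈trans (U₁-V⊛ f₂ (y ⊛ y)) (drop f₂ (λ n → trans (y²≈ (suc (n * 3))) (U₀-q· (κ ⊛ κ) n)))))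
          (solve 1 (λ x → :0 :+ x :+ :0 := x) (λ _ → refl) (f₁ ⊛ κ))))

      U₂-dissect : U₂ g ≈ f₂ ⊛ (κ ⊛ κ)
      U₂-dissect = ≈trans (λ n → g≈ (suc (suc (n * 3))))
        (≈trans (≈trans (U₂-⊕ (V f₀ ⊕ V f₁ ⊛ y) (V f₂ ⊛ (y ⊛ y))) (⊕-cong (U₂-⊕ (V f₀) (V f₁ ⊛ y)) ≈refl)) (≈trans (⊕-cong (⊕-cong (U₂V f₀) (≈trans (U₂-V⊛ f₁ y) (drop f₁ (λ n → trans (y≈ (suc (suc (n * 3)))) (U₁V κ n)))))
                        (≈trans (U₂-V⊛ f₂ (y ⊛ y)) (⊛-congʳ f₂ (λ n → trans (y²≈ (suc (suc (n * 3)))) (U₀V (κ ⊛ κ) n)))))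
          (solve 1 (λ x → :0 :+ :0 :+ x := x) (λ _ → refl) (f₂ ⊛ (κ ⊛ κ)))))

    B : Series
    B = V β

    VbB : V b ³ ⊛ B ³ ≈ 1#
    VbB = unit³ (V-unit bβ)

    b³β³ : b ³ ⊛ β ³ ≈ 1#
    b³β³ = unit³ bβ

    a³≈ : a ³ ≈ b ³ ⊕ 27 · Y
    a³≈ = ≈trans (³-cong a≈) (lincomb₁ (const (+ 27)) yw
      (solve 3 (λ b y z → cube (b :+ 9 :· y) :- (cube b :+ 27 :· z)
          := con (+ 27) :* (y :* (b :* b :+ 9 :· (b :* y) :+ 27 :· (y :* y)) :- z)) (λ _ → refl) b y Y))

    -- Rationalises the denominator: b w = (V b)³ gives 1/b = w/(V b)³, whose denominator is a
    -- series in q³. This is what makes t and its powers dissectable.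
    β≈wB³ : β ≈ w ⊛ B ³
    β≈wB³ = lincomb₃ (w ⊛ B ³) bβ (⊖ (β ⊛ B ³)) bw′ (⊖ β) VbB
      (solve 5 (λ b β w v B → β :- w :* B := (w :* B) :* (b :* β :- :1) :+ (:- (β :* B)) :* (b :* w :- v) :+ (:- β) :* (v :* B :- :1))
        (λ _ → refl) b β w (V b ³) (B ³))

    w≈ : w ≈ X ⊛ X ⊕ 3 · (X ⊛ y) ⊕ 9 · (y ⊛ y)
    w≈ = ≈trans (solve 2 (λ b y → b :* b :+ 9 :· (b :* y) :+ 27 :· (y :* y) :=
                  (b :+ 3 :· y) :* (b :+ 3 :· y) :+ 3 :· ((b :+ 3 :· y) :* y) :+ 9 :· (y :* y)) (λ _ → refl) b y)
           (⊕-cong (⊕-cong (⊛-cong (≈sym X≈) (≈sym X≈)) (⊛-congʳ (const (+ 3)) (⊛-congˡ y (≈sym X≈)))) ≈refl)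

    t≈ : t ≈ y ⊛ (X ⊛ X ⊕ 3 · (X ⊛ y) ⊕ 9 · (y ⊛ y)) ⊛ B ³
    t≈ = ≈trans (⊛-congʳ y (≈trans β≈wB³ (⊛-congˡ (B ³) w≈))) (≈sym (⊛-assoc y (X ⊛ X ⊕ 3 · (X ⊛ y) ⊕ 9 · (y ⊛ y)) (B ³)))

    wβ² : w ⊛ (β ⊛ β) ≈ 1# ⊕ 9 · t ⊕ 27 · (t ⊛ t)
    wβ² = lincomb₁ (b ⊛ β ⊕ 1# ⊕ 9 · (y ⊛ β)) bβ
      (solve 3 (λ b β y → (b :* b :+ 9 :· (b :* y) :+ 27 :· (y :* y)) :* (β :* β) :- (:1 :+ 9 :· (y :* β) :+ 27 :· ((y :* β) :* (y :* β)))
         := (b :* β :+ :1 :+ 9 :· (y :* β)) :* (b :* β :- :1)) (λ _ → refl) b β y)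

    s≈ : s ≈ t ⊛ (1# ⊕ 9 · t ⊕ 27 · (t ⊛ t))
    s≈ = ≈trans (⊛-congˡ (β ³) (≈sym yw))
      (≈trans (solve 3 (λ y w β → (y :* w) :* cube β := (y :* β) :* (w :* (β :* β))) (λ _ → refl) y w β) (⊛-congʳ t wβ²))

    Vs≈ : V s ≈ V Y ⊛ B ³
    Vs≈ = ≈trans (V-⊛ Y (β ³)) (⊛-congʳ (V Y) (V³ β))

    -- In t³ = y³ β³ the factor y³ is V Y and one of the three β is rationalised to w B³. Then V Y
    -- B³ is V s, and w β² is the quadratic in t.
    t³≈ : t ³ ≈ V s ⊛ (1# ⊕ 9 · t ⊕ 27 · (t ⊛ t))
    t³≈ = ≈trans
      (lincomb₂ (β ³) y³ (V Y ⊛ (β ⊛ β)) β≈wB³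
        (solve 5 (λ y β w B Z → cube (y :* β) :- (Z :* B) :* (w :* (β :* β)) := cube β :* (cube y :- Z) :+ (Z :* (β :* β)) :* (β :- w :* B))
          (λ _ → refl) y β w (B ³) (V Y)))
      (⊛-cong (≈sym Vs≈) wβ²)

    σ≈ : σ ≈ 9 · (τ ⊛ (1# ⊕ 3 · τ ⊕ 3 · (τ ⊛ τ)))
    σ≈ = ≈trans (⊛-congʳ (const (+ 27)) s≈)
      (solve 1 (λ t → 27 :· (t :* (:1 :+ 9 :· t :+ 27 :· (t :* t))) := 9 :· (3 :· t :* (:1 :+ 3 :· (3 :· t) :+ 3 :· (3 :· t :* 3 :· t)))) (λ _ → refl) t)

    τ³≈ : τ ³ ≈ V σ ⊛ (1# ⊕ 3 · τ ⊕ 3 · (τ ⊛ τ))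
    τ³≈ = ≈trans (solve 1 (λ t → cube (3 :· t) := 27 :· cube t) (λ _ → refl) t)
      (≈trans (⊛-congʳ (const (+ 27)) t³≈)
      (≈trans (solve 2 (λ t S → 27 :· (S :* (:1 :+ 9 :· t :+ 27 :· (t :* t))) := 27 :· S :* (:1 :+ 3 :· (3 :· t) :+ 3 :· (3 :· t :* 3 :· t))) (λ _ → refl) t (V s))
        (⊛-congˡ (1# ⊕ 3 · τ ⊕ 3 · (τ ⊛ τ)) (≈sym (V-· 27 s)))))

    a≈X : a ≈ X ⊕ 6 · y
    a≈X = a-split

    -- The common factor of the values of `U₂` on a t and a t².
    λ₂ : Series
    λ₂ = κ ⊛ κ ⊛ (a ⊛ a) ⊛ β ³

    V-poly : ∀ {n} (p : Polynomial n) (ρ : Vec Series n) → V (⟦ p ⟧ ρ) ≈ ⟦ p ⟧ (vmap V ρ)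
    V-poly (op [+] p r) ρ = ≈trans (V-⊕ (⟦ p ⟧ ρ) (⟦ r ⟧ ρ)) (⊕-cong (V-poly p ρ) (V-poly r ρ))
    V-poly (op [*] p r) ρ = ≈trans (V-⊛ (⟦ p ⟧ ρ) (⟦ r ⟧ ρ)) (⊛-cong (V-poly p ρ) (V-poly r ρ))
    V-poly (con c) ρ = V-const c
    V-poly (var i) ρ = V-lookup i ρ
      where
      V-lookup : ∀ {n} (i : Fin n) (ρ : Vec Series n) → V (lookup ρ i) ≈ lookup (vmap V ρ) i
      V-lookup zero       (f ∷ ρ) = ≈refl
      V-lookup (suc i) (f ∷ ρ) = V-lookup i ρ
    V-poly (p :^ n) ρ = V-pow n
      where
      V-pow : ∀ n → V (⟦ p :^ n ⟧ ρ) ≈ ⟦ p :^ n ⟧ (vmap V ρ)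
      V-pow zero    = V-const 1ℤ
      V-pow (suc n) = ≈trans (V-⊛ (⟦ p ⟧ ρ) (⟦ p :^ n ⟧ ρ)) (⊛-cong (V-poly p ρ) (V-pow n))
    V-poly (:- p) ρ = ≈trans (V-⊖ (⟦ p ⟧ ρ)) (⊖-cong (V-poly p ρ))

    -- Dissection coefficients are polynomials in a, Y and β, which V sends to X, y³ and B.
    private
      vars : Vec Series 3
      vars = a ∷ Y ∷ β ∷ []

      A′ Y′ β′ : Polynomial 3
      A′ = var zero
      Y′ = var (suc zero)
      β′ = var (suc (suc zero))

      module PolyDissection {g : Series} (p₀ p₁ p₂ : Polynomial 3)
          (g≈ : g ≈ ⟦ p₀ ⟧ (X ∷ V Y ∷ B ∷ []) ⊕ ⟦ p₁ ⟧ (X ∷ V Y ∷ B ∷ []) ⊛ y ⊕ ⟦ p₂ ⟧ (X ∷ V Y ∷ B ∷ []) ⊛ (y ⊛ y)) =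
        Dissection {g} {⟦ p₀ ⟧ vars} {⟦ p₁ ⟧ vars} {⟦ p₂ ⟧ vars}
          (≈trans g≈ (≈sym (⊕-cong (⊕-cong (V-poly p₀ vars) (⊛-congˡ y (V-poly p₁ vars))) (⊛-congˡ (y ⊛ y) (V-poly p₂ vars)))))

      at≈ : a ⊛ t ≈ 27 · (X ⊛ V Y ⊛ B ³) ⊕ (X ³ ⊕ 54 · V Y) ⊛ B ³ ⊛ y ⊕ 9 · (X ⊛ X ⊛ B ³) ⊛ (y ⊛ y)
      at≈ = ≈trans (⊛-cong a≈X t≈) (lincomb₁ ((27 · X ⊕ 54 · y) ⊛ B ³) y³
        (solve 4 (λ x y z B → (x :+ 6 :· y) :* (y :* (x :* x :+ 3 :· (x :* y) :+ 9 :· (y :* y)) :* cube B)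
             :- (27 :· (x :* z :* cube B) :+ (cube x :+ 54 :· z) :* cube B :* y :+ 9 :· (x :* x :* cube B) :* (y :* y))
             := ((27 :· x :+ 54 :· y) :* cube B) :* (cube y :- z)) (λ _ → refl) X y (V Y) B))

      module AT = PolyDissection {a ⊛ t} (27 :· (A′ :* Y′ :* cube β′)) ((cube A′ :+ 54 :· Y′) :* cube β′) (9 :· (A′ :* A′ :* cube β′)) at≈

      att≈ : a ⊛ (t ⊛ t) ≈ (12 · (X ³ ⊛ X ⊛ V Y) ⊕ 405 · (X ⊛ (V Y ⊛ V Y))) ⊛ (B ³ ⊛ B ³)
                           ⊕ (63 · (X ³ ⊛ V Y) ⊕ 486 · (V Y ⊛ V Y)) ⊛ (B ³ ⊛ B ³) ⊛ y
                           ⊕ (X ³ ⊛ (X ⊛ X) ⊕ 216 · (X ⊛ X ⊛ V Y)) ⊛ (B ³ ⊛ B ³) ⊛ (y ⊛ y)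
      att≈ = ≈trans (⊛-cong a≈X (⊛-cong t≈ t≈))
        (lincomb₁ ((12 · (X ³ ⊛ X) ⊕ 63 · (X ³ ⊛ y) ⊕ 216 · (X ⊛ X ⊛ y ⊛ y) ⊕ (405 · X ⊕ 486 · y) ⊛ (y ³ ⊕ V Y)) ⊛ (B ³ ⊛ B ³)) y³
        (solve 4 (λ x y z B → let b6 = cube B :* cube B ; t = y :* (x :* x :+ 3 :· (x :* y) :+ 9 :· (y :* y)) :* cube B in
              (x :+ 6 :· y) :* (t :* t)
             :- ((12 :· (cube x :* x :* z) :+ 405 :· (x :* (z :* z))) :* b6
                 :+ (63 :· (cube x :* z) :+ 486 :· (z :* z)) :* b6 :* y
                 :+ (cube x :* (x :* x) :+ 216 :· (x :* x :* z)) :* b6 :* (y :* y))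
             := ((12 :· (cube x :* x) :+ 63 :· (cube x :* y) :+ 216 :· (x :* x :* y :* y) :+ (405 :· x :+ 486 :· y) :* (cube y :+ z)) :* b6) :* (cube y :- z))
          (λ _ → refl) X y (V Y) B))

      module ATT = PolyDissection {a ⊛ (t ⊛ t)}
        ((12 :· (cube A′ :* A′ :* Y′) :+ 405 :· (A′ :* (Y′ :* Y′))) :* (cube β′ :* cube β′))
        ((63 :· (cube A′ :* Y′) :+ 486 :· (Y′ :* Y′)) :* (cube β′ :* cube β′))
        ((cube A′ :* (A′ :* A′) :+ 216 :· (A′ :* A′ :* Y′)) :* (cube β′ :* cube β′)) att≈

      module AA = PolyDissection {a} A′ (con (+ 6)) (con 0ℤ)
        (≈trans a≈X (solve 2 (λ x y → x :+ 6 :· y := x :+ con (+ 6) :* y :+ con 0ℤ :* (y :* y)) (λ _ → refl) X y))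

      module BB = PolyDissection {b} A′ (con (-[1+ 2 ])) (con 0ℤ)
        (≈trans (lincomb₁ (const (-[1+ 0 ])) X≈ (solve 3 (λ b x y → b :- (x :+ con (-[1+ 2 ]) :* y) := con (-[1+ 0 ]) :* (x :- (b :+ 3 :· y))) (λ _ → refl) b X y))
          (solve 2 (λ x y → x :+ con (-[1+ 2 ]) :* y := x :+ con (-[1+ 2 ]) :* y :+ con 0ℤ :* (y :* y)) (λ _ → refl) X y))

      btt≈ : b ⊛ (t ⊛ t) ≈ 3 · (X ⊛ V Y ⊛ B ³) ⊕ 9 · (V Y ⊛ B ³) ⊛ y ⊕ X ⊛ X ⊛ B ³ ⊛ (y ⊛ y)
      btt≈ = ≈trans (lincomb₁ (y ⊛ y ⊛ β) bβ (solve 3 (λ b β y → b :* ((y :* β) :* (y :* β)) :- y :* (y :* β) := (y :* y :* β) :* (b :* β :- :1)) (λ _ → refl) b β y))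
        (≈trans (⊛-congʳ y t≈) (lincomb₁ ((3 · X ⊕ 9 · y) ⊛ B ³) y³
        (solve 4 (λ x y z B → y :* (y :* (x :* x :+ 3 :· (x :* y) :+ 9 :· (y :* y)) :* cube B)
             :- (3 :· (x :* z :* cube B) :+ 9 :· (z :* cube B) :* y :+ x :* x :* cube B :* (y :* y))
             := ((3 :· x :+ 9 :· y) :* cube B) :* (cube y :- z)) (λ _ → refl) X y (V Y) B)))

      module BTT = PolyDissection {b ⊛ (t ⊛ t)} (3 :· (A′ :* Y′ :* cube β′)) (9 :· (Y′ :* cube β′)) (A′ :* A′ :* cube β′) btt≈

    U₀a : U₀ a ≈ a
    U₀a = AA.U₀-dissect

    U₀at : U₀ (a ⊛ t) ≈ a ⊛ σ
    U₀at = ≈trans AT.U₀-dissect (solve 3 (λ a z β → 27 :· (a :* z :* cube β) := a :* 27 :· (z :* cube β)) (λ _ → refl) a Y β)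

    -- The cubic identity a³ = b³ + 27Y lowers the degree in a, and b³ cancels against β³. Hence 729
    -- = 405 + 12 × 27; in the same way 2187 = 486 + 63 × 27 for `U₁att` and 243 = 216 + 27 for
    -- `U₂att`.
    U₀att : U₀ (a ⊛ (t ⊛ t)) ≈ a ⊛ (12 · s ⊕ 729 · (s ⊛ s))
    U₀att = ≈trans ATT.U₀-dissect (lincomb₂ (12 · (a ⊛ Y ⊛ (β ³ ⊛ β ³))) a³≈ (12 · (a ⊛ Y ⊛ β ³)) b³β³
      (solve 4 (λ a b z β → (12 :· (cube a :* a :* z) :+ 405 :· (a :* (z :* z))) :* (cube β :* cube β)
           :- a :* (12 :· (z :* cube β) :+ 729 :· (z :* cube β :* (z :* cube β)))
           := 12 :· (a :* z :* (cube β :* cube β)) :* (cube a :- (cube b :+ 27 :· z)) :+ 12 :· (a :* z :* cube β) :* (cube b :* cube β :- :1))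
        (λ _ → refl) a b Y β))

    U₁a : U₁ a ≈ 6 · κ
    U₁a = AA.U₁-dissect

    U₁at : U₁ (a ⊛ t) ≈ κ ⊛ (1# ⊕ 3 · σ)
    U₁at = ≈trans AT.U₁-dissect (lincomb₂ (κ ⊛ β ³) a³≈ κ b³β³
      (solve 5 (λ a b z β k → (cube a :+ 54 :· z) :* cube β :* k :- k :* (:1 :+ 3 :· (27 :· (z :* cube β)))
           := (k :* cube β) :* (cube a :- (cube b :+ 27 :· z)) :+ k :* (cube b :* cube β :- :1))
        (λ _ → refl) a b Y β κ))

    U₁att : U₁ (a ⊛ (t ⊛ t)) ≈ κ ⊛ (63 · s ⊕ 2187 · (s ⊛ s))
    U₁att = ≈trans ATT.U₁-dissect (lincomb₂ (63 · (κ ⊛ Y ⊛ (β ³ ⊛ β ³))) a³≈ (63 · (κ ⊛ Y ⊛ β ³)) b³β³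
      (solve 5 (λ a b z β k → (63 :· (cube a :* z) :+ 486 :· (z :* z)) :* (cube β :* cube β) :* k
           :- k :* (63 :· (z :* cube β) :+ 2187 :· (z :* cube β :* (z :* cube β)))
           := 63 :· (k :* z :* (cube β :* cube β)) :* (cube a :- (cube b :+ 27 :· z)) :+ 63 :· (k :* z :* cube β) :* (cube b :* cube β :- :1))
        (λ _ → refl) a b Y β κ))

    U₂a : U₂ a ≈ const 0ℤ
    U₂a = ≈trans AA.U₂-dissect (≈trans (⊛-comm (const 0ℤ) (κ ⊛ κ)) (⊛-zeroʳ (κ ⊛ κ)))

    U₂at : U₂ (a ⊛ t) ≈ 9 · λ₂
    U₂at = ≈trans AT.U₂-dissect (solve 3 (λ a k β → 9 :· (a :* a :* cube β) :* (k :* k) := 9 :· (k :* k :* (a :* a) :* cube β)) (λ _ → refl) a κ β)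

    U₂att : U₂ (a ⊛ (t ⊛ t)) ≈ λ₂ ⊛ (1# ⊕ 243 · s)
    U₂att = ≈trans ATT.U₂-dissect (lincomb₂ (κ ⊛ κ ⊛ (a ⊛ a) ⊛ (β ³ ⊛ β ³)) a³≈ λ₂ b³β³
      (solve 5 (λ a b z β k → (cube a :* (a :* a) :+ 216 :· (a :* a :* z)) :* (cube β :* cube β) :* (k :* k)
           :- (k :* k :* (a :* a) :* cube β) :* (:1 :+ 243 :· (z :* cube β))
           := (k :* k :* (a :* a) :* (cube β :* cube β)) :* (cube a :- (cube b :+ 27 :· z)) :+ (k :* k :* (a :* a) :* cube β) :* (cube b :* cube β :- :1))
        (λ _ → refl) a b Y β κ))

    U₀b : U₀ b ≈ a
    U₀b = BB.U₀-dissect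

    U₀bt : U₀ (b ⊛ t) ≈ const 0ℤ
    U₀bt = ≈trans (λ n → bt≈y (n * 3)) (λ n → trans (y≈ (n * 3)) (U₀-q· κ n))
      where
      bt≈y : b ⊛ t ≈ y
      bt≈y = lincomb₁ y bβ (solve 3 (λ b β y → b :* (y :* β) :- y := y :* (b :* β :- :1)) (λ _ → refl) b β y)

    U₀btt : U₀ (b ⊛ (t ⊛ t)) ≈ a ⊛ 3 · s
    U₀btt = ≈trans BTT.U₀-dissect (solve 3 (λ a z β → 3 :· (a :* z :* cube β) := a :* 3 :· (z :* cube β)) (λ _ → refl) a Y β)

-- Extraction as an operator on ℤ[σ], with control of the powers of 3.

module CubicOperators where
  open PowerSeries
  open Trisection
  open CubicTheta

  module PolynomialsIn (σ : Series) where

    -- The subring ℤ[σ]. As an inductive predicate it lets statements about linear operators be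
    -- proved by induction on the generation of an element, with no coefficient sequences.
    data Poly : Series → Set where
      con  : ∀ c → Poly (const c)
      _⊞_  : ∀ {f g} → Poly f → Poly g → Poly (f ⊕ g)
      σ⊠_  : ∀ {f} → Poly f → Poly (σ ⊛ f)
      resp : ∀ {f g} → f ≈ g → Poly f → Poly g

    scalar : ∀ c {f} → Poly f → Poly (const c ⊛ f)
    scalar c (con d)    = resp (λ n → const-* n) (con (c *ᶻ d))
      where
      const-* : const (c *ᶻ d) ≈ const c ⊛ const d
      const-* zero    = sym (const-⊛ c (const d) zero)
      const-* (suc n) = sym (trans (const-⊛ c (const d) (suc n)) (ℤₚ.*-zeroʳ c))
    scalar c (_⊞_ {f} {g} p r) = resp (solve 3 (λ c f g → c :* f :+ c :* g := c :* (f :+ g)) (λ _ → refl) (const c) f g) (scalar c p ⊞ scalar c r)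
    scalar c (σ⊠_ {f} p) = resp (solve 3 (λ c s f → s :* (c :* f) := c :* (s :* f)) (λ _ → refl) (const c) σ f) (σ⊠ scalar c p)
    scalar c (resp e p) = resp (⊛-congʳ (const c) e) (scalar c p)

    -- Isolates the constant term, whose contribution has to be computed exactly; the rest brings
    -- one more σ and with it enough powers of 3.
    horner : ∀ {f} → Poly f → Σ[ c ∈ ℤ ] Σ[ h ∈ Series ] Poly h × f ≈ const c ⊕ σ ⊛ h
    horner (con c) = c , const 0ℤ , con 0ℤ , solve 2 (λ c s → c := c :+ s :* con 0ℤ) (λ _ → refl) (const c) σ
    horner (p ⊞ r) with horner p | horner r
    ... | c , h , ph , e | d , k , pk , e′ = c +ᶻ d , h ⊕ k , ph ⊞ pk , ≈trans (⊕-cong e e′)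
      (≈trans (solve 5 (λ c d s h k → (c :+ s :* h) :+ (d :+ s :* k) := (c :+ d) :+ s :* (h :+ k)) (λ _ → refl) (const c) (const d) σ h k)
        (⊕-cong (≈sym (const-⊕ c d)) ≈refl))
    horner (σ⊠_ {f} p) = 0ℤ , f , p , solve 1 (λ x → x := con 0ℤ :+ x) (λ _ → refl) (σ ⊛ f)
    horner (resp e p) with horner p
    ... | c , h , ph , e′ = c , h , ph , ≈trans (≈sym e) e′

    Span : Series → Series → Set
    Span g f = Σ[ h ∈ Series ] Poly h × f ≈ g ⊛ h

    span-resp : ∀ {g f f′} → f ≈ f′ → Span g f → Span g f′
    span-resp p (h , ph , e) = h , ph , ≈trans (≈sym p) e

    span-⊕ : ∀ {g f f′} → Span g f → Span g f′ → Span g (f ⊕ f′)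
    span-⊕ {g} (h , ph , e) (k , pk , e′) = h ⊕ k , ph ⊞ pk ,
      ≈trans (⊕-cong e e′) (solve 3 (λ g h k → g :* h :+ g :* k := g :* (h :+ k)) (λ _ → refl) g h k)

    span-scale : ∀ {g} c {f} → Span g f → Span g (const c ⊛ f)
    span-scale {g} c (h , ph , e) = const c ⊛ h , scalar c ph ,
      ≈trans (⊛-congʳ (const c) e) (solve 3 (λ c g h → c :* (g :* h) := g :* (c :* h)) (λ _ → refl) (const c) g h)

    span-σ : ∀ {g f} → Span g f → Span (g ⊛ σ) (σ ⊛ f)
    span-σ {g} (h , ph , e) = h , ph , ≈trans (⊛-congʳ σ e) (solve 3 (λ s g h → s :* (g :* h) := (g :* s) :* h) (λ _ → refl) σ g h)

    span-weaken : ∀ {g f} → Span (g ⊛ σ) f → Span g f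
    span-weaken {g} (h , ph , e) = σ ⊛ h , σ⊠ ph , ≈trans e (⊛-assoc g σ h)

  module CubicOperator
    (t τ σ : Series) (τ≈ : τ ≈ 3 · t)
    (σ≈ : σ ≈ 9 · (τ ⊛ (1# ⊕ 3 · τ ⊕ 3 · (τ ⊛ τ))))
    (τ³≈ : τ ³ ≈ V σ ⊛ (1# ⊕ 3 · τ ⊕ 3 · (τ ⊛ τ)))
    (U : Series → Series) (U-cong : ∀ {f g} → f ≈ g → U f ≈ U g)
    (U-⊕ : ∀ f g → U (f ⊕ g) ≈ U f ⊕ U g) (U-V⊛ : ∀ f g → U (V f ⊛ g) ≈ f ⊛ U g)
    (m : Series) where

    L : Series → Series
    L h = U (m ⊛ h)

    L-cong : ∀ {h k} → h ≈ k → L h ≈ L k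
    L-cong p = U-cong (⊛-congʳ m p)

    L-⊕ : ∀ h k → L (h ⊕ k) ≈ L h ⊕ L k
    L-⊕ h k = ≈trans (U-cong (solve 3 (λ m h k → m :* (h :+ k) := m :* h :+ m :* k) (λ _ → refl) m h k)) (U-⊕ (m ⊛ h) (m ⊛ k))

    L-V : ∀ f h → L (V f ⊛ h) ≈ f ⊛ L h
    L-V f h = ≈trans (U-cong (solve 3 (λ m f h → m :* (f :* h) := f :* (m :* h)) (λ _ → refl) m (V f) h)) (U-V⊛ f (m ⊛ h))

    L-const : ∀ c h → L (const c ⊛ h) ≈ const c ⊛ L h
    L-const c h = ≈trans (L-cong (⊛-congˡ h (≈sym (V-const c)))) (L-V (const c) h)

    -- `p·` is multiplication by 1 + 3τ + 3τ², the factor common to σ = 9τ (1 + 3τ + 3τ²) and τ³ = V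
    -- σ (1 + 3τ + 3τ²).
    τ₁ τ₂ τ₃ p· : Series → Series
    τ₁ h = τ ⊛ h
    τ₂ h = τ ⊛ (τ ⊛ h)
    τ₃ h = τ ⊛ (τ ⊛ (τ ⊛ h))
    p· h = h ⊕ 3 · τ₁ h ⊕ 3 · τ₂ h

    L-p : ∀ h → L (p· h) ≈ L h ⊕ 3 · L (τ₁ h) ⊕ 3 · L (τ₂ h)
    L-p h = ≈trans (L-⊕ (h ⊕ 3 · τ₁ h) (3 · τ₂ h))
      (⊕-cong (≈trans (L-⊕ h (3 · τ₁ h)) (⊕-congʳ (L h) (L-const (+ 3) (τ₁ h)))) (L-const (+ 3) (τ₂ h)))

    -- The factor V σ of τ³ leaves the extraction as σ. So the values of `L` at 1, τ and τ²
    -- determine all others by a recursion of order three.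
    L-τ₃ : ∀ h → L (τ₃ h) ≈ σ ⊛ (L h ⊕ 3 · L (τ₁ h) ⊕ 3 · L (τ₂ h))
    L-τ₃ h = ≈trans (L-cong (lincomb₁ h τ³≈ (solve 3 (λ t h v → t :* (t :* (t :* h)) :- v :* (h :+ 3 :· (t :* h) :+ 3 :· (t :* (t :* h)))
        := h :* (cube t :- v :* (:1 :+ 3 :· t :+ 3 :· (t :* t)))) (λ _ → refl) τ h (V σ))))
      (≈trans (L-V σ (p· h)) (⊛-congʳ σ (L-p h)))

    σ⊛≈ : ∀ h → σ ⊛ h ≈ 9 · τ₁ (p· h)
    σ⊛≈ h = lincomb₁ h σ≈ (solve 3 (λ s t h → s :* h :- 9 :· (t :* (h :+ 3 :· (t :* h) :+ 3 :· (t :* (t :* h))))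
        := h :* (s :- 9 :· (t :* (:1 :+ 3 :· t :+ 3 :· (t :* t))))) (λ _ → refl) σ τ h)

    -- Trading t for τ = 3t consumes one of the two factors 3 of σ; in exchange τ² appears instead
    -- of τ.
    tσ⊛≈ : ∀ h → t ⊛ (σ ⊛ h) ≈ 3 · τ₂ (p· h)
    tσ⊛≈ h = ≈trans (⊛-congʳ t (σ⊛≈ h)) (lincomb₁ (⊖ (3 · τ₁ (p· h))) τ≈
      (solve 3 (λ t τ k → t :* 9 :· (τ :* k) :- 3 :· (τ :* (τ :* k)) := (:- (3 :· (τ :* k))) :* (τ :- 3 :· t)) (λ _ → refl) t τ (p· h)))

    module Values {A₀ A₁ A₂ : Series} (L₀ : L 1# ≈ A₀) (L₁ : L (τ₁ 1#) ≈ A₁) (L₂ : L (τ₂ 1#) ≈ A₂) where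
      A₃ A₄ : Series
      A₃ = σ ⊛ (A₀ ⊕ 3 · A₁ ⊕ 3 · A₂)
      A₄ = σ ⊛ (A₁ ⊕ 3 · A₂ ⊕ 3 · A₃)

      private
        comb : ∀ {x y z x′ y′ z′} → x ≈ x′ → y ≈ y′ → z ≈ z′ → x ⊕ 3 · y ⊕ 3 · z ≈ x′ ⊕ 3 · y′ ⊕ 3 · z′
        comb p r u = ⊕-cong (⊕-cong p (⊛-congʳ (const (+ 3)) r)) (⊛-congʳ (const (+ 3)) u)

      L₃ : L (τ₃ 1#) ≈ A₃
      L₃ = ≈trans (L-τ₃ 1#) (⊛-congʳ σ (comb L₀ L₁ L₂))

      L₄ : L (τ₃ (τ₁ 1#)) ≈ A₄
      L₄ = ≈trans (L-τ₃ (τ₁ 1#)) (⊛-congʳ σ (comb L₁ L₂ L₃))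

      private
        τ-p : ∀ h → τ₁ (p· h) ≈ p· (τ₁ h)
        τ-p h = solve 2 (λ t h → t :* (h :+ 3 :· (t :* h) :+ 3 :· (t :* (t :* h))) := (t :* h) :+ 3 :· (t :* (t :* h)) :+ 3 :· (t :* (t :* (t :* h)))) (λ _ → refl) τ h

      Lσ : L (σ ⊛ 1#) ≈ 9 · (A₁ ⊕ 3 · A₂ ⊕ 3 · A₃)
      Lσ = ≈trans (L-cong (σ⊛≈ 1#)) (≈trans (L-const (+ 9) (τ₁ (p· 1#))) (⊛-congʳ (const (+ 9))
        (≈trans (L-cong (τ-p 1#)) (≈trans (L-p (τ₁ 1#)) (comb L₁ L₂ L₃)))))

      Ltσ : L (t ⊛ (σ ⊛ 1#)) ≈ 3 · (A₂ ⊕ 3 · A₃ ⊕ 3 · A₄)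
      Ltσ = ≈trans (L-cong (tσ⊛≈ 1#)) (≈trans (L-const (+ 3) (τ₂ (p· 1#))) (⊛-congʳ (const (+ 3))
        (≈trans (L-cong (≈trans (⊛-congʳ τ (τ-p 1#)) (τ-p (τ₁ 1#)))) (≈trans (L-p (τ₂ 1#)) (comb L₂ L₃ L₄)))))

    open PolynomialsIn σ

    module Descent (g₀ g₁ g₂ : Series)
      (g₁⊂g₀ : ∀ {f} → Span g₁ f → Span g₀ f) (g₂⊂g₁ : ∀ {f} → Span g₂ f → Span g₁ f) (σg₀⊂g₂ : ∀ {f} → Span g₀ f → Span g₂ (σ ⊛ f))
      (base₀ : Span g₀ (L 1#)) (base₁ : Span g₁ (L (τ₁ 1#))) (base₂ : Span g₂ (L (τ₂ 1#))) where

      -- The three conditions follow the filtration g₀ ⊇ g₁ ⊇ g₂ ⊇ σ g₀ of spans. Multiplication by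
      -- τ moves each condition one place, and the recursion for τ³ refills the last place because
      -- it produces σ g₀. Thus goodness passes from 1 to all of ℤ[σ].
      Good : Series → Set
      Good h = Span g₀ (L h) × Span g₁ (L (τ₁ h)) × Span g₂ (L (τ₂ h))

      good-resp : ∀ {h k} → h ≈ k → Good h → Good k
      good-resp p (c₀ , c₁ , c₂) = span-resp (L-cong p) c₀ , span-resp (L-cong (⊛-congʳ τ p)) c₁ , span-resp (L-cong (⊛-congʳ τ (⊛-congʳ τ p))) c₂

      good-⊕ : ∀ {h k} → Good h → Good k → Good (h ⊕ k)
      good-⊕ {h} {k} (c₀ , c₁ , c₂) (d₀ , d₁ , d₂) =
        span-resp (≈sym (L-⊕ h k)) (span-⊕ c₀ d₀) ,
        span-resp (≈sym (≈trans (L-cong (solve 3 (λ t h k → t :* (h :+ k) := t :* h :+ t :* k) (λ _ → refl) τ h k)) (L-⊕ (τ₁ h) (τ₁ k)))) (span-⊕ c₁ d₁) ,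
        span-resp (≈sym (≈trans (L-cong (solve 3 (λ t h k → t :* (t :* (h :+ k)) := t :* (t :* h) :+ t :* (t :* k)) (λ _ → refl) τ h k)) (L-⊕ (τ₂ h) (τ₂ k)))) (span-⊕ c₂ d₂)

      good-scale : ∀ c {h} → Good h → Good (const c ⊛ h)
      good-scale c {h} (c₀ , c₁ , c₂) =
        span-resp (≈sym (L-const c h)) (span-scale c c₀) ,
        span-resp (≈sym (≈trans (L-cong (solve 3 (λ t c h → t :* (c :* h) := c :* (t :* h)) (λ _ → refl) τ (const c) h)) (L-const c (τ₁ h)))) (span-scale c c₁) ,
        span-resp (≈sym (≈trans (L-cong (solve 3 (λ t c h → t :* (t :* (c :* h)) := c :* (t :* (t :* h))) (λ _ → refl) τ (const c) h)) (L-const c (τ₂ h)))) (span-scale c c₂)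

      good-τ : ∀ {h} → Good h → Good (τ₁ h)
      good-τ {h} (c₀ , c₁ , c₂) = g₁⊂g₀ c₁ , g₂⊂g₁ c₂ , span-resp (≈sym (L-τ₃ h))
        (σg₀⊂g₂ (span-⊕ (span-⊕ c₀ (span-scale (+ 3) (g₁⊂g₀ c₁))) (span-scale (+ 3) (g₁⊂g₀ (g₂⊂g₁ c₂)))))

      good-p : ∀ {h} → Good h → Good (p· h)
      good-p d = good-⊕ (good-⊕ d (good-scale (+ 3) (good-τ d))) (good-scale (+ 3) (good-τ (good-τ d)))

      good : ∀ {h} → Poly h → Good h
      good (con c) = good-resp (solve 1 (λ c → c :* :1 := c) (λ _ → refl) (const c)) (good-scale c (base₀ , base₁ , base₂))
      good (p ⊞ r) = good-⊕ (good p) (good r)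
      good (σ⊠_ {h} p) = good-resp (≈sym (σ⊛≈ h)) (good-scale (+ 9) (good-τ (good-p (good p))))
      good (resp e p) = good-resp e (good p)

      opaque
        -- For h = c + σ k the second term is σ² k = 81 τ² (1 + 3τ + 3τ²)² k. Its τ² places the
        -- image in the smallest span g₂, so only the value at σ is left to evaluate.
        L-σ⊛ : ∀ {h} → Poly h → Σ[ c ∈ ℤ ] Σ[ z ∈ Series ] Span g₂ z × L (σ ⊛ h) ≈ const c ⊛ L (σ ⊛ 1#) ⊕ 81 · z
        L-σ⊛ {h} ph with horner ph
        ... | c , k , pk , e = c , L (τ₂ (p· (p· k))) , proj₂ (proj₂ (good-p (good-p (good pk)))) ,
          ≈trans (L-cong (≈trans (⊛-congʳ σ e) (≈trans
              (solve 3 (λ s c k → s :* (c :+ s :* k) := c :* (s :* :1) :+ s :* (s :* k)) (λ _ → refl) σ (const c) k)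
              (⊕-congʳ (const c ⊛ (σ ⊛ 1#)) (≈trans (⊛-congʳ σ (σ⊛≈ k)) (≈trans (σ⊛≈ (9 · τ₁ (p· k)))
                (solve 2 (λ t u → 9 :· (t :* (9 :· (t :* u) :+ 3 :· (t :* 9 :· (t :* u)) :+ 3 :· (t :* (t :* 9 :· (t :* u)))))
                            := 81 :· (t :* (t :* (u :+ 3 :· (t :* u) :+ 3 :· (t :* (t :* u)))))) (λ _ → refl) τ (p· k))))))))
            (≈trans (L-⊕ (const c ⊛ (σ ⊛ 1#)) (81 · τ₂ (p· (p· k)))) (⊕-cong (L-const c (σ ⊛ 1#)) (L-const (+ 81) (τ₂ (p· (p· k))))))

        -- Here the second term is t σ² k = 27 τ³ (1 + 3τ + 3τ²)² k.
        L-tσ⊛ : ∀ {h} → Poly h → Σ[ c ∈ ℤ ] Σ[ z ∈ Series ] Span g₂ z × L (t ⊛ (σ ⊛ h)) ≈ const c ⊛ L (t ⊛ (σ ⊛ 1#)) ⊕ 27 · z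
        L-tσ⊛ {h} ph with horner ph
        ... | c , k , pk , e = c , L (τ₂ (τ₁ (p· (p· k)))) , proj₂ (proj₂ (good-τ (good-p (good-p (good pk))))) ,
          ≈trans (L-cong (≈trans (⊛-congʳ t (⊛-congʳ σ e)) (≈trans
              (solve 4 (λ t s c k → t :* (s :* (c :+ s :* k)) := c :* (t :* (s :* :1)) :+ t :* (s :* (s :* k))) (λ _ → refl) t σ (const c) k)
              (⊕-congʳ (const c ⊛ (t ⊛ (σ ⊛ 1#))) (≈trans (⊛-congʳ t (⊛-congʳ σ (σ⊛≈ k))) (≈trans (tσ⊛≈ (9 · τ₁ (p· k)))
                (solve 2 (λ t u → 3 :· (t :* (t :* (9 :· (t :* u) :+ 3 :· (t :* 9 :· (t :* u)) :+ 3 :· (t :* (t :* 9 :· (t :* u))))))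
                            := 27 :· (t :* (t :* (t :* (u :+ 3 :· (t :* u) :+ 3 :· (t :* (t :* u))))))) (λ _ → refl) τ (p· k))))))))
            (≈trans (L-⊕ (const c ⊛ (t ⊛ (σ ⊛ 1#))) (27 · τ₂ (τ₁ (p· (p· k))))) (⊕-cong (L-const c (t ⊛ (σ ⊛ 1#))) (L-const (+ 27) (τ₂ (τ₁ (p· (p· k)))))))

-- The powers of 3 gained along the iterated extractions.

module Congruences where
  open PowerSeries
  open Trisection
  open CubicTheta
  open CubicOperators

  ·-· : ∀ m n f → m · (n · f) ≈ (m * n) · f
  ·-· m n f = ≈trans (≈sym (⊛-assoc (const (+ m)) (const (+ n)) f)) (⊛-congˡ f λ i →
    trans (const-⊛ (+ m) (const (+ n)) i) (const-* i))
    where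
    const-* : ∀ i → + m *ᶻ const (+ n) i ≡ const (+ (m * n)) i
    const-* zero    = sym (ℤₚ.pos-* m n)
    const-* (suc i) = ℤₚ.*-zeroʳ (+ m)

  divides-coefficient : ∀ m f g → f ≈ m · g → ∀ n → m ∣ ∣ f n ∣
  divides-coefficient m f g p n = divides ∣ g n ∣ (trans (cong ∣_∣ (trans (p n) (const-⊛ (+ m) g n)))
    (trans (ℤₚ.abs-* (+ m) (g n)) (ℕₚ.*-comm m ∣ g n ∣)))

  U₀-q⊛ : ∀ f → U₀ (q ⊛ f) ≈ q ⊛ U₂ f
  U₀-q⊛ f = ≈trans (λ n → q⊛ f (n * 3)) (≈trans (λ { zero → refl ; (suc n) → refl }) (≈sym (q⊛ (U₂ f))))

  module Divisibility
    (C a κ Φ : Series)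
    (C₀ : C 0 ≡ 1ℤ)
    (C-split : C ≈ V C ³ ⊛ κ)
    (a-split : a ≈ V a ⊕ 6 · (q ⊛ V κ))
    (C³-split : C ³ ⊛ (V a ⊝ 3 · (q ⊛ V κ)) ≈ V C)
    (Φ≈ : Φ ≈ (C ³) ³ ⊛ (a ³ ⊛ V a ⊕ 54 · (a ⊛ (q ⊛ κ ³)) ⊕ 162 · (q ⊛ κ ³ ⊛ (q ⊛ V κ))))
    where

    open CubicTheory C a κ C₀ C-split a-split C³-split
    open PolynomialsIn σ

    module Op₀ (m : Series) = CubicOperator t τ σ ≈refl σ≈ τ³≈ U₀ (λ p n → p (n * 3)) U₀-⊕ U₀-V⊛ m
    module Op₁ = CubicOperator t τ σ ≈refl σ≈ τ³≈ U₁ (λ p n → p (suc (n * 3))) U₁-⊕ U₁-V⊛ a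
    module Op₂ = CubicOperator t τ σ ≈refl σ≈ τ³≈ U₂ (λ p n → p (suc (suc (n * 3)))) U₂-⊕ U₂-V⊛ a

    τ₁≈ : τ ⊛ 1# ≈ const (+ 3) ⊛ t
    τ₁≈ = solve 1 (λ t → 3 :· t :* :1 := 3 :· t) (λ _ → refl) t

    τ₂≈ : τ ⊛ (τ ⊛ 1#) ≈ const (+ 9) ⊛ (t ⊛ t)
    τ₂≈ = solve 1 (λ t → 3 :· t :* (3 :· t :* :1) := 9 :· (t :* t)) (λ _ → refl) t

    ⊛1 : ∀ f → f ⊛ 1# ≈ f
    ⊛1 = solve 1 (λ f → f :* :1 := f) (λ _ → refl)

    module Level₀ where
      open Op₀ a
      L₀ : L 1# ≈ a
      L₀ = ≈trans (λ n → ⊛1 a (n * 3)) U₀a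
      L₁ : L (τ₁ 1#) ≈ 3 · (a ⊛ σ)
      L₁ = ≈trans (L-cong τ₁≈) (≈trans (L-const (+ 3) t) (⊛-congʳ (const (+ 3)) U₀at))
      L₂ : L (τ₂ 1#) ≈ a ⊛ (4 · σ ⊕ 9 · (σ ⊛ σ))
      L₂ = ≈trans (L-cong τ₂≈) (≈trans (L-const (+ 9) (t ⊛ t)) (≈trans (⊛-congʳ (const (+ 9)) U₀att)
        (solve 2 (λ a s → 9 :· (a :* (12 :· s :+ 729 :· (s :* s))) := a :* (4 :· 27 :· s :+ 9 :· (27 :· s :* 27 :· s))) (λ _ → refl) a s)))
      open Values L₀ L₁ L₂
      aσ : Series
      aσ = a ⊛ σ
      open Descent a aσ aσ span-weaken (λ p → p) span-σ
        (1# , con 1ℤ , ≈trans L₀ (≈sym (⊛1 a)))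
        (const (+ 3) , con (+ 3) , ≈trans L₁ (⊛-comm (const (+ 3)) aσ))
        (const (+ 4) ⊕ σ ⊛ const (+ 9) , con (+ 4) ⊞ (σ⊠ con (+ 9)) , ≈trans L₂
          (solve 2 (λ a s → a :* (4 :· s :+ 9 :· (s :* s)) := a :* s :* (con (+ 4) :+ s :* con (+ 9))) (λ _ → refl) a σ))

      opaque
        -- The remainder in `L-σ⊛` already carries 81. The image of σ is 9 (A₁ + 3A₂ + 3A₃), and the
        -- bracket equals a σ (18 + 90σ + 81σ²), which provides the missing 9.
        Uσ : ∀ {h} → Poly h → Σ[ k ∈ Series ] Poly k × U₀ (a ⊛ (σ ⊛ h)) ≈ 81 · (a ⊛ (σ ⊛ k))
        Uσ ph = let c , z , (k , pk , e) , e′ = L-σ⊛ ph in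
          const c ⊛ u ⊕ k , scalar c pu ⊞ pk , ≈trans e′
          (≈trans (⊕-cong (⊛-congʳ (const c) Lσ) (⊛-congʳ (const (+ 81)) e))
            (solve 4 (λ a s c k → c :* 9 :· (3 :· (a :* s) :+ 3 :· (a :* (4 :· s :+ 9 :· (s :* s)))
                  :+ 3 :· (s :* (a :+ 3 :· 3 :· (a :* s) :+ 3 :· (a :* (4 :· s :+ 9 :· (s :* s)))))) :+ 81 :· (a :* s :* k)
                := 81 :· (a :* (s :* (c :* (con (+ 2) :+ s :* (con (+ 10) :+ s :* con (+ 9))) :+ k)))) (λ _ → refl) a σ (const c) k))
          where
          u : Series
          u = const (+ 2) ⊕ σ ⊛ (const (+ 10) ⊕ σ ⊛ const (+ 9))
          pu : Poly u
          pu = con (+ 2) ⊞ (σ⊠ (con (+ 10) ⊞ (σ⊠ con (+ 9))))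

      opaque
        Utσ : ∀ {h} → Poly h → Σ[ k ∈ Series ] Poly k × U₀ (a ⊛ (t ⊛ (σ ⊛ h))) ≈ 3 · (a ⊛ (σ ⊛ k))
        Utσ ph = let c , z , (k , pk , e) , e′ = L-tσ⊛ ph in
          const c ⊛ u ⊕ const (+ 9) ⊛ k , scalar c pu ⊞ scalar (+ 9) pk , ≈trans e′
          (≈trans (⊕-cong (⊛-congʳ (const c) Ltσ) (⊛-congʳ (const (+ 27)) e))
            (solve 4 (λ a s c k → let A₁ = 3 :· (a :* s) ; A₂ = a :* (4 :· s :+ 9 :· (s :* s)) ; A₃ = s :* (a :+ 3 :· A₁ :+ 3 :· A₂) ; A₄ = s :* (A₁ :+ 3 :· A₂ :+ 3 :· A₃) in
                c :* 3 :· (A₂ :+ 3 :· A₃ :+ 3 :· A₄) :+ 27 :· (a :* s :* k)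
                := 3 :· (a :* (s :* (c :* (con (+ 7) :+ s :* (con (+ 126) :+ s :* (con (+ 351) :+ s :* con (+ 243)))) :+ con (+ 9) :* k)))) (λ _ → refl) a σ (const c) k))
          where
          u : Series
          -- The leading coefficient 7 = 4 + 3 comes from A₂ and 3A₃. It is prime to 3, so this
          -- extraction gains a single 3.
          u = const (+ 7) ⊕ σ ⊛ (const (+ 126) ⊕ σ ⊛ (const (+ 351) ⊕ σ ⊛ const (+ 243)))
          pu : Poly u
          pu = con (+ 7) ⊞ (σ⊠ (con (+ 126) ⊞ (σ⊠ (con (+ 351) ⊞ (σ⊠ con (+ 243))))))

    module Level₁ where
      open Op₁
      L₀ : L 1# ≈ 6 · κ
      L₀ = ≈trans (λ n → ⊛1 a (suc (n * 3))) U₁a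
      L₁ : L (τ₁ 1#) ≈ 3 · (κ ⊛ (1# ⊕ 3 · σ))
      L₁ = ≈trans (L-cong τ₁≈) (≈trans (L-const (+ 3) t) (⊛-congʳ (const (+ 3)) U₁at))
      L₂ : L (τ₂ 1#) ≈ 3 · (κ ⊛ (7 · σ ⊕ 9 · (σ ⊛ σ)))
      L₂ = ≈trans (L-cong τ₂≈) (≈trans (L-const (+ 9) (t ⊛ t)) (≈trans (⊛-congʳ (const (+ 9)) U₁att)
        (solve 2 (λ k s → 9 :· (k :* (63 :· s :+ 2187 :· (s :* s))) := 3 :· (k :* (7 :· 27 :· s :+ 9 :· (27 :· s :* 27 :· s)))) (λ _ → refl) κ s)))
      open Values L₀ L₁ L₂
      open Descent (3 · κ) (3 · κ) (3 · κ ⊛ σ) (λ p → p) span-weaken span-σ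
        (const (+ 2) , con (+ 2) , ≈trans L₀ (solve 1 (λ k → 6 :· k := 3 :· k :* con (+ 2)) (λ _ → refl) κ))
        (const (+ 1) ⊕ σ ⊛ const (+ 3) , con (+ 1) ⊞ (σ⊠ con (+ 3)) , ≈trans L₁
          (solve 2 (λ k s → 3 :· (k :* (:1 :+ 3 :· s)) := 3 :· k :* (:1 :+ s :* con (+ 3))) (λ _ → refl) κ σ))
        (const (+ 7) ⊕ σ ⊛ const (+ 9) , con (+ 7) ⊞ (σ⊠ con (+ 9)) , ≈trans L₂
          (solve 2 (λ k s → 3 :· (k :* (7 :· s :+ 9 :· (s :* s))) := 3 :· k :* s :* (con (+ 7) :+ s :* con (+ 9))) (λ _ → refl) κ σ))

      opaque
        -- The image of t σ begins with 3 (21 + 45 + 9) κσ = 225 κσ, and σ = 27s turns this into 243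
        -- × 25 κs. The remainder 27 × 3 κσ carries 3⁷.
        Utσ : ∀ {h} → Poly h → Σ[ z ∈ Series ] U₁ (a ⊛ (t ⊛ (σ ⊛ h))) ≈ 243 · z
        Utσ ph = let c , z , (k , pk , e) , e′ = L-tσ⊛ ph in
          κ ⊛ s ⊛ (const c ⊛ (const (+ 25) ⊕ 216 · σ ⊕ 432 · (σ ⊛ σ) ⊕ 243 · σ ³) ⊕ 9 · k) , ≈trans e′
          (≈trans (⊕-cong (⊛-congʳ (const c) Ltσ) (⊛-congʳ (const (+ 27)) e))
            (solve 4 (λ κ s′ c k → let s = 27 :· s′ ; A₀ = 6 :· κ ; A₁ = 3 :· (κ :* (:1 :+ 3 :· s)) ; A₂ = 3 :· (κ :* (7 :· s :+ 9 :· (s :* s))) ; A₃ = s :* (A₀ :+ 3 :· A₁ :+ 3 :· A₂) ; A₄ = s :* (A₁ :+ 3 :· A₂ :+ 3 :· A₃) in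
                c :* 3 :· (A₂ :+ 3 :· A₃ :+ 3 :· A₄) :+ 27 :· (3 :· κ :* s :* k)
                := 243 :· (κ :* s′ :* (c :* (con (+ 25) :+ 216 :· s :+ 432 :· (s :* s) :+ 243 :· cube s) :+ 9 :· k))) (λ _ → refl) κ s (const c) k))

    module Level₂ where
      open Op₂
      L₀ : L 1# ≈ const 0ℤ
      L₀ = ≈trans (λ n → ⊛1 a (suc (suc (n * 3)))) U₂a
      L₁ : L (τ₁ 1#) ≈ 27 · λ₂
      L₁ = ≈trans (L-cong τ₁≈) (≈trans (L-const (+ 3) t) (≈trans (⊛-congʳ (const (+ 3)) U₂at) (·-· 3 9 λ₂)))
      L₂ : L (τ₂ 1#) ≈ 9 · (λ₂ ⊛ (1# ⊕ 9 · σ))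
      L₂ = ≈trans (L-cong τ₂≈) (≈trans (L-const (+ 9) (t ⊛ t)) (≈trans (⊛-congʳ (const (+ 9)) U₂att)
        (solve 2 (λ k s → 9 :· (k :* (:1 :+ 243 :· s)) := 9 :· (k :* (:1 :+ 9 :· 27 :· s))) (λ _ → refl) λ₂ s)))
      open Values L₀ L₁ L₂
      open Descent (9 · λ₂) (9 · λ₂) (9 · λ₂) (λ p → p) (λ p → p) (λ p → span-weaken (span-σ p))
        (const 0ℤ , con 0ℤ , ≈trans L₀ (solve 1 (λ k → con 0ℤ := 9 :· k :* con 0ℤ) (λ _ → refl) λ₂))
        (const (+ 3) , con (+ 3) , ≈trans L₁ (solve 1 (λ k → 27 :· k := 9 :· k :* con (+ 3)) (λ _ → refl) λ₂))
        (const (+ 1) ⊕ σ ⊛ const (+ 9) , con (+ 1) ⊞ (σ⊠ con (+ 9)) , ≈trans L₂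
          (solve 2 (λ k s → 9 :· (k :* (:1 :+ 9 :· s)) := 9 :· k :* (:1 :+ s :* con (+ 9))) (λ _ → refl) λ₂ σ))

      opaque
        -- In this class no σ can be split off, so the power of 3 must come from the numbers: the
        -- image of σ begins with 9 (27 + 27) λ₂ = 243 × 2 λ₂, and the remainder has 81 × 9.
        Uσ : ∀ {h} → Poly h → Σ[ z ∈ Series ] U₂ (a ⊛ (σ ⊛ h)) ≈ 243 · z
        Uσ ph = let c , z , (k , pk , e) , e′ = L-σ⊛ ph in
          λ₂ ⊛ (const c ⊛ (const (+ 2) ⊕ 21 · σ ⊕ 27 · (σ ⊛ σ)) ⊕ 3 · k) , ≈trans e′
          (≈trans (⊕-cong (⊛-congʳ (const c) Lσ) (⊛-congʳ (const (+ 81)) e))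
            (solve 4 (λ l s c k → let A₁ = 27 :· l ; A₂ = 9 :· (l :* (:1 :+ 9 :· s)) ; A₃ = s :* (con 0ℤ :+ 3 :· A₁ :+ 3 :· A₂) in
                c :* 9 :· (A₁ :+ 3 :· A₂ :+ 3 :· A₃) :+ 81 :· (9 :· l :* k)
                := 243 :· (l :* (c :* (con (+ 2) :+ 21 :· s :+ 27 :· (s :* s)) :+ 3 :· k))) (λ _ → refl) λ₂ σ (const c) k))

    bt≈y : b ⊛ t ≈ y
    bt≈y = lincomb₁ y bβ (solve 3 (λ b β y → b :* (y :* β) :- y := y :* (b :* β :- :1)) (λ _ → refl) b β y)

    -- The theta series of A₈ divided by b⁴.
    P : Series
    P = 1# ⊕ 28 · τ ⊕ 162 · (τ ⊛ τ) ⊕ 324 · τ ³ ⊕ 243 · (τ ³ ⊛ τ)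

    -- Since C³ b = C(q³), three of the four factors b turn C⁹ into C(q³)³, a series in q³ that
    -- passes through the extraction. One factor b remains.
    Φ≈bP : Φ ≈ V (C ³) ⊛ (b ⊛ P)
    Φ≈bP = ≈trans Φ≈ (≈trans (⊛-congʳ ((C ³) ³) θ≈)
      (≈trans (lincomb₁ (V C ³ ⊛ b ⊛ P ⊛ (e ³ ⊛ C ³ ⊛ (e ³ ⊛ C ³) ⊕ e ³ ⊛ C ³ ⊕ 1#)) e³C³
            (solve 5 (λ e c c′ b p → cube c :* (cube (c′ :* e) :* (b :* p)) :- cube c′ :* (b :* p)
                := (cube c′ :* b :* p :* (e :* c :* (e :* c) :+ e :* c :+ :1)) :* (e :* c :- :1)) (λ _ → refl) (e ³) (C ³) (V C) b P))
        (⊛-congˡ (b ⊛ P) (≈sym (V³ C)))))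
      where
      a≈bt : a ≈ b ⊛ (1# ⊕ 9 · t)
      a≈bt = lincomb₂ 1# a≈ (const (-[1+ 8 ])) bt≈y
        (solve 4 (λ a b t y → a :- b :* (:1 :+ 9 :· t) := :1 :* (a :- (b :+ 9 :· y)) :+ con (-[1+ 8 ]) :* (b :* t :- y)) (λ _ → refl) a b t y)
      X≈bt : X ≈ b ⊛ (1# ⊕ 3 · t)
      X≈bt = lincomb₂ 1# X≈ (const (-[1+ 2 ])) bt≈y
        (solve 4 (λ a b t y → a :- b :* (:1 :+ 3 :· t) := :1 :* (a :- (b :+ 3 :· y)) :+ con (-[1+ 2 ]) :* (b :* t :- y)) (λ _ → refl) X b t y)
      Y≈bt : Y ≈ b ³ ⊛ (t ⊛ (1# ⊕ 9 · t ⊕ 27 · (t ⊛ t)))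
      Y≈bt = ≈trans (lincomb₁ (⊖ Y) b³β³ (solve 3 (λ z b β → z :- b :* (z :* β) := (:- z) :* (b :* β :- :1)) (λ _ → refl) Y (b ³) (β ³)))
        (⊛-congʳ (b ³) s≈)
      θ≈ : a ³ ⊛ V a ⊕ 54 · (a ⊛ Y) ⊕ 162 · (Y ⊛ y) ≈ b ³ ⊛ (b ⊛ P)
      θ≈ = ≈trans (⊕-cong (⊕-cong (⊛-cong (³-cong a≈bt) X≈bt) (⊛-congʳ (const (+ 54)) (⊛-cong a≈bt Y≈bt))) (⊛-congʳ (const (+ 162)) (⊛-cong Y≈bt (≈sym bt≈y))))
        (solve 2 (λ b t → let a = b :* (:1 :+ 9 :· t) ; Y = cube b :* (t :* (:1 :+ 9 :· t :+ 27 :· (t :* t))) ; u = 3 :· t in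
            cube a :* (b :* (:1 :+ 3 :· t)) :+ 54 :· (a :* Y) :+ 162 :· (Y :* (b :* t))
            := cube b :* (b :* (:1 :+ 28 :· u :+ 162 :· (u :* u) :+ 324 :· cube u :+ 243 :· (cube u :* u)))) (λ _ → refl) b t)

    module Start where
      open Op₀ b
      M₀ : L 1# ≈ a
      M₀ = ≈trans (λ n → ⊛1 b (n * 3)) U₀b
      M₁ : L (τ₁ 1#) ≈ const 0ℤ
      M₁ = ≈trans (L-cong τ₁≈) (≈trans (L-const (+ 3) t) (≈trans (⊛-congʳ (const (+ 3)) U₀bt) (⊛-zeroʳ (const (+ 3)))))
      M₂ : L (τ₂ 1#) ≈ a ⊛ σ
      M₂ = ≈trans (L-cong τ₂≈) (≈trans (L-const (+ 9) (t ⊛ t)) (≈trans (⊛-congʳ (const (+ 9)) U₀btt)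
        (solve 2 (λ a s → 9 :· (a :* 3 :· s) := a :* 27 :· s) (λ _ → refl) a s)))
      open Values M₀ M₁ M₂

      h₀ : Series
      h₀ = const (+ 486) ⊕ σ ⊛ (const (+ 2430) ⊕ σ ⊛ const (+ 2187))

      poly-h₀ : Poly h₀
      poly-h₀ = con (+ 486) ⊞ (σ⊠ (con (+ 2430) ⊞ (σ⊠ con (+ 2187))))

      -- The term 28τ disappears because b t = y has no exponent divisible by 3; the terms of degree
      -- 2, 3 and 4 all acquire a factor σ.
      UbP : U₀ (b ⊛ P) ≈ a ⊛ (1# ⊕ σ ⊛ h₀)
      UbP = ≈trans (L-cong (solve 1 (λ u → :1 :+ 28 :· u :+ 162 :· (u :* u) :+ 324 :· cube u :+ 243 :· (cube u :* u)
                := :1 :+ 28 :· (u :* :1) :+ 162 :· (u :* (u :* :1)) :+ 324 :· (u :* (u :* (u :* :1))) :+ 243 :· (u :* (u :* (u :* (u :* :1))))) (λ _ → refl) τ))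
        (≈trans (≈trans (L-⊕ _ _) (⊕-cong (≈trans (L-⊕ _ _) (⊕-cong (≈trans (L-⊕ _ _) (⊕-cong (≈trans (L-⊕ 1# _) (⊕-cong M₀
              (≈trans (L-const (+ 28) _) (⊛-congʳ (const (+ 28)) M₁)))) (≈trans (L-const (+ 162) _) (⊛-congʳ (const (+ 162)) M₂))))
              (≈trans (L-const (+ 324) _) (⊛-congʳ (const (+ 324)) L₃)))) (≈trans (L-const (+ 243) _) (⊛-congʳ (const (+ 243)) L₄))))
          (solve 2 (λ a s → let A₃ = s :* (a :+ 3 :· con 0ℤ :+ 3 :· (a :* s)) in
              a :+ 28 :· con 0ℤ :+ 162 :· (a :* s) :+ 324 :· A₃ :+ 243 :· (s :* (con 0ℤ :+ 3 :· (a :* s) :+ 3 :· A₃))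
              := a :* (:1 :+ s :* (con (+ 486) :+ s :* (con (+ 2430) :+ s :* con (+ 2187))))) (λ _ → refl) a σ))

    -- F k n and H k n are the coefficients of Φ at the x with 8x − 3 = 3^(2k+1) (8n − 1) and 8x − 3 = 3^(2k+2) (8n + 5).
    F H : ℕ → Series
    F zero    = U₀ Φ
    F (suc k) = U₀ (q ⊛ H k)
    H k = U₂ (F k)

    -- Here κ(q³) = C(q³)/C(q⁹)³ and b = C(q³)/C³, so C(q³) cancels in t = q κ(q³)/b. The shift by q
    -- thereby becomes multiplication by t, up to a series in q⁹.
    qC³ : q ⊛ C ³ ≈ V (V (C ³)) ⊛ t
    qC³ = ≈sym (≈trans (⊛-cong (≈trans (V-cong (V³ C)) (V³ (V C))) (⊛-congˡ β (⊛-congʳ q Vκ≈)))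
      (≈trans (lincomb₁ (q ⊛ C ³ ⊛ V C ⊛ V e) (unit³ (V-unit (V-unit eC)))
          (solve 6 (λ q c c′ e′ c″ e″ → cube c″ :* (q :* (c′ :* cube e″) :* (e′ :* c)) :- q :* c :* c′ :* e′
              := (q :* c :* c′ :* e′) :* (cube e″ :* cube c″ :- :1)) (λ _ → refl) q (C ³) (V C) (V e) (V (V C)) (V (V e))))
        (lincomb₁ (q ⊛ C ³) (V-unit eC)
          (solve 4 (λ q c c′ e′ → q :* c :* c′ :* e′ :- q :* c := (q :* c) :* (e′ :* c′ :- :1)) (λ _ → refl) q (C ³) (V C) (V e)))))

    step-U₂ : ∀ {f} g → f ≈ C ³ ⊛ (a ⊛ g) → q ⊛ U₂ f ≈ V (C ³) ⊛ U₀ (a ⊛ (t ⊛ g))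
    step-U₂ {f} g p = ≈trans (≈sym (U₀-q⊛ f)) (≈trans (λ n → qf (n * 3)) (U₀-V⊛ (V (C ³)) (a ⊛ (t ⊛ g))))
      where
      qf : q ⊛ f ≈ V (V (C ³)) ⊛ (a ⊛ (t ⊛ g))
      qf = ≈trans (⊛-congʳ q p) (≈trans (≈sym (⊛-assoc q (C ³) (a ⊛ g))) (≈trans (⊛-congˡ (a ⊛ g) qC³)
        (solve 4 (λ v t a g → (v :* t) :* (a :* g) := v :* (a :* (t :* g))) (λ _ → refl) (V (V (C ³))) t a g)))

    -- Odd and even refer to the exponent of 3 in the modulus of the progression. The even form
    -- concerns q H because q U₂ f = U₀ (q f). The odd form starts at F 1, since F 0 still contains
    -- a term outside a σ ℤ[σ].
    OddForm EvenForm : ℕ → Set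
    OddForm  k = Σ[ h ∈ Series ] Poly h × F (suc k) ≈ C ³ ⊛ (a ⊛ ((3 ^ (5 * k + 4)) · (σ ⊛ h)))
    EvenForm k = Σ[ h ∈ Series ] Poly h × q ⊛ H k ≈ V (C ³) ⊛ (a ⊛ ((3 ^ (5 * k)) · (σ ⊛ h)))

    -- The constant 1 in F 0 = C³ a (1 + σ h₀) is sent to U₀ (a t) = a σ, so from here on everything
    -- lies in a σ ℤ[σ]. The rest contributes a multiple of 3 a σ.
    even-zero : EvenForm 0
    even-zero = let k , pk , e = Level₀.Utσ Start.poly-h₀ in
      1# ⊕ 3 · k , con 1ℤ ⊞ scalar (+ 3) pk ,
      ≈trans (step-U₂ (1# ⊕ σ ⊛ Start.h₀) F0) (⊛-congʳ (V (C ³))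
        (≈trans (λ n → (solve 4 (λ a t s h → a :* (t :* (:1 :+ s :* h)) := a :* t :+ a :* (t :* (s :* h))) (λ _ → refl) a t σ Start.h₀) (n * 3))
          (≈trans (≈trans (U₀-⊕ (a ⊛ t) (a ⊛ (t ⊛ (σ ⊛ Start.h₀)))) (⊕-cong U₀at e)) (solve 3 (λ a s k → a :* s :+ 3 :· (a :* (s :* k)) := a :* (1 :· (s :* (:1 :+ 3 :· k)))) (λ _ → refl) a σ k))))
      where
      F0 : F 0 ≈ C ³ ⊛ (a ⊛ (1# ⊕ σ ⊛ Start.h₀))
      F0 = ≈trans (λ n → Φ≈bP (n * 3)) (≈trans (U₀-V⊛ (C ³) (b ⊛ P)) (⊛-congʳ (C ³) Start.UbP))

    even→odd : ∀ k → EvenForm k → OddForm k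
    even→odd k (h , ph , e) = let h′ , ph′ , e′ = Level₀.Uσ ph in
      h′ , ph′ , ≈trans (λ n → e (n * 3)) (≈trans (U₀-V⊛ (C ³) _) (⊛-congʳ (C ³)
      (≈trans (λ n → (solve 4 (λ c a s h → a :* (c :* (s :* h)) := c :* (a :* (s :* h))) (λ _ → refl) (const (+ (3 ^ (5 * k)))) a σ h) (n * 3))
        (≈trans (λ n → ⊛-congˡ (a ⊛ (σ ⊛ h)) (≈sym (V-const (+ (3 ^ (5 * k))))) (n * 3))
        (≈trans (U₀-V⊛ (const (+ (3 ^ (5 * k)))) (a ⊛ (σ ⊛ h)))
        (≈trans (⊛-congʳ (const (+ (3 ^ (5 * k)))) e′)
        (≈trans (·-· (3 ^ (5 * k)) 81 (a ⊛ (σ ⊛ h′)))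
        (≈trans (λ n → cong (λ c → (c · (a ⊛ (σ ⊛ h′))) n) (sym (ℕₚ.^-distribˡ-+-* 3 (5 * k) 4)))
          (solve 4 (λ c a s h → c :* (a :* (s :* h)) := a :* (c :* (s :* h))) (λ _ → refl) (const (+ (3 ^ (5 * k + 4)))) a σ h′)))))))))

    odd→even : ∀ k → OddForm k → EvenForm (suc k)
    odd→even k (h , ph , e) = let h′ , ph′ , e′ = Level₀.Utσ ph in
      h′ , ph′ , ≈trans (step-U₂ {F (suc k)} _ e) (⊛-congʳ (V (C ³))
      (≈trans (λ n → (solve 5 (λ c a t s h → a :* (t :* (c :* (s :* h))) := c :* (a :* (t :* (s :* h)))) (λ _ → refl) (const (+ m)) a t σ h) (n * 3))
        (≈trans (λ n → ⊛-congˡ (a ⊛ (t ⊛ (σ ⊛ h))) (≈sym (V-const (+ m))) (n * 3))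
        (≈trans (U₀-V⊛ (const (+ m)) (a ⊛ (t ⊛ (σ ⊛ h))))
        (≈trans (⊛-congʳ (const (+ m)) e′)
        (≈trans (·-· m 3 (a ⊛ (σ ⊛ h′)))
        (≈trans (λ n → cong (λ c → (c · (a ⊛ (σ ⊛ h′))) n) m3)
          (solve 4 (λ c a s h → c :* (a :* (s :* h)) := a :* (c :* (s :* h))) (λ _ → refl) (const (+ (3 ^ (5 * suc k)))) a σ h′))))))))
      where
      m : ℕ
      m = 3 ^ (5 * k + 4)
      m3 : m * 3 ≡ 3 ^ (5 * suc k)
      m3 = trans (ℕₚ.*-comm m 3) (cong (3 ^_) (trans (sym (ℕₚ.+-suc (5 * k) 4)) (trans (ℕₚ.+-comm (5 * k) 5) (sym (ℕₚ.*-suc 5 k)))))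

    opaque
      even-form : ∀ k → EvenForm k
      odd-form  : ∀ k → OddForm k
      even-form zero    = even-zero
      even-form (suc k) = odd→even k (odd-form k)
      odd-form k = even→odd k (even-form k)

    -- The last 3³ comes from σ = 27s with s integral.
    F-divisible : ∀ k n → 3 ^ (5 * k + 7) ∣ ∣ F (suc k) n ∣
    F-divisible k = let h , ph , e = odd-form k in
      subst (λ m → ∀ n → m ∣ ∣ F (suc k) n ∣) (sym m≡) (divides-coefficient (m * 27) (F (suc k)) (C ³ ⊛ (a ⊛ (s ⊛ h)))
      (≈trans e (≈trans (solve 5 (λ m c a s h → c :* (a :* (m :* (27 :· s :* h))) := m :* 27 :· (c :* (a :* (s :* h)))) (λ _ → refl) (const (+ m)) (C ³) a s h)
        (·-· m 27 _))))
      where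
      m : ℕ
      m = 3 ^ (5 * k + 4)
      m≡ : 3 ^ (5 * k + 7) ≡ m * 27
      m≡ = trans (cong (3 ^_) (sym (ℕₚ.+-assoc (5 * k) 4 3))) (ℕₚ.^-distribˡ-+-* 3 (5 * k + 4) 3)

    H-divisible : ∀ k n → 3 ^ (5 * k + 3) ∣ ∣ H k n ∣
    H-divisible k n = let h , ph , e = even-form k in
      subst (3 ^ (5 * k + 3) ∣_) (cong ∣_∣ (q⊛ (H k) (suc n)))
        (subst (λ m′ → m′ ∣ ∣ (q ⊛ H k) (suc n) ∣) (sym (ℕₚ.^-distribˡ-+-* 3 (5 * k) 3)) (divides-coefficient (m * 27) (q ⊛ H k) (V (C ³) ⊛ (a ⊛ (s ⊛ h)))
      (≈trans e (≈trans (solve 5 (λ m c a s h → c :* (a :* (m :* (27 :· s :* h))) := m :* 27 :· (c :* (a :* (s :* h)))) (λ _ → refl) (const (+ m)) (V (C ³)) a s h)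
        (·-· m 27 _))) (suc n)))
      where
      m : ℕ
      m = 3 ^ (5 * k)

    -- Exponents 3n of F are exponents 3n + 1 of q F, and q F is t a σ ℤ[σ] times a series in q³. So
    -- `U₁` applies, and its 3⁵ includes the 27 of σ.
    F-divisible-3n : ∀ k n → 3 ^ (5 * k + 9) ∣ ∣ F (suc k) (n * 3) ∣
    F-divisible-3n k n =
      subst (3 ^ (5 * k + 9) ∣_) (cong ∣_∣ (q⊛ (F (suc k)) (suc (n * 3))))
        (subst (λ m′ → m′ ∣ ∣ (q ⊛ F (suc k)) (suc (n * 3)) ∣) (sym m≡) (divides-coefficient (m * 243) (U₁ (q ⊛ F (suc k))) (V (C ³) ⊛ z) U₁qF n))
      where
      h z : Series
      h = proj₁ (odd-form k)
      ph : Poly h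
      ph = proj₁ (proj₂ (odd-form k))
      form : F (suc k) ≈ C ³ ⊛ (a ⊛ ((3 ^ (5 * k + 4)) · (σ ⊛ h)))
      form = proj₂ (proj₂ (odd-form k))
      z = proj₁ (Level₁.Utσ ph)
      e′ : U₁ (a ⊛ (t ⊛ (σ ⊛ h))) ≈ 243 · z
      e′ = proj₂ (Level₁.Utσ ph)
      m : ℕ
      m = 3 ^ (5 * k + 4)
      m≡ : 3 ^ (5 * k + 9) ≡ m * 243
      m≡ = trans (cong (3 ^_) (sym (ℕₚ.+-assoc (5 * k) 4 5))) (ℕₚ.^-distribˡ-+-* 3 (5 * k + 4) 5)
      qF : q ⊛ F (suc k) ≈ V (V (C ³) ⊛ const (+ m)) ⊛ (a ⊛ (t ⊛ (σ ⊛ h)))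
      qF = ≈trans (⊛-congʳ q form) (≈trans (≈sym (⊛-assoc q (C ³) _)) (≈trans (⊛-congˡ _ qC³)
        (≈trans (solve 6 (λ v t a m s h → (v :* t) :* (a :* (m :* (s :* h))) := (v :* m) :* (a :* (t :* (s :* h)))) (λ _ → refl) (V (V (C ³))) t a (const (+ m)) σ h)
          (⊛-congˡ _ (≈sym (≈trans (V-⊛ (V (C ³)) (const (+ m))) (⊛-congʳ (V (V (C ³))) (V-const (+ m)))))))))
      U₁qF : U₁ (q ⊛ F (suc k)) ≈ (m * 243) · (V (C ³) ⊛ z)
      U₁qF = ≈trans (λ n → qF (suc (n * 3))) (≈trans (U₁-V⊛ (V (C ³) ⊛ const (+ m)) _) (≈trans (⊛-congʳ _ e′)
        (≈trans (solve 3 (λ v m z → (v :* m) :* 243 :· z := m :* 243 :· (v :* z)) (λ _ → refl) (V (C ³)) (const (+ m)) z) (·-· m 243 _))))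

    -- Exponents 3n + 1 of H are exponents 3n + 2 of q H, to which the even form applies directly.
    H-divisible-3n+1 : ∀ k n → 3 ^ (5 * k + 5) ∣ ∣ H k (suc (n * 3)) ∣
    H-divisible-3n+1 k n =
      subst (3 ^ (5 * k + 5) ∣_) (cong ∣_∣ (q⊛ (H k) (suc (suc (n * 3)))))
        (subst (λ m′ → m′ ∣ ∣ (q ⊛ H k) (suc (suc (n * 3))) ∣) (sym (ℕₚ.^-distribˡ-+-* 3 (5 * k) 5)) (divides-coefficient (m * 243) (U₂ (q ⊛ H k)) (C ³ ⊛ z) U₂qH n))
      where
      h z : Series
      h = proj₁ (even-form k)
      ph : Poly h
      ph = proj₁ (proj₂ (even-form k))
      form : q ⊛ H k ≈ V (C ³) ⊛ (a ⊛ ((3 ^ (5 * k)) · (σ ⊛ h)))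
      form = proj₂ (proj₂ (even-form k))
      z = proj₁ (Level₂.Uσ ph)
      e′ : U₂ (a ⊛ (σ ⊛ h)) ≈ 243 · z
      e′ = proj₂ (Level₂.Uσ ph)
      m : ℕ
      m = 3 ^ (5 * k)
      qH : q ⊛ H k ≈ V (C ³ ⊛ const (+ m)) ⊛ (a ⊛ (σ ⊛ h))
      qH = ≈trans form (≈trans (solve 5 (λ v a m s h → v :* (a :* (m :* (s :* h))) := (v :* m) :* (a :* (s :* h))) (λ _ → refl) (V (C ³)) a (const (+ m)) σ h)
          (⊛-congˡ _ (≈sym (≈trans (V-⊛ (C ³) (const (+ m))) (⊛-congʳ (V (C ³)) (V-const (+ m)))))))
      U₂qH : U₂ (q ⊛ H k) ≈ (m * 243) · (C ³ ⊛ z)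
      U₂qH = ≈trans (λ n → qH (suc (suc (n * 3)))) (≈trans (U₂-V⊛ (C ³ ⊛ const (+ m)) _) (≈trans (⊛-congʳ _ e′)
        (≈trans (solve 3 (λ v m z → (v :* m) :* 243 :· z := m :* 243 :· (v :* z)) (λ _ → refl) (C ³) (const (+ m)) z) (·-· m 243 _))))

-- Generating functions of weighted sets.

module GeneratingFunctions where
  open PowerSeries
  open Trisection
  open import Data.Product using (uncurry)
  open import Data.Fin using (splitAt; join; remQuot; combine)
  import Data.Fin.Properties as Finₚ
  open import Data.Fin.Permutation using (↔⇒≡)
  open import Function.Bundles using (mk↔ₛ′)

  infix 3 _≃_

  record _≃_ (A B : Set) : Set where
    field
      to      : A → B
      from    : B → A
      from-to : ∀ x → from (to x) ≡ x
      to-from : ∀ y → to (from y) ≡ y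

  open _≃_ public

  ≃-refl : ∀ {A} → A ≃ A
  ≃-refl = record { to = λ x → x ; from = λ x → x ; from-to = λ _ → refl ; to-from = λ _ → refl }

  ≃-sym : ∀ {A B} → A ≃ B → B ≃ A
  ≃-sym e = record { to = from e ; from = to e ; from-to = to-from e ; to-from = from-to e }

  infixr 2 _∙_
  _∙_ : ∀ {A B C} → A ≃ B → B ≃ C → A ≃ C
  e ∙ f = record
    { to = λ x → to f (to e x) ; from = λ z → from e (from f z)
    ; from-to = λ x → trans (cong (from e) (from-to f (to e x))) (from-to e x)
    ; to-from = λ z → trans (cong (to f) (to-from e (from f z))) (to-from f z) }

  _×≃_ : ∀ {A B C D} → A ≃ C → B ≃ D → (A × B) ≃ (C × D)
  e ×≃ f = record
    { to = λ { (x , y) → to e x , to f y } ; from = λ { (x , y) → from e x , from f y }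
    ; from-to = λ { (x , y) → cong₂ _,_ (from-to e x) (from-to f y) }
    ; to-from = λ { (x , y) → cong₂ _,_ (to-from e x) (to-from f y) } }

  _⊎≃_ : ∀ {A B C D} → A ≃ C → B ≃ D → (A ⊎ B) ≃ (C ⊎ D)
  e ⊎≃ f = record
    { to = λ { (inj₁ x) → inj₁ (to e x) ; (inj₂ y) → inj₂ (to f y) }
    ; from = λ { (inj₁ x) → inj₁ (from e x) ; (inj₂ y) → inj₂ (from f y) }
    ; from-to = λ { (inj₁ x) → cong inj₁ (from-to e x) ; (inj₂ y) → cong inj₂ (from-to f y) }
    ; to-from = λ { (inj₁ x) → cong inj₁ (to-from e x) ; (inj₂ y) → cong inj₂ (to-from f y) } }

  Σ≃ : ∀ {I : Set} {A B : I → Set} → (∀ i → A i ≃ B i) → Σ I A ≃ Σ I B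
  Σ≃ e = record
    { to = λ { (i , x) → i , to (e i) x } ; from = λ { (i , x) → i , from (e i) x }
    ; from-to = λ { (i , x) → cong (i ,_) (from-to (e i) x) } ; to-from = λ { (i , x) → cong (i ,_) (to-from (e i) x) } }

  record Sub (A : Set) (P : A → Set) : Set where
    constructor _∥_
    field
      val  : A
      .prf : P val

  open Sub public

  Sub-≡ : ∀ {A P} {x y : Sub A P} → val x ≡ val y → x ≡ y
  Sub-≡ refl = refl

  Sub-map : ∀ {A B} {P : A → Set} {Q : B → Set} (f : A → B) → (∀ x → P x → Q (f x)) → Sub A P → Sub B Q
  Sub-map f g (x ∥ p) = f x ∥ g x p

  Sub≃ : ∀ {A B} {P : A → Set} {Q : B → Set} (e : A ≃ B) → (∀ x → P x → Q (to e x)) → (∀ y → Q y → P (from e y)) → Sub A P ≃ Sub B Q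
  Sub≃ e f g = record
    { to = λ { (x ∥ p) → to e x ∥ f x p } ; from = λ { (y ∥ p) → from e y ∥ g y p }
    ; from-to = λ { (x ∥ p) → Sub-≡ (from-to e x) } ; to-from = λ { (y ∥ p) → Sub-≡ (to-from e y) } }

  -- W is twice the exponent, since the exponents that occur are halves of integral quadratic forms.
  record GF (I : Set) (W : I → ℤ) (f : Series) : Set where
    field
      card   : ℕ → ℕ
      iso    : I ≃ Σ ℕ (λ n → Fin (card n))
      weighs : ∀ i → W i ≡ + (2 * proj₁ (to iso i))
      coeff  : ∀ n → f n ≡ + card n

  open GF public

  gf-≃ : ∀ {I J W W′ f} (e : I ≃ J) → (∀ i → W i ≡ W′ (to e i)) → GF J W′ f → GF I W f
  gf-≃ e p g = record { card = card g ; iso = e ∙ iso g ; weighs = λ i → trans (p i) (weighs g (to e i)) ; coeff = coeff g }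

  private
    2*-injective : ∀ {m n} → + (2 * m) ≡ + (2 * n) → m ≡ n
    2*-injective {m} {n} p = ℕₚ.*-cancelˡ-≡ m n 2 (ℤₚ.+-injective p)

    fibre : ∀ {A B : ℕ → Set} (e : Σ ℕ A ≃ Σ ℕ B) → (∀ x → proj₁ (to e x) ≡ proj₁ x) → ∀ n → A n ≃ B n
    fibre {A} {B} e p n = record
      { to = λ a → subst B (p (n , a)) (proj₂ (to e (n , a)))
      ; from = λ b → subst A (r (n , b)) (proj₂ (from e (n , b)))
      ; from-to = λ a → back (to e (n , a)) (p (n , a)) (from-to e (n , a))
      ; to-from = λ b → forth (from e (n , b)) (r (n , b)) (to-from e (n , b)) }
      where
      r : ∀ y → proj₁ (from e y) ≡ proj₁ y
      r y = trans (sym (p (from e y))) (cong proj₁ (to-from e y))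
      back : ∀ {a} y (h : proj₁ y ≡ n) → from e y ≡ (n , a) → subst A (r (n , subst B h (proj₂ y))) (proj₂ (from e (n , subst B h (proj₂ y)))) ≡ a
      back (.n , b) refl k = lem (from e (n , b)) (r (n , b)) k
        where
        lem : ∀ {a} x (h : proj₁ x ≡ n) → x ≡ (n , a) → subst A h (proj₂ x) ≡ a
        lem x refl refl = refl
      forth : ∀ {b} x (h : proj₁ x ≡ n) → to e x ≡ (n , b) → subst B (p (n , subst A h (proj₂ x))) (proj₂ (to e (n , subst A h (proj₂ x)))) ≡ b
      forth (.n , a) refl k = lem (to e (n , a)) (p (n , a)) k
        where
        lem : ∀ {b} y (h : proj₁ y ≡ n) → y ≡ (n , b) → subst B h (proj₂ y) ≡ b
        lem y refl refl = refl

    Fin-≃ : ∀ {m n} → Fin m ≃ Fin n → m ≡ n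
    Fin-≃ e = ↔⇒≡ (mk↔ₛ′ (to e) (from e) (to-from e) (from-to e))

  -- The source of the combinatorial identities: two enumerations of one weighted set restrict to a
  -- bijection of finite sets over each exponent.
  gf-unique : ∀ {I W f g} → GF I W f → GF I W g → f ≈ g
  gf-unique {W = W} G H n = trans (coeff G n) (trans (cong +_ (Fin-≃ (fibre (≃-sym (iso G) ∙ iso H) p n))) (sym (coeff H n)))
    where
    p : ∀ x → proj₁ (to (iso H) (from (iso G) x)) ≡ proj₁ x
    p x = 2*-injective (trans (sym (weighs H (from (iso G) x))) (trans (weighs G (from (iso G) x)) (cong (λ y → + (2 * proj₁ y)) (to-from (iso G) x))))

  +≃ : ∀ m n → Fin (m + n) ≃ (Fin m ⊎ Fin n)
  +≃ m n = record { to = splitAt m ; from = join m n ; from-to = Finₚ.join-splitAt m n ; to-from = Finₚ.splitAt-join m n }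

  *≃ : ∀ m n → Fin (m * n) ≃ (Fin m × Fin n)
  *≃ m n = record { to = remQuot n ; from = uncurry combine ; from-to = Finₚ.combine-remQuot {m} n ; to-from = λ { (i , j) → Finₚ.remQuot-combine i j } }

  ⊎-wt : ∀ {I J : Set} → (I → ℤ) → (J → ℤ) → I ⊎ J → ℤ
  ⊎-wt W W′ = [ W , W′ ]′

  opaque
    unfolding _⊕_

    gf-⊎ : ∀ {I J W W′ f g} → GF I W f → GF J W′ g → GF (I ⊎ J) (⊎-wt W W′) (f ⊕ g)
    gf-⊎ G H = record
      { card = λ n → card G n + card H n
      ; iso = (iso G ⊎≃ iso H) ∙ Σ⊎ ∙ Σ≃ (λ n → ≃-sym (+≃ (card G n) (card H n)))
      ; weighs = λ { (inj₁ i) → weighs G i ; (inj₂ j) → weighs H j }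
      ; coeff = λ n → trans (cong₂ _+ᶻ_ (coeff G n) (coeff H n)) (sym (ℤₚ.pos-+ (card G n) (card H n))) }
      where
      Σ⊎ : ∀ {A B : ℕ → Set} → (Σ ℕ A ⊎ Σ ℕ B) ≃ Σ ℕ (λ n → A n ⊎ B n)
      Σ⊎ = record
        { to = λ { (inj₁ (n , x)) → n , inj₁ x ; (inj₂ (n , y)) → n , inj₂ y }
        ; from = λ { (n , inj₁ x) → inj₁ (n , x) ; (n , inj₂ y) → inj₂ (n , y) }
        ; from-to = λ { (inj₁ (n , x)) → refl ; (inj₂ (n , y)) → refl }
        ; to-from = λ { (n , inj₁ x) → refl ; (n , inj₂ y) → refl } }

  conv : (ℕ → ℕ) → (ℕ → ℕ) → ℕ → ℕ
  conv c d zero    = c 0 * d 0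
  conv c d (suc n) = c 0 * d (suc n) + conv (λ m → c (suc m)) d n

  -- Follows the recursion of `_⊛_` on the level of sets, so that products need no reindexing of
  -- finite sums.
  Conv : (ℕ → Set) → (ℕ → Set) → ℕ → Set
  Conv A B zero    = A 0 × B 0
  Conv A B (suc n) = (A 0 × B (suc n)) ⊎ Conv (λ m → A (suc m)) B n

  toConv : ∀ {A B : ℕ → Set} k l → A k → B l → Conv A B (k + l)
  toConv zero    zero    a b = a , b
  toConv zero    (suc l) a b = inj₁ (a , b)
  toConv {A} {B} (suc k) l a b = inj₂ (toConv {λ m → A (suc m)} {B} k l a b)

  fromConv : ∀ {A B : ℕ → Set} n → Conv A B n → Σ ℕ A × Σ ℕ B
  fromConv zero    (a , b)        = (0 , a) , (0 , b)
  fromConv (suc n) (inj₁ (a , b)) = (0 , a) , (suc n , b)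
  fromConv {A} {B} (suc n) (inj₂ c) with fromConv {λ m → A (suc m)} {B} n c
  ... | (k , a) , y = (suc k , a) , y

  Σ-Conv : ∀ {A B : ℕ → Set} → (Σ ℕ A × Σ ℕ B) ≃ Σ ℕ (Conv A B)
  Σ-Conv {A} {B} = record
    { to = λ { ((k , a) , (l , b)) → k + l , toConv {A} {B} k l a b } ; from = λ { (n , c) → fromConv {A} {B} n c }
    ; from-to = λ { ((k , a) , (l , b)) → ft {A} {B} k l a b } ; to-from = λ { (n , c) → tf {A} {B} n c } }
    where
    ft : ∀ {A B : ℕ → Set} k l (a : A k) (b : B l) → fromConv {A} {B} (k + l) (toConv {A} {B} k l a b) ≡ ((k , a) , (l , b))
    ft zero zero    a b = refl
    ft zero (suc l) a b = refl
    ft {A} {B} (suc k) l a b rewrite ft {λ m → A (suc m)} {B} k l a b = refl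
    tf : ∀ {A B : ℕ → Set} n (c : Conv A B n) →
         (let (k , a) , (l , b) = fromConv {A} {B} n c in _≡_ {A = Σ ℕ (Conv A B)} (k + l , toConv {A} {B} k l a b) (n , c))
    tf zero    (a , b)        = refl
    tf (suc n) (inj₁ (a , b)) = refl
    tf {A} {B} (suc n) (inj₂ c) = cong (λ { (m , x) → suc m , inj₂ x }) (tf {λ m → A (suc m)} {B} n c)

  conv≃ : ∀ c d n → Conv (λ m → Fin (c m)) (λ m → Fin (d m)) n ≃ Fin (conv c d n)
  conv≃ c d zero    = ≃-sym (*≃ (c 0) (d 0))
  conv≃ c d (suc n) = (≃-sym (*≃ (c 0) (d (suc n))) ⊎≃ conv≃ (λ m → c (suc m)) d n) ∙ ≃-sym (+≃ (c 0 * d (suc n)) _)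

  opaque
    unfolding _⊛_

    ⊛-conv : ∀ f g c d → (∀ n → f n ≡ + c n) → (∀ n → g n ≡ + d n) → ∀ n → (f ⊛ g) n ≡ + conv c d n
    ⊛-conv f g c d p r zero    = trans (cong₂ _*ᶻ_ (p 0) (r 0)) (sym (ℤₚ.pos-* (c 0) (d 0)))
    ⊛-conv f g c d p r (suc n) = trans (cong₂ _+ᶻ_ (trans (cong₂ _*ᶻ_ (p 0) (r (suc n))) (sym (ℤₚ.pos-* (c 0) (d (suc n)))))
      (⊛-conv (tail f) g (λ m → c (suc m)) d (λ m → p (suc m)) r n)) (sym (ℤₚ.pos-+ (c 0 * d (suc n)) _))

  ×-wt : ∀ {I J : Set} → (I → ℤ) → (J → ℤ) → I × J → ℤ
  ×-wt W W′ (i , j) = W i +ᶻ W′ j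

  gf-× : ∀ {I J W W′ f g} → GF I W f → GF J W′ g → GF (I × J) (×-wt W W′) (f ⊛ g)
  gf-× {f = f} {g} G H = record
    { card = conv (card G) (card H)
    ; iso = (iso G ×≃ iso H) ∙ Σ-Conv ∙ Σ≃ (conv≃ (card G) (card H))
    ; weighs = λ { (i , j) → trans (cong₂ _+ᶻ_ (weighs G i) (weighs H j))
        (cong +_ (sym (ℕₚ.*-distribˡ-+ 2 (proj₁ (to (iso G) i)) (proj₁ (to (iso H) j))))) }
    ; coeff = ⊛-conv f g (card G) (card H) (coeff G) (coeff H) }

  gf-q : ∀ {I W f} → GF I W f → GF I (λ i → + 2 +ᶻ W i) (q ⊛ f)
  gf-q {f = f} G = record
    { card = c
    ; iso = iso G ∙ record
        { to = λ { (n , x) → suc n , x } ; from = λ { (suc n , x) → n , x }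
        ; from-to = λ _ → refl ; to-from = λ { (suc n , x) → refl } }
    ; weighs = λ i → trans (cong (+ 2 +ᶻ_) (weighs G i)) (cong +_ (sym (ℕₚ.*-suc 2 (proj₁ (to (iso G) i)))))
    ; coeff = λ n → trans (q⊛ f n) (coeff′ n) }
    where
    c : ℕ → ℕ
    c zero    = 0
    c (suc n) = card G n
    coeff′ : ∀ n → q· f n ≡ + c n
    coeff′ zero    = refl
    coeff′ (suc n) = coeff G n

  dilate : (ℕ → ℕ) → ℕ → ℕ
  dilate c 0 = c 0
  dilate c 1 = 0
  dilate c 2 = 0
  dilate c (suc (suc (suc n))) = dilate (λ m → c (suc m)) n

  dilate-in : ∀ {c} n → Fin (c n) → Fin (dilate c (n * 3))
  dilate-in zero    x = x
  dilate-in (suc n) x = dilate-in n x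

  dilate-out : ∀ {c} m → Fin (dilate c m) → Σ ℕ (λ n → Fin (c n))
  dilate-out 0 x = 0 , x
  dilate-out (suc (suc (suc m))) x with dilate-out m x
  ... | n , y = suc n , y

  gf-V : ∀ {I W f} → GF I W f → GF I (λ i → + 3 *ᶻ W i) (V f)
  gf-V {f = f} G = record
    { card = dilate (card G)
    ; iso = iso G ∙ record
        { to = λ { (n , x) → n * 3 , dilate-in n x } ; from = λ { (m , x) → dilate-out m x }
        ; from-to = λ { (n , x) → out-in n x } ; to-from = λ { (m , x) → in-out m x } }
    ; weighs = λ i → trans (cong (+ 3 *ᶻ_) (weighs G i)) (trans (sym (ℤₚ.pos-* 3 (2 * proj₁ (to (iso G) i)))) (cong +_ (lem (proj₁ (to (iso G) i)))))
    ; coeff = coeff′ f (card G) (coeff G) }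
    where
    lem : ∀ n → 3 * (2 * n) ≡ 2 * (n * 3)
    lem n = trans (ℕₚ.*-comm 3 (2 * n)) (ℕₚ.*-assoc 2 n 3)
    out-in : ∀ {c} n (x : Fin (c n)) → dilate-out {c} (n * 3) (dilate-in {c} n x) ≡ (n , x)
    out-in zero    x = refl
    out-in {c} (suc n) x rewrite out-in {λ m → c (suc m)} n x = refl
    in-out : ∀ {c} m (x : Fin (dilate c m)) → (let n , y = dilate-out {c} m x in _≡_ {A = Σ ℕ (λ n → Fin (dilate c n))} (n * 3 , dilate-in {c} n y) (m , x))
    in-out 0 x = refl
    in-out (suc (suc (suc m))) x = cong (λ { (n , y) → suc (suc (suc n)) , y }) (in-out m x)
    coeff′ : ∀ f c → (∀ n → f n ≡ + c n) → ∀ n → V f n ≡ + dilate c n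
    coeff′ f c p 0 = p 0
    coeff′ f c p 1 = refl
    coeff′ f c p 2 = refl
    coeff′ f c p (suc (suc (suc n))) = coeff′ (tail f) (λ m → c (suc m)) (λ m → p (suc m)) n

  gf-⊥ : ∀ {I W} → (I → ⊥) → GF I W (const 0ℤ)
  gf-⊥ ¬i = record
    { card = λ _ → 0 ; iso = record { to = λ i → ⊥-elim (¬i i) ; from = λ { (n , ()) } ; from-to = λ i → ⊥-elim (¬i i) ; to-from = λ { (n , ()) } }
    ; weighs = λ i → ⊥-elim (¬i i) ; coeff = const0 }

  gf-Fin3 : ∀ {I : Fin 3 → Set} {W : ∀ r → I r → ℤ} {f : Fin 3 → Series} → (∀ r → GF (I r) (W r) (f r)) →
            GF (Σ (Fin 3) I) (λ { (r , i) → W r i }) (f zero ⊕ (f (suc zero) ⊕ f (suc (suc zero))))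
  gf-Fin3 {I} G = gf-≃ e (λ { (zero , i) → refl ; (suc zero , i) → refl ; (suc (suc zero) , i) → refl }) (gf-⊎ (G zero) (gf-⊎ (G (suc zero)) (G (suc (suc zero)))))
    where
    e : Σ (Fin 3) I ≃ (I zero ⊎ (I (suc zero) ⊎ I (suc (suc zero))))
    e = record
      { to = λ { (zero , i) → inj₁ i ; (suc zero , i) → inj₂ (inj₁ i) ; (suc (suc zero) , i) → inj₂ (inj₂ i) }
      ; from = λ { (inj₁ i) → zero , i ; (inj₂ (inj₁ i)) → suc zero , i ; (inj₂ (inj₂ i)) → suc (suc zero) , i }
      ; from-to = λ { (zero , i) → refl ; (suc zero , i) → refl ; (suc (suc zero) , i) → refl }
      ; to-from = λ { (inj₁ i) → refl ; (inj₂ (inj₁ i)) → refl ; (inj₂ (inj₂ i)) → refl } }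

  decidable-subset : ∀ m (P : Fin m → Set) → (∀ x → Dec (P x)) → Σ[ k ∈ ℕ ] Sub (Fin m) P ≃ Fin k
  decidable-subset zero P P? = 0 , record { to = λ { (() ∥ _) } ; from = λ () ; from-to = λ { (() ∥ _) } ; to-from = λ () }
  decidable-subset (suc m) P P? with decidable-subset m (λ x → P (suc x)) (λ x → P? (suc x)) | P? zero
  ... | k , e | yes p₀ = suc k , record
    { to = λ { (zero ∥ _) → zero ; (suc x ∥ p) → suc (to e (x ∥ p)) }
    ; from = λ { zero → zero ∥ p₀ ; (suc y) → Sub-map suc (λ _ p → p) (from e y) }
    ; from-to = λ { (zero ∥ _) → refl ; (suc x ∥ p) → Sub-≡ (cong suc (cong val (from-to e (x ∥ p)))) }
    ; to-from = λ { zero → refl ; (suc y) → cong suc (to-from e y) } }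
  ... | k , e | no ¬p₀ = k , record
    { to = λ { (zero ∥ p) → ⊥-elim (¬p₀ (recompute (P? zero) p)) ; (suc x ∥ p) → to e (x ∥ p) }
    ; from = λ y → Sub-map suc (λ _ p → p) (from e y)
    ; from-to = λ { (zero ∥ p) → ⊥-elim (¬p₀ (recompute (P? zero) p)) ; (suc x ∥ p) → Sub-≡ (cong suc (cong val (from-to e (x ∥ p)))) }
    ; to-from = λ y → to-from e y }

  gf-Sub : ∀ {I W f} (P : I → Set) → (∀ i → Dec (P i)) → GF I W f → Σ[ g ∈ Series ] GF (Sub I P) (λ i → W (val i)) g
  gf-Sub {I} {W} P P? G = (λ n → + c n) , record
    { card = c
    ; iso = record
        { to = to′
        ; from = λ { (n , y) → Sub-map (λ x → from (iso G) (n , x)) (λ _ p → p) (from (e n) y) }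
        ; from-to = λ { (i ∥ p) → Sub-≡ (trans (cong (λ z → from (iso G) (proj₁ (to (iso G) i) , val z)) (from-to (e _) _)) (from-to (iso G) i)) }
        ; to-from = λ { (n , y) → tf′ n (from (e n) y) y (to-from (e n) y) } }
    ; weighs = λ { (i ∥ p) → weighs G i }
    ; coeff = λ n → refl }
    where
    c : ℕ → ℕ
    c n = proj₁ (decidable-subset (card G n) (λ x → P (from (iso G) (n , x))) (λ x → P? _))
    e : ∀ n → Sub (Fin (card G n)) (λ x → P (from (iso G) (n , x))) ≃ Fin (c n)
    e n = proj₂ (decidable-subset (card G n) (λ x → P (from (iso G) (n , x))) (λ x → P? _))
    to′ : Sub I P → Σ ℕ (λ n → Fin (c n))
    to′ (i ∥ p) = proj₁ (to (iso G) i) , to (e _) (proj₂ (to (iso G) i) ∥ subst P (sym (from-to (iso G) i)) p)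
    tf : ∀ n (z : Sub (Fin (card G n)) (λ x → P (from (iso G) (n , x)))) y → to (e n) z ≡ y → ∀ w → w ≡ (n , val z) → .(pf : P (from (iso G) w)) →
         _≡_ {A = Σ ℕ (λ n → Fin (c n))} (proj₁ w , to (e _) (proj₂ w ∥ pf)) (n , y)
    tf n z y p .(n , val z) refl pf = cong (n ,_) p
    tf′ : ∀ n (z : Sub (Fin (card G n)) (λ x → P (from (iso G) (n , x)))) y → to (e n) z ≡ y → 
         _≡_ {A = Σ ℕ (λ n → Fin (c n))} (to′ (Sub-map (λ x → from (iso G) (n , x)) (λ _ p → p) z)) (n , y)
    tf′ n (x ∥ p) y eq = tf n (x ∥ p) y eq _ (to-from (iso G) (n , x)) (subst P (sym (from-to (iso G) _)) p)

-- Finite subsets of ℕ, interleaved modulo 3 or read in parallel.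

module Streams where
  open GeneratingFunctions
  open import Data.Bool using (Bool; true; false)
  open import Data.List using (List; []; _∷_)
  open import Data.Maybe using (Maybe; just; nothing)

  -- Finitely supported sequences of letters, where b is the blank letter.
  record Stream (A : Set) (b : A) (X : Set) : Set where
    field
      pop      : X → A × X
      push     : A → X → X
      pop-push : ∀ a x → pop (push a x) ≡ (a , x)
      push-pop : ∀ x → push (proj₁ (pop x)) (proj₂ (pop x)) ≡ x
      empty    : X
      blank    : push b empty ≡ empty
      size     : X → ℕ
      shrink   : ∀ x → x ≡ empty ⊎ size (proj₂ (pop x)) < size x

    induction : (P : X → Set) → P empty → (∀ a x → P x → P (push a x)) → ∀ x → P x
    induction P p₀ step x = below (size x) x ℕₚ.≤-refl
      where
      below : ∀ n x → size x ≤ n → P x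
      below n x s≤n with shrink x
      ... | inj₁ refl = p₀
      below zero x s≤n | inj₂ t<s with ℕₚ.≤-trans t<s s≤n
      ... | ()
      below (suc n) x s≤n | inj₂ t<s = subst P (push-pop x) (step _ _ (below n _ (ℕₚ.≤-pred (ℕₚ.≤-trans t<s s≤n))))

    pop-empty : pop empty ≡ (b , empty)
    pop-empty = trans (cong pop (sym blank)) (pop-push b empty)

  module Convert {A : Set} {b : A} {X Y : Set} (SX : Stream A b X) (SY : Stream A b Y) where
    private
      module X = Stream SX
      module Y = Stream SY

    go : ℕ → X → Y
    go zero    x = Y.empty
    go (suc n) x = Y.push (proj₁ (X.pop x)) (go n (proj₂ (X.pop x)))

    convert : X → Y
    convert x = go (X.size x) x

    private
      go-empty : ∀ n → go n X.empty ≡ Y.empty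
      go-empty zero = refl
      go-empty (suc n) rewrite X.pop-empty | go-empty n = Y.blank

      go-stable : ∀ n m x → X.size x ≤ n → X.size x ≤ m → go n x ≡ go m x
      go-stable n m x p r with X.shrink x
      ... | inj₁ refl = trans (go-empty n) (sym (go-empty m))
      go-stable zero m x p r | inj₂ t<s with ℕₚ.≤-trans t<s p
      ... | ()
      go-stable (suc n) zero x p r | inj₂ t<s with ℕₚ.≤-trans t<s r
      ... | ()
      go-stable (suc n) (suc m) x p r | inj₂ t<s =
        cong (Y.push (proj₁ (X.pop x))) (go-stable n m _ (ℕₚ.≤-pred (ℕₚ.≤-trans t<s p)) (ℕₚ.≤-pred (ℕₚ.≤-trans t<s r)))

      convert-step : ∀ x → convert x ≡ Y.push (proj₁ (X.pop x)) (convert (proj₂ (X.pop x)))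
      convert-step x with X.shrink x
      ... | inj₁ refl rewrite X.pop-empty = trans (go-empty (X.size X.empty)) (trans (sym Y.blank) (cong (Y.push b) (sym (go-empty (X.size X.empty)))))
      ... | inj₂ t<s = step (X.size x) t<s
        where
        step : ∀ s → X.size (proj₂ (X.pop x)) < s → go s x ≡ Y.push (proj₁ (X.pop x)) (convert (proj₂ (X.pop x)))
        step (suc s) (s≤s t≤s) = cong (Y.push (proj₁ (X.pop x))) (go-stable s _ _ t≤s ℕₚ.≤-refl)

    convert-empty : convert X.empty ≡ Y.empty
    convert-empty = go-empty (X.size X.empty)

    convert-push : ∀ a x → convert (X.push a x) ≡ Y.push a (convert x)
    convert-push a x = trans (convert-step (X.push a x)) (cong (λ p → Y.push (proj₁ p) (convert (proj₂ p))) (X.pop-push a x))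

    -- A position-dependent sum satisfies a recursion under `push`: the first letter contributes
    -- `v a φ`, and the later ones see the position weight shifted by one. Two measures with the
    -- same recursion agree along the conversion.
    convert-measure : {Φ : Set} (_∘s : Φ → Φ) (v : A → Φ → ℤ) (μ : Φ → X → ℤ) (ν : Φ → Y → ℤ) →
      (∀ φ → μ φ X.empty ≡ ν φ Y.empty) →
      (∀ φ a x → μ φ (X.push a x) ≡ v a φ +ᶻ μ (φ ∘s) x) → (∀ φ a y → ν φ (Y.push a y) ≡ v a φ +ᶻ ν (φ ∘s) y) →
      ∀ φ x → ν φ (convert x) ≡ μ φ x
    convert-measure _∘s v μ ν e₀ μ-push ν-push φ x = X.induction (λ x → ∀ φ → ν φ (convert x) ≡ μ φ x)
      (λ φ → trans (cong (ν φ) convert-empty) (sym (e₀ φ)))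
      (λ a x ih φ → trans (cong (ν φ) (convert-push a x)) (trans (ν-push φ a (convert x)) (trans (cong (v a φ +ᶻ_) (ih (φ ∘s))) (sym (μ-push φ a x)))))
      x φ

  convert-inverse : ∀ {A b X Y} (SX : Stream A b X) (SY : Stream A b Y) → ∀ x → Convert.convert SY SX (Convert.convert SX SY x) ≡ x
  convert-inverse SX SY = X.induction _ (trans (cong YX.convert XY.convert-empty) YX.convert-empty)
    (λ a x ih → trans (cong YX.convert (XY.convert-push a x)) (trans (YX.convert-push a (XY.convert x)) (cong (X.push a) ih)))
    where
    module X = Stream SX
    module XY = Convert SX SY
    module YX = Convert SY SX

  stream-≃ : ∀ {A b X Y} → Stream A b X → Stream A b Y → X ≃ Y
  stream-≃ SX SY = record
    { to = Convert.convert SX SY ; from = Convert.convert SY SX ; from-to = convert-inverse SX SY ; to-from = convert-inverse SY SX }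

  -- A letter together with the number of blanks preceding it
  Seq : Set → Set
  Seq L = List (ℕ × L)

  seq-stream : ∀ L → Stream (Maybe L) nothing (Seq L)
  seq-stream L = record
    { pop = pop ; push = push
    ; pop-push = λ { nothing [] → refl ; nothing ((g , l) ∷ r) → refl ; (just l) r → refl }
    ; push-pop = λ { [] → refl ; ((zero , l) ∷ r) → refl ; ((suc g , l) ∷ r) → refl }
    ; empty = [] ; blank = refl ; size = size
    ; shrink = λ { [] → inj₁ refl ; ((zero , l) ∷ r) → inj₂ ℕₚ.≤-refl ; ((suc g , l) ∷ r) → inj₂ ℕₚ.≤-refl } }
    where
    pop : Seq L → Maybe L × Seq L
    pop []                = nothing , []
    pop ((zero , l) ∷ r)  = just l , r
    pop ((suc g , l) ∷ r) = nothing , (g , l) ∷ r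
    push : Maybe L → Seq L → Seq L
    push nothing  []            = []
    push nothing  ((g , l) ∷ r) = (suc g , l) ∷ r
    push (just l) r             = (zero , l) ∷ r
    size : Seq L → ℕ
    size []            = 0
    size ((g , l) ∷ r) = suc (g + size r)

  mw : ∀ {L : Set} → (L → ℤ) → Maybe L → ℤ
  mw w nothing  = 0ℤ
  mw w (just l) = w l

  sumSeq : ∀ {L} → (L → ℤ) → (ℕ → ℤ) → Seq L → ℤ
  sumSeq w φ []            = 0ℤ
  sumSeq w φ ((g , l) ∷ r) = w l *ᶻ φ g +ᶻ sumSeq w (λ n → φ (suc (g + n))) r

  sumSeq-push : ∀ {L} (w : L → ℤ) φ a r → sumSeq w φ (Stream.push (seq-stream L) a r) ≡ mw w a *ᶻ φ 0 +ᶻ sumSeq w (λ n → φ (suc n)) r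
  sumSeq-push w φ nothing  []            = sym (trans (ℤₚ.+-identityʳ _) (ℤₚ.*-zeroˡ (φ 0)))
  sumSeq-push w φ nothing  ((g , l) ∷ r) = sym (trans (cong (_+ᶻ sumSeq w (λ n → φ (suc n)) ((g , l) ∷ r)) (ℤₚ.*-zeroˡ (φ 0))) (ℤₚ.+-identityˡ _))
  sumSeq-push w φ (just l) r             = refl

  sumSeq-cong : ∀ {L} (w : L → ℤ) {φ ψ} → (∀ n → φ n ≡ ψ n) → ∀ r → sumSeq w φ r ≡ sumSeq w ψ r
  sumSeq-cong w p []            = refl
  sumSeq-cong w p ((g , l) ∷ r) = cong₂ _+ᶻ_ (cong (w l *ᶻ_) (p g)) (sumSeq-cong w (λ n → p (suc (g + n))) r)

  sumSeq-linear : ∀ {L} (w : L → ℤ) c d φ ψ r → sumSeq w (λ n → c *ᶻ φ n +ᶻ d *ᶻ ψ n) r ≡ c *ᶻ sumSeq w φ r +ᶻ d *ᶻ sumSeq w ψ r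
  sumSeq-linear w c d φ ψ []            = sym (cong₂ _+ᶻ_ (ℤₚ.*-zeroʳ c) (ℤₚ.*-zeroʳ d))
  sumSeq-linear w c d φ ψ ((g , l) ∷ r) =
    trans (cong (w l *ᶻ (c *ᶻ φ g +ᶻ d *ᶻ ψ g) +ᶻ_) (sumSeq-linear w c d (λ n → φ (suc (g + n))) (λ n → ψ (suc (g + n))) r))
          (lem c d (w l) (φ g) (ψ g) (sumSeq w (λ n → φ (suc (g + n))) r) (sumSeq w (λ n → ψ (suc (g + n))) r))
    where
    lem : ∀ c d w x y X Y → w *ᶻ (c *ᶻ x +ᶻ d *ᶻ y) +ᶻ (c *ᶻ X +ᶻ d *ᶻ Y) ≡ c *ᶻ (w *ᶻ x +ᶻ X) +ᶻ d *ᶻ (w *ᶻ y +ᶻ Y)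
    lem = ring-ℤ

  -- A row of the array with one colour, as a finite set of naturals
  Row : Set
  Row = Seq ⊤

  one : ⊤ → ℤ
  one _ = 1ℤ

  sumRow : (ℕ → ℤ) → Row → ℤ
  sumRow = sumSeq one

  open Stream (seq-stream ⊤) public using () renaming (pop to popRow; push to pushRow; pop-push to popRow-pushRow; push-pop to pushRow-popRow)

  Tri : Set → Set
  Tri A = A × A × A

  triple : ℕ → ℕ
  triple zero    = zero
  triple (suc n) = suc (suc (suc (triple n)))

  tri-stream : Stream (Maybe ⊤) nothing (Tri Row)
  tri-stream = record
    { pop = λ { (r₀ , r₁ , r₂) → proj₁ (popRow r₀) , (r₁ , r₂ , proj₂ (popRow r₀)) }
    ; push = λ { a (r₁ , r₂ , r₀) → pushRow a r₀ , r₁ , r₂ }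
    ; pop-push = λ { a (r₁ , r₂ , r₀) → cong (λ p → proj₁ p , (r₁ , r₂ , proj₂ p)) (popRow-pushRow a r₀) }
    ; push-pop = λ { (r₀ , r₁ , r₂) → cong (λ r → r , r₁ , r₂) (pushRow-popRow r₀) }
    ; empty = [] , [] , [] ; blank = refl
    ; size = λ { (r₀ , r₁ , r₂) → f 0 r₀ + f 1 r₁ + f 2 r₂ }
    ; shrink = λ { (r₀ , r₁ , r₂) → shrink r₀ r₁ r₂ } }
    where
    ℓ : Row → ℕ
    ℓ = Stream.size (seq-stream ⊤)
    -- In slot c, a row with last element p has value 3p + c + 3, three more than the position of
    -- that element in the interleaved row. A pop lowers this position by one or empties the row, so
    -- the total drops although the slots rotate.
    f : ℕ → Row → ℕ
    f c []      = 0
    f c (x ∷ r) = c + triple (ℓ (x ∷ r))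
    f-pop : ∀ x r → f 2 (proj₂ (popRow (x ∷ r))) < f 0 (x ∷ r)
    f-pop (suc g , tt) r      = ℕₚ.≤-refl
    f-pop (zero , tt) []      = s≤s z≤n
    f-pop (zero , tt) (y ∷ r) = ℕₚ.≤-refl
    f-≤ : ∀ c r → f c r ≤ f (suc c) r
    f-≤ c []      = z≤n
    f-≤ c (x ∷ r) = ℕₚ.n≤1+n _
    rotate : ∀ {d} x y z → z + x + y < d → x + y + z < d
    rotate {d} x y z = subst (_< d) (sym (trans (ℕₚ.+-comm (x + y) z) (sym (ℕₚ.+-assoc z x y))))
    shrink : ∀ r₀ r₁ r₂ → (r₀ , r₁ , r₂) ≡ ([] , [] , []) ⊎ f 0 r₁ + f 1 r₂ + f 2 (proj₂ (popRow r₀)) < f 0 r₀ + f 1 r₁ + f 2 r₂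
    shrink []      []      []      = inj₁ refl
    shrink (x ∷ r) s       u       = inj₂ (rotate (f 0 s) (f 1 u) _ (ℕₚ.+-mono-<-≤ (ℕₚ.+-mono-<-≤ (f-pop x r) (f-≤ 0 s)) (f-≤ 1 u)))
    shrink []      (x ∷ s) u       = inj₂ (rotate (f 0 (x ∷ s)) (f 1 u) 0 (ℕₚ.+-mono-<-≤ {f 0 (x ∷ s)} ℕₚ.≤-refl (f-≤ 1 u)))
    shrink []      []      (x ∷ u) = inj₂ (rotate 0 (f 1 (x ∷ u)) 0 ℕₚ.≤-refl)

  split3 : Row ≃ Tri Row
  split3 = stream-≃ (seq-stream ⊤) tri-stream

  sumTri : (ℕ → ℤ) → (ℕ → ℤ) → (ℕ → ℤ) → Tri Row → ℤ
  sumTri φ₀ φ₁ φ₂ (r₀ , r₁ , r₂) = sumRow φ₀ r₀ +ᶻ (sumRow φ₁ r₁ +ᶻ sumRow φ₂ r₂)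

  sum-split3 : ∀ φ r → sumTri (λ n → φ (triple n)) (λ n → φ (suc (triple n))) (λ n → φ (suc (suc (triple n)))) (to split3 r) ≡ sumRow φ r
  sum-split3 = Convert.convert-measure (seq-stream ⊤) tri-stream (λ φ n → φ (suc n)) (λ a φ → mw one a *ᶻ φ 0) sumRow
    (λ φ → sumTri (λ n → φ (triple n)) (λ n → φ (suc (triple n))) (λ n → φ (suc (suc (triple n)))))
    (λ φ → refl) (λ φ a r → sumSeq-push one φ a r)
    (λ { φ a (r₁ , r₂ , r₀) → trans (cong (_+ᶻ (sumRow (λ n → φ (suc (triple n))) r₁ +ᶻ sumRow (λ n → φ (suc (suc (triple n)))) r₂)) (sumSeq-push one (λ n → φ (triple n)) a r₀))
          (lem (mw one a *ᶻ φ 0) (sumRow (λ n → φ (triple (suc n))) r₀) (sumRow (λ n → φ (suc (triple n))) r₁) (sumRow (λ n → φ (suc (suc (triple n)))) r₂)) })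
    where
    lem : ∀ m x y z → (m +ᶻ x) +ᶻ (y +ᶻ z) ≡ m +ᶻ (y +ᶻ (z +ᶻ x))
    lem = ring-ℤ

  -- Three rows read in parallel: at each position either all three contain it, or exactly one or two of them do.
  -- The Fin 3 is #₁ − #₂ modulo 3, where #ᵢ is the number of elements contributed to row i.
  data Letter : Set where
    full : Letter
    part : Bool → Fin 3 → Letter

  bit₀ bit₁ bit₂ : Letter → Maybe ⊤
  bit₀ full                         = just tt
  bit₀ (part false zero)            = just tt
  bit₀ (part false (suc x))         = nothing
  bit₀ (part true zero)             = nothing
  bit₀ (part true (suc x))          = just tt
  bit₁ full                         = just tt
  bit₁ (part false (suc zero))      = just tt
  bit₁ (part false _)               = nothing
  bit₁ (part true (suc (suc zero))) = nothing
  bit₁ (part true _)                = just tt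
  bit₂ full                         = just tt
  bit₂ (part false (suc (suc zero))) = just tt
  bit₂ (part false _)               = nothing
  bit₂ (part true (suc zero))       = nothing
  bit₂ (part true _)                = just tt

  letter : Maybe ⊤ → Maybe ⊤ → Maybe ⊤ → Maybe Letter
  letter nothing   nothing   nothing   = nothing
  letter (just tt) (just tt) (just tt) = just full
  letter (just tt) nothing   nothing   = just (part false zero)
  letter nothing   (just tt) nothing   = just (part false (suc zero))
  letter nothing   nothing   (just tt) = just (part false (suc (suc zero)))
  letter nothing   (just tt) (just tt) = just (part true zero)
  letter (just tt) (just tt) nothing   = just (part true (suc zero))
  letter (just tt) nothing   (just tt) = just (part true (suc (suc zero)))

  bits : Maybe Letter → Maybe ⊤ × Maybe ⊤ × Maybe ⊤
  bits nothing  = nothing , nothing , nothing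
  bits (just l) = bit₀ l , bit₁ l , bit₂ l

  letter-bits : ∀ a → (let b₀ , b₁ , b₂ = bits a in letter b₀ b₁ b₂) ≡ a
  letter-bits nothing = refl
  letter-bits (just full) = refl
  letter-bits (just (part false zero)) = refl
  letter-bits (just (part false (suc zero))) = refl
  letter-bits (just (part false (suc (suc zero)))) = refl
  letter-bits (just (part true zero)) = refl
  letter-bits (just (part true (suc zero))) = refl
  letter-bits (just (part true (suc (suc zero)))) = refl

  bits-letter : ∀ b₀ b₁ b₂ → bits (letter b₀ b₁ b₂) ≡ (b₀ , b₁ , b₂)
  bits-letter nothing   nothing   nothing   = refl
  bits-letter (just tt) (just tt) (just tt) = refl
  bits-letter (just tt) nothing   nothing   = refl
  bits-letter nothing   (just tt) nothing   = refl
  bits-letter nothing   nothing   (just tt) = refl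
  bits-letter nothing   (just tt) (just tt) = refl
  bits-letter (just tt) (just tt) nothing   = refl
  bits-letter (just tt) nothing   (just tt) = refl

  parallel-stream : Stream (Maybe Letter) nothing (Tri Row)
  parallel-stream = record
    { pop = λ { (r₀ , r₁ , r₂) → letter (proj₁ (popRow r₀)) (proj₁ (popRow r₁)) (proj₁ (popRow r₂)) , (proj₂ (popRow r₀) , proj₂ (popRow r₁) , proj₂ (popRow r₂)) }
    ; push = push
    ; pop-push = pop-push
    ; push-pop = push-pop
    ; empty = [] , [] , [] ; blank = refl
    ; size = λ { (r₀ , r₁ , r₂) → ℓ r₀ + ℓ r₁ + ℓ r₂ }
    ; shrink = λ { (r₀ , r₁ , r₂) → shrink r₀ r₁ r₂ } }
    where
    push : Maybe Letter → Tri Row → Tri Row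
    push a (r₀ , r₁ , r₂) = pushRow (proj₁ (bits a)) r₀ , pushRow (proj₁ (proj₂ (bits a))) r₁ , pushRow (proj₂ (proj₂ (bits a))) r₂
    pop-push : ∀ a x → _
    pop-push a (r₀ , r₁ , r₂) rewrite popRow-pushRow (proj₁ (bits a)) r₀ | popRow-pushRow (proj₁ (proj₂ (bits a))) r₁ | popRow-pushRow (proj₂ (proj₂ (bits a))) r₂ =
      cong (_, (r₀ , r₁ , r₂)) (letter-bits a)
    push-pop : ∀ x → _
    push-pop (r₀ , r₁ , r₂) rewrite bits-letter (proj₁ (popRow r₀)) (proj₁ (popRow r₁)) (proj₁ (popRow r₂)) =
      cong₂ _,_ (pushRow-popRow r₀) (cong₂ _,_ (pushRow-popRow r₁) (pushRow-popRow r₂))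
    ℓ : Row → ℕ
    ℓ = Stream.size (seq-stream ⊤)
    ℓ-pop : ∀ r → ℓ (proj₂ (popRow r)) ≤ ℓ r
    ℓ-pop []                 = z≤n
    ℓ-pop ((zero , tt) ∷ r)  = ℕₚ.n≤1+n _
    ℓ-pop ((suc g , tt) ∷ r) = ℕₚ.n≤1+n _
    ℓ-pop-< : ∀ x r → ℓ (proj₂ (popRow (x ∷ r))) < ℓ (x ∷ r)
    ℓ-pop-< (zero , tt) r  = ℕₚ.≤-refl
    ℓ-pop-< (suc g , tt) r = ℕₚ.≤-refl
    shrink : ∀ r₀ r₁ r₂ → (r₀ , r₁ , r₂) ≡ ([] , [] , []) ⊎ ℓ (proj₂ (popRow r₀)) + ℓ (proj₂ (popRow r₁)) + ℓ (proj₂ (popRow r₂)) < ℓ r₀ + ℓ r₁ + ℓ r₂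
    shrink []      []      []      = inj₁ refl
    shrink (x ∷ r) r₁      r₂      = inj₂ (ℕₚ.+-mono-<-≤ (ℕₚ.+-mono-<-≤ (ℓ-pop-< x r) (ℓ-pop r₁)) (ℓ-pop r₂))
    shrink []      (x ∷ r) r₂      = inj₂ (ℕₚ.+-mono-<-≤ (ℓ-pop-< x r) (ℓ-pop r₂))
    shrink []      []      (x ∷ r) = inj₂ (ℓ-pop-< x r)

  parallel : Tri Row ≃ Seq Letter
  parallel = stream-≃ parallel-stream (seq-stream Letter)

  mwone : (Letter → Maybe ⊤) → Letter → ℤ
  mwone β l = mw one (β l)

  private
    mw-bits : (β : Letter → Maybe ⊤) (π : Maybe ⊤ × Maybe ⊤ × Maybe ⊤ → Maybe ⊤) → π (nothing , nothing , nothing) ≡ nothing → (∀ l → π (bits (just l)) ≡ β l) →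
      ∀ a → mw one (π (bits a)) ≡ mw (mwone β) a
    mw-bits β π p r nothing  = cong (mw one) p
    mw-bits β π p r (just l) = cong (mw one) (r l)

  sum-parallel : ∀ φ (x : Tri Row) → (sumSeq (mwone bit₀) φ (to parallel x) ≡ sumRow φ (proj₁ x))
    × (sumSeq (mwone bit₁) φ (to parallel x) ≡ sumRow φ (proj₁ (proj₂ x))) × (sumSeq (mwone bit₂) φ (to parallel x) ≡ sumRow φ (proj₂ (proj₂ x)))
  sum-parallel φ x = at bit₀ proj₁ proj₁ refl (λ _ → refl) (λ _ → refl) (λ { a (r₀ , r₁ , r₂) → refl })
                   , at bit₁ (λ t → proj₁ (proj₂ t)) (λ t → proj₁ (proj₂ t)) refl (λ _ → refl) (λ _ → refl) (λ { a (r₀ , r₁ , r₂) → refl })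
                   , at bit₂ (λ t → proj₂ (proj₂ t)) (λ t → proj₂ (proj₂ t)) refl (λ _ → refl) (λ _ → refl) (λ { a (r₀ , r₁ , r₂) → refl })
    where
    at : (β : Letter → Maybe ⊤) (π : Maybe ⊤ × Maybe ⊤ × Maybe ⊤ → Maybe ⊤) (π′ : Tri Row → Row) → π (nothing , nothing , nothing) ≡ nothing → (∀ l → π (bits (just l)) ≡ β l) →
         (∀ (φ : ℕ → ℤ) → sumRow φ (π′ ([] , [] , [])) ≡ 0ℤ) → (∀ a x → π′ (Stream.push parallel-stream a x) ≡ pushRow (π (bits a)) (π′ x)) →
         sumSeq (mwone β) φ (to parallel x) ≡ sumRow φ (π′ x)
    at β π π′ p r e s = Convert.convert-measure parallel-stream (seq-stream Letter) (λ φ n → φ (suc n)) (λ a φ → mw (mwone β) a *ᶻ φ 0)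
      (λ φ x → sumRow φ (π′ x)) (sumSeq (mwone β)) e
      (λ φ a x → trans (cong (sumRow φ) (s a x)) (trans (sumSeq-push one φ (π (bits a)) (π′ x)) (cong (λ c → c *ᶻ φ 0 +ᶻ sumRow (λ n → φ (suc n)) (π′ x)) (mw-bits β π p r a))))
      (λ φ a y → sumSeq-push (mwone β) φ a y) φ x

-- Jacobi's triple product and the splitting of states modulo 3.

module States where
  open GeneratingFunctions
  open Streams
  open import Data.Maybe using (Maybe; just; nothing)

  State : Set
  State = Row × Row

  len : Row → ℤ
  len = sumRow (λ _ → 1ℤ)

  sum⁺ sum⁰ : Row → ℤ
  sum⁺ = sumRow (λ n → + suc n)
  sum⁰ = sumRow (λ n → + n)

  -- A state is a choice of terms in Jacobi's product: position n of the top row selects z q^(n+1),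
  -- position n of the bottom row selects q^n / z. The charge is the exponent of z.
  charge weight₂ : State → ℤ
  charge (t , b) = len t -ᶻ len b
  weight₂ (t , b) = + 2 *ᶻ (sum⁺ t +ᶻ sum⁰ b)

  flip : Maybe ⊤ → Maybe ⊤
  flip nothing  = just tt
  flip (just _) = nothing

  private
    flip-flip : ∀ a → flip (flip a) ≡ a
    flip-flip nothing   = refl
    flip-flip (just tt) = refl

    mw-flip : ∀ a → mw one (flip a) +ᶻ mw one a ≡ 1ℤ
    mw-flip nothing  = refl
    mw-flip (just _) = refl

  -- Multiplication by z: every position moves up by one, the lowest bottom position passing to the top.
  shift unshift : State → State
  shift (t , b)   = pushRow (flip (proj₁ (popRow b))) t , proj₂ (popRow b)
  unshift (t , b) = proj₂ (popRow t) , pushRow (flip (proj₁ (popRow t))) b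

  unshift-shift : ∀ x → unshift (shift x) ≡ x
  unshift-shift (t , b) rewrite popRow-pushRow (flip (proj₁ (popRow b))) t | flip-flip (proj₁ (popRow b)) = cong (t ,_) (pushRow-popRow b)

  shift-unshift : ∀ x → shift (unshift x) ≡ x
  shift-unshift (t , b) rewrite popRow-pushRow (flip (proj₁ (popRow t))) b | flip-flip (proj₁ (popRow t)) = cong (_, b) (pushRow-popRow t)

  private
    len-push : ∀ a r → len (pushRow a r) ≡ mw one a +ᶻ len r
    len-push a r = trans (sumSeq-push one (λ _ → 1ℤ) a r) (cong (_+ᶻ len r) (ℤₚ.*-identityʳ (mw one a)))

    sum⁰-push : ∀ a r → sum⁰ (pushRow a r) ≡ sum⁺ r
    sum⁰-push a r = trans (sumSeq-push one (λ n → + n) a r) (trans (cong (_+ᶻ sum⁺ r) (ℤₚ.*-zeroʳ (mw one a))) (ℤₚ.+-identityˡ (sum⁺ r)))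

    affine : ∀ c d φ r {ψ} → (∀ n → ψ n ≡ c *ᶻ φ n +ᶻ d *ᶻ 1ℤ) → sumRow ψ r ≡ c *ᶻ sumRow φ r +ᶻ d *ᶻ len r
    affine c d φ r p = trans (sumSeq-cong one p r) (sumSeq-linear one c d φ (λ _ → 1ℤ) r)

    sum⁺-push : ∀ a r → sum⁺ (pushRow a r) ≡ mw one a +ᶻ (sum⁺ r +ᶻ len r)
    sum⁺-push a r = trans (sumSeq-push one (λ n → + suc n) a r) (cong₂ _+ᶻ_ (ℤₚ.*-identityʳ (mw one a))
      (trans (affine 1ℤ 1ℤ (λ n → + suc n) r (λ n → lem (+ n))) (cong₂ _+ᶻ_ (ℤₚ.*-identityˡ (sum⁺ r)) (ℤₚ.*-identityˡ (len r)))))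
      where
      lem : ∀ n → 1ℤ +ᶻ (1ℤ +ᶻ n) ≡ 1ℤ *ᶻ (1ℤ +ᶻ n) +ᶻ 1ℤ *ᶻ 1ℤ
      lem = ring-ℤ

  sum⁺-sum⁰ : ∀ r → sum⁺ r ≡ sum⁰ r +ᶻ len r
  sum⁺-sum⁰ r = trans (affine 1ℤ 1ℤ (λ n → + n) r (λ n → lem (+ n))) (cong₂ _+ᶻ_ (ℤₚ.*-identityˡ (sum⁰ r)) (ℤₚ.*-identityˡ (len r)))
    where
    lem : ∀ n → 1ℤ +ᶻ n ≡ 1ℤ *ᶻ n +ᶻ 1ℤ *ᶻ 1ℤ
    lem = ring-ℤ

  -- Exactly one of two things happens: position 0 leaves the bottom row or position 0 enters the
  -- top row. Either raises the charge by one.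
  charge-shift : ∀ x → charge (shift x) ≡ charge x +ᶻ 1ℤ
  charge-shift (t , b) = trans (cong (_-ᶻ len b′) (len-push (flip c) t))
    (trans (lem (mw one (flip c)) (len t) (len b′) (mw one c)) (cong₂ (λ u v → (len t -ᶻ u) +ᶻ v)
      (trans (sym (len-push c b′)) (cong len (pushRow-popRow b))) (mw-flip c)))
    where
    c = proj₁ (popRow b)
    b′ = proj₂ (popRow b)
    lem : ∀ f t b c → (f +ᶻ t) -ᶻ b ≡ (t -ᶻ (c +ᶻ b)) +ᶻ (f +ᶻ c)
    lem = ring-ℤ

  weight₂-shift : ∀ x → weight₂ (shift x) ≡ weight₂ x +ᶻ + 2 *ᶻ charge (shift x)
  weight₂-shift (t , b) = trans (cong (λ u → + 2 *ᶻ (u +ᶻ sum⁰ b′)) (sum⁺-push (flip c) t))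
    (trans (lem (mw one (flip c)) (sum⁺ t) (len t) (sum⁰ b′) (len b′))
      (cong₂ (λ u v → + 2 *ᶻ (sum⁺ t +ᶻ u) +ᶻ + 2 *ᶻ (v -ᶻ len b′))
        (trans (sym (sum⁺-sum⁰ b′)) (trans (sym (sum⁰-push c b′)) (cong sum⁰ (pushRow-popRow b)))) (sym (len-push (flip c) t))))
    where
    c = proj₁ (popRow b)
    b′ = proj₂ (popRow b)
    lem : ∀ f s t b l → + 2 *ᶻ ((f +ᶻ (s +ᶻ t)) +ᶻ b) ≡ + 2 *ᶻ (s +ᶻ (b +ᶻ l)) +ᶻ + 2 *ᶻ ((f +ᶻ t) -ᶻ l)
    lem = ring-ℤ

  iterate : (State → State) → ℕ → State → State
  iterate f zero    x = x
  iterate f (suc n) x = f (iterate f n x)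

  shiftBy : ℤ → State → State
  shiftBy (+ n)    = iterate shift n
  shiftBy -[1+ n ] = iterate unshift (suc n)

  private
    iterate-inner : ∀ f n x → iterate f n (f x) ≡ f (iterate f n x)
    iterate-inner f zero    x = refl
    iterate-inner f (suc n) x = cong f (iterate-inner f n x)

    iterate-inverse : ∀ f g → (∀ x → f (g x) ≡ x) → ∀ n x → iterate f n (iterate g n x) ≡ x
    iterate-inverse f g p zero    x = refl
    iterate-inverse f g p (suc n) x = trans (sym (iterate-inner f n _)) (trans (cong (iterate f n) (p _)) (iterate-inverse f g p n x))

    shiftBy-inverse : ∀ j x → shiftBy j (shiftBy (-ᶻ j) x) ≡ x
    shiftBy-inverse (+ zero)  x = refl
    shiftBy-inverse (+ suc n) x = iterate-inverse shift unshift shift-unshift (suc n) x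
    shiftBy-inverse -[1+ n ]  x = iterate-inverse unshift shift unshift-shift (suc n) x

    -- Each shift adds twice the new charge, and 2(c + 1) + ... + 2(c + j) = 2jc + j(j + 1).
    ShiftLaw : ℤ → State → State → Set
    ShiftLaw j x y = (charge y ≡ charge x +ᶻ j) × (weight₂ y ≡ weight₂ x +ᶻ + 2 *ᶻ (j *ᶻ charge x) +ᶻ j *ᶻ (j +ᶻ 1ℤ))

    law-shift : ∀ j x y → ShiftLaw j x y → ShiftLaw (1ℤ +ᶻ j) x (shift y)
    law-shift j x y (p , r) = c , trans (weight₂-shift y) (trans (cong₂ (λ u v → u +ᶻ + 2 *ᶻ v) r c) (lem₂ j (charge x) (weight₂ x)))
      where
      lem₁ : ∀ j c → (c +ᶻ j) +ᶻ 1ℤ ≡ c +ᶻ (1ℤ +ᶻ j)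
      lem₁ = ring-ℤ
      c : charge (shift y) ≡ charge x +ᶻ (1ℤ +ᶻ j)
      c = trans (charge-shift y) (trans (cong (_+ᶻ 1ℤ) p) (lem₁ j (charge x)))
      lem₂ : ∀ j c w → (w +ᶻ + 2 *ᶻ (j *ᶻ c) +ᶻ j *ᶻ (j +ᶻ 1ℤ)) +ᶻ + 2 *ᶻ (c +ᶻ (1ℤ +ᶻ j))
        ≡ w +ᶻ + 2 *ᶻ ((1ℤ +ᶻ j) *ᶻ c) +ᶻ (1ℤ +ᶻ j) *ᶻ ((1ℤ +ᶻ j) +ᶻ 1ℤ)
      lem₂ = ring-ℤ

    law-unshift : ∀ j x y → ShiftLaw (-ᶻ j) x y → ShiftLaw (-ᶻ (1ℤ +ᶻ j)) x (unshift y)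
    law-unshift j x y (p , r) = c , trans w (trans (cong₂ (λ u v → u -ᶻ + 2 *ᶻ v) r p) (lem₂ j (charge x) (weight₂ x)))
      where
      c₀ : charge y ≡ charge (unshift y) +ᶻ 1ℤ
      c₀ = trans (cong charge (sym (shift-unshift y))) (charge-shift (unshift y))
      w₀ : weight₂ y ≡ weight₂ (unshift y) +ᶻ + 2 *ᶻ charge y
      w₀ = trans (cong weight₂ (sym (shift-unshift y))) (trans (weight₂-shift (unshift y)) (cong (λ z → weight₂ (unshift y) +ᶻ + 2 *ᶻ charge z) (shift-unshift y)))
      cancel : ∀ u v → u ≡ (u +ᶻ v) -ᶻ v
      cancel = ring-ℤ
      w : weight₂ (unshift y) ≡ weight₂ y -ᶻ + 2 *ᶻ charge y
      w = trans (cancel _ (+ 2 *ᶻ charge y)) (cong (_-ᶻ + 2 *ᶻ charge y) (sym w₀))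
      lem₁ : ∀ j c → (c +ᶻ -ᶻ j) -ᶻ 1ℤ ≡ c +ᶻ -ᶻ (1ℤ +ᶻ j)
      lem₁ = ring-ℤ
      c : charge (unshift y) ≡ charge x +ᶻ -ᶻ (1ℤ +ᶻ j)
      c = trans (cancel _ 1ℤ) (trans (cong (_-ᶻ 1ℤ) (trans (sym c₀) p)) (lem₁ j (charge x)))
      lem₂ : ∀ j c w → (w +ᶻ + 2 *ᶻ (-ᶻ j *ᶻ c) +ᶻ -ᶻ j *ᶻ (-ᶻ j +ᶻ 1ℤ)) -ᶻ + 2 *ᶻ (c +ᶻ -ᶻ j)
        ≡ w +ᶻ + 2 *ᶻ (-ᶻ (1ℤ +ᶻ j) *ᶻ c) +ᶻ -ᶻ (1ℤ +ᶻ j) *ᶻ (-ᶻ (1ℤ +ᶻ j) +ᶻ 1ℤ)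
      lem₂ = ring-ℤ

    law-zero : ∀ x → ShiftLaw 0ℤ x x
    law-zero x = lem₁ (charge x) , lem₂ (charge x) (weight₂ x)
      where
      lem₁ : ∀ c → c ≡ c +ᶻ 0ℤ
      lem₁ = ring-ℤ
      lem₂ : ∀ c w → w ≡ w +ᶻ + 2 *ᶻ (0ℤ *ᶻ c) +ᶻ 0ℤ *ᶻ (0ℤ +ᶻ 1ℤ)
      lem₂ = ring-ℤ

    law-iterate-unshift : ∀ n x → ShiftLaw (-ᶻ (+ n)) x (iterate unshift n x)
    law-iterate-unshift zero    x = law-zero x
    law-iterate-unshift (suc n) x = law-unshift (+ n) x (iterate unshift n x) (law-iterate-unshift n x)

    law-iterate-shift : ∀ n x → ShiftLaw (+ n) x (iterate shift n x)
    law-iterate-shift zero    x = law-zero x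
    law-iterate-shift (suc n) x = law-shift (+ n) x (iterate shift n x) (law-iterate-shift n x)

    shift-law : ∀ j x → ShiftLaw j x (shiftBy j x)
    shift-law (+ n)    x = law-iterate-shift n x
    shift-law -[1+ n ] x = law-iterate-unshift (suc n) x

  State₀ : Set
  State₀ = Sub State (λ x → charge x ≡ 0ℤ)

  weight₀ : State₀ → ℤ
  weight₀ x = weight₂ (val x)

  -- Shifting back by the charge neutralises a state. Neutral states are Frobenius symbols of
  -- ordinary partitions, and the charge j accounts for the factor z^j q^(j(j+1)/2).
  jacobi : State ≃ (ℤ × State₀)
  jacobi = record
    { to = discharge
    ; from = λ { (j , (x ∥ p)) → shiftBy j x }
    ; from-to = λ x → shiftBy-inverse (charge x) x
    ; to-from = λ { (j , (x ∥ p)) → to-from′ j x (recompute (charge x ℤₚ.≟ 0ℤ) p) } }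
    where
    discharge : State → ℤ × State₀
    discharge x = charge x , (shiftBy (-ᶻ charge x) x ∥ trans (proj₁ (shift-law (-ᶻ charge x) x)) (ℤₚ.+-inverseʳ (charge x)))
    to-from′ : ∀ j x (p : charge x ≡ 0ℤ) → discharge (shiftBy j x) ≡ (j , (x ∥ p))
    to-from′ j x p = cong₂ _,_ e (Sub-≡ (trans (cong (λ k → shiftBy (-ᶻ k) (shiftBy j x)) e) back))
      where
      e : charge (shiftBy j x) ≡ j
      e = trans (proj₁ (shift-law j x)) (trans (cong (_+ᶻ j) p) (ℤₚ.+-identityˡ j))
      back : shiftBy (-ᶻ j) (shiftBy j x) ≡ x
      back = trans (cong (λ k → shiftBy (-ᶻ j) (shiftBy k x)) (sym (ℤₚ.neg-involutive j))) (shiftBy-inverse (-ᶻ j) x)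

  tri₂ : ℤ → ℤ
  tri₂ j = j *ᶻ (j +ᶻ 1ℤ)

  jacobi-weight : ∀ x → weight₂ x ≡ tri₂ (proj₁ (to jacobi x)) +ᶻ weight₀ (proj₂ (to jacobi x))
  jacobi-weight x = trans (lem (charge x) (weight₂ x)) (cong (tri₂ (charge x) +ᶻ_) (sym (proj₂ (shift-law (-ᶻ charge x) x))))
    where
    lem : ∀ c w → w ≡ c *ᶻ (c +ᶻ 1ℤ) +ᶻ (w +ᶻ + 2 *ᶻ (-ᶻ c *ᶻ c) +ᶻ -ᶻ c *ᶻ (-ᶻ c +ᶻ 1ℤ))
    lem = ring-ℤ

  Σ₃ : ∀ {A : Set} → (A → ℤ) → Tri A → ℤ
  Σ₃ f (x , y , z) = f x +ᶻ (f y +ᶻ f z)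

  tri≃ : ∀ {A B} → A ≃ B → Tri A ≃ Tri B
  tri≃ e = e ×≃ (e ×≃ e)

  zip₃ : ∀ {A B : Set} → (Tri A × Tri B) ≃ Tri (A × B)
  zip₃ = record
    { to = λ { ((a , b , c) , (x , y , z)) → (a , x) , (b , y) , (c , z) }
    ; from = λ { ((a , x) , (b , y) , (c , z)) → (a , b , c) , (x , y , z) }
    ; from-to = λ _ → refl ; to-from = λ _ → refl }

  -- Positions modulo 3: a top position 3a + c is paired with the bottom positions 3b + (2 − c).
  residues : State ≃ Tri State
  residues = (split3 ×≃ (split3 ∙ reverse₃)) ∙ zip₃
    where
    reverse₃ : ∀ {A : Set} → Tri A ≃ Tri A
    reverse₃ = record { to = λ { (x , y , z) → z , y , x } ; from = λ { (x , y , z) → z , y , x } ; from-to = λ _ → refl ; to-from = λ _ → refl }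

  private
    +triple : ∀ n → + triple n ≡ + 3 *ᶻ + n
    +triple zero    = refl
    +triple (suc n) = trans (cong (+ 3 +ᶻ_) (+triple n)) (lem (+ n))
      where
      lem : ∀ n → + 3 +ᶻ + 3 *ᶻ n ≡ + 3 *ᶻ (1ℤ +ᶻ n)
      lem = ring-ℤ

    len-split3 : ∀ r → Σ₃ len (to split3 r) ≡ len r
    len-split3 = sum-split3 (λ _ → 1ℤ)

  charge-residues : ∀ x → Σ₃ charge (to residues x) ≡ charge x
  charge-residues (t , b) = trans (lem (len t₀) (len t₁) (len t₂) (len b₀) (len b₁) (len b₂)) (cong₂ _-ᶻ_ (len-split3 t) (len-split3 b))
    where
    t₀ = proj₁ (to split3 t)
    t₁ = proj₁ (proj₂ (to split3 t))
    t₂ = proj₂ (proj₂ (to split3 t))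
    b₀ = proj₁ (to split3 b)
    b₁ = proj₁ (proj₂ (to split3 b))
    b₂ = proj₂ (proj₂ (to split3 b))
    lem : ∀ a b c x y z → (a -ᶻ z) +ᶻ ((b -ᶻ y) +ᶻ (c -ᶻ x)) ≡ (a +ᶻ (b +ᶻ c)) -ᶻ (x +ᶻ (y +ᶻ z))
    lem = ring-ℤ

  -- A top position 3a + c weighs 3(a + 1) - (2 - c) and a bottom position 3b + (2 - c) weighs 3b +
  -- (2 - c). With this pairing the correction in class c is -(2 - c) times the charge of that
  -- class.
  weight-residues : ∀ x → let x₀ , x₁ , x₂ = to residues x in
    weight₂ x ≡ + 3 *ᶻ Σ₃ weight₂ (to residues x) -ᶻ (+ 4 *ᶻ charge x₀ +ᶻ + 2 *ᶻ charge x₁)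
  weight-residues (t , b) = trans (cong₂ (λ u v → + 2 *ᶻ (u +ᶻ v))
      (trans (sym (sum-split3 (λ n → + suc n) t)) (cong₂ _+ᶻ_ (affine (+ 3) (-[1+ 1 ]) (λ n → + suc n) t₀ top₀)
        (cong₂ _+ᶻ_ (affine (+ 3) (-[1+ 0 ]) (λ n → + suc n) t₁ top₁) (affine (+ 3) 0ℤ (λ n → + suc n) t₂ top₂))))
      (trans (sym (sum-split3 (λ n → + n) b)) (cong₂ _+ᶻ_ (affine (+ 3) 0ℤ (λ n → + n) b₀ bot₀)
        (cong₂ _+ᶻ_ (affine (+ 3) 1ℤ (λ n → + n) b₁ bot₁) (affine (+ 3) (+ 2) (λ n → + n) b₂ bot₂)))))
    (lem (sum⁺ t₀) (len t₀) (sum⁺ t₁) (len t₁) (sum⁺ t₂) (len t₂) (sum⁰ b₀) (len b₀) (sum⁰ b₁) (len b₁) (sum⁰ b₂) (len b₂))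
    where
    t₀ = proj₁ (to split3 t)
    t₁ = proj₁ (proj₂ (to split3 t))
    t₂ = proj₂ (proj₂ (to split3 t))
    b₀ = proj₁ (to split3 b)
    b₁ = proj₁ (proj₂ (to split3 b))
    b₂ = proj₂ (proj₂ (to split3 b))
    e₀ : ∀ n → 1ℤ +ᶻ + 3 *ᶻ n ≡ + 3 *ᶻ (1ℤ +ᶻ n) +ᶻ -[1+ 1 ] *ᶻ 1ℤ
    e₀ = ring-ℤ
    e₁ : ∀ n → + 2 +ᶻ + 3 *ᶻ n ≡ + 3 *ᶻ (1ℤ +ᶻ n) +ᶻ -[1+ 0 ] *ᶻ 1ℤ
    e₁ = ring-ℤ
    e₂ : ∀ n → + 3 +ᶻ + 3 *ᶻ n ≡ + 3 *ᶻ (1ℤ +ᶻ n) +ᶻ 0ℤ *ᶻ 1ℤ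
    e₂ = ring-ℤ
    top₀ : ∀ n → + suc (triple n) ≡ + 3 *ᶻ + suc n +ᶻ -[1+ 1 ] *ᶻ 1ℤ
    top₀ n = trans (cong (1ℤ +ᶻ_) (+triple n)) (e₀ (+ n))
    top₁ : ∀ n → + suc (suc (triple n)) ≡ + 3 *ᶻ + suc n +ᶻ -[1+ 0 ] *ᶻ 1ℤ
    top₁ n = trans (cong (+ 2 +ᶻ_) (+triple n)) (e₁ (+ n))
    top₂ : ∀ n → + suc (suc (suc (triple n))) ≡ + 3 *ᶻ + suc n +ᶻ 0ℤ *ᶻ 1ℤ
    top₂ n = trans (cong (+ 3 +ᶻ_) (+triple n)) (e₂ (+ n))
    f₀ : ∀ n → + 3 *ᶻ n ≡ + 3 *ᶻ n +ᶻ 0ℤ *ᶻ 1ℤ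
    f₀ = ring-ℤ
    f₁ : ∀ n → 1ℤ +ᶻ + 3 *ᶻ n ≡ + 3 *ᶻ n +ᶻ 1ℤ *ᶻ 1ℤ
    f₁ = ring-ℤ
    f₂ : ∀ n → + 2 +ᶻ + 3 *ᶻ n ≡ + 3 *ᶻ n +ᶻ + 2 *ᶻ 1ℤ
    f₂ = ring-ℤ
    bot₀ : ∀ n → + triple n ≡ + 3 *ᶻ + n +ᶻ 0ℤ *ᶻ 1ℤ
    bot₀ n = trans (+triple n) (f₀ (+ n))
    bot₁ : ∀ n → + suc (triple n) ≡ + 3 *ᶻ + n +ᶻ 1ℤ *ᶻ 1ℤ
    bot₁ n = trans (cong (1ℤ +ᶻ_) (+triple n)) (f₁ (+ n))
    bot₂ : ∀ n → + suc (suc (triple n)) ≡ + 3 *ᶻ + n +ᶻ + 2 *ᶻ 1ℤ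
    bot₂ n = trans (cong (+ 2 +ᶻ_) (+triple n)) (f₂ (+ n))
    lem : ∀ a a′ b b′ c c′ x x′ y y′ z z′ →
      + 2 *ᶻ (((+ 3 *ᶻ a +ᶻ -[1+ 1 ] *ᶻ a′) +ᶻ ((+ 3 *ᶻ b +ᶻ -[1+ 0 ] *ᶻ b′) +ᶻ (+ 3 *ᶻ c +ᶻ 0ℤ *ᶻ c′)))
        +ᶻ ((+ 3 *ᶻ x +ᶻ 0ℤ *ᶻ x′) +ᶻ ((+ 3 *ᶻ y +ᶻ 1ℤ *ᶻ y′) +ᶻ (+ 3 *ᶻ z +ᶻ + 2 *ᶻ z′))))
      ≡ + 3 *ᶻ (+ 2 *ᶻ (a +ᶻ z) +ᶻ (+ 2 *ᶻ (b +ᶻ y) +ᶻ + 2 *ᶻ (c +ᶻ x))) -ᶻ (+ 4 *ᶻ (a′ -ᶻ z′) +ᶻ + 2 *ᶻ (b′ -ᶻ y′))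
    lem = ring-ℤ

  jacobi₃ : Tri State ≃ (Tri ℤ × Tri State₀)
  jacobi₃ = tri≃ jacobi ∙ ≃-sym zip₃

-- The hexagonal lattice, its cosets modulo 3 and their theta series.

module Lattices where
  open PowerSeries using (Series; _⊕_; _⊛_; q)
  open Trisection using (V)
  open GeneratingFunctions
  open Streams using (Tri)
  open States using (tri₂; Σ₃)
  open import Data.Integer.Solver using (module +-*-Solver)
  open +-*-Solver using (solve; con; _:=_; _:+_; _:*_; _:-_; :-_; Polynomial)
  import Data.Fin.Properties as Finₚ

  ℤ² : Set
  ℤ² = ℤ × ℤ

  affine≃ : (f₁ f₂ g₁ g₂ : ℤ → ℤ → ℤ) → (∀ x y → g₁ (f₁ x y) (f₂ x y) ≡ x) → (∀ x y → g₂ (f₁ x y) (f₂ x y) ≡ y) →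
    (∀ x y → f₁ (g₁ x y) (g₂ x y) ≡ x) → (∀ x y → f₂ (g₁ x y) (g₂ x y) ≡ y) → ℤ² ≃ ℤ²
  affine≃ f₁ f₂ g₁ g₂ p₁ p₂ r₁ r₂ = record
    { to = λ { (x , y) → f₁ x y , f₂ x y } ; from = λ { (x , y) → g₁ x y , g₂ x y }
    ; from-to = λ { (x , y) → cong₂ _,_ (p₁ x y) (p₂ x y) } ; to-from = λ { (x , y) → cong₂ _,_ (r₁ x y) (r₂ x y) } }

  residue : Fin 3 → ℤ
  residue r = + toℕ r

  -- Division with remainder in the form s = 3m − r
  private
    up down : ℤ × Fin 3 → ℤ × Fin 3
    up (m , zero)         = 1ℤ +ᶻ m , suc (suc zero)
    up (m , suc zero)     = m , zero
    up (m , suc (suc zero)) = m , suc zero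
    down (m , zero)       = m , suc zero
    down (m , suc zero)   = m , suc (suc zero)
    down (m , suc (suc zero)) = m -ᶻ 1ℤ , zero

    compose : ℤ × Fin 3 → ℤ
    compose (m , r) = + 3 *ᶻ m -ᶻ residue r

    compose-up : ∀ x → compose (up x) ≡ 1ℤ +ᶻ compose x
    compose-up (m , zero) = lem m
      where
      lem : ∀ m → + 3 *ᶻ (1ℤ +ᶻ m) -ᶻ + 2 ≡ 1ℤ +ᶻ (+ 3 *ᶻ m -ᶻ 0ℤ)
      lem = ring-ℤ
    compose-up (m , suc zero) = lem m
      where
      lem : ∀ m → + 3 *ᶻ m -ᶻ 0ℤ ≡ 1ℤ +ᶻ (+ 3 *ᶻ m -ᶻ 1ℤ)
      lem = ring-ℤ
    compose-up (m , suc (suc zero)) = lem m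
      where
      lem : ∀ m → + 3 *ᶻ m -ᶻ 1ℤ ≡ 1ℤ +ᶻ (+ 3 *ᶻ m -ᶻ + 2)
      lem = ring-ℤ

    compose-down : ∀ x → compose (down x) ≡ compose x -ᶻ 1ℤ
    compose-down (m , zero) = lem m
      where
      lem : ∀ m → + 3 *ᶻ m -ᶻ 1ℤ ≡ (+ 3 *ᶻ m -ᶻ 0ℤ) -ᶻ 1ℤ
      lem = ring-ℤ
    compose-down (m , suc zero) = lem m
      where
      lem : ∀ m → + 3 *ᶻ m -ᶻ + 2 ≡ (+ 3 *ᶻ m -ᶻ 1ℤ) -ᶻ 1ℤ
      lem = ring-ℤ
    compose-down (m , suc (suc zero)) = lem m
      where
      lem : ∀ m → + 3 *ᶻ (m -ᶻ 1ℤ) -ᶻ 0ℤ ≡ (+ 3 *ᶻ m -ᶻ + 2) -ᶻ 1ℤ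
      lem = ring-ℤ

    decompose : ℤ → ℤ × Fin 3
    decompose (+ zero)      = 0ℤ , zero
    decompose (+ suc n)     = up (decompose (+ n))
    decompose -[1+ zero ]   = down (0ℤ , zero)
    decompose -[1+ suc n ]  = down (decompose -[1+ n ])

    compose-decompose : ∀ s → compose (decompose s) ≡ s
    compose-decompose (+ zero)     = refl
    compose-decompose (+ suc n)    = trans (compose-up (decompose (+ n))) (cong (1ℤ +ᶻ_) (compose-decompose (+ n)))
    compose-decompose -[1+ zero ]  = refl
    compose-decompose -[1+ suc n ] = trans (compose-down (decompose -[1+ n ])) (trans (cong (_-ᶻ 1ℤ) (compose-decompose -[1+ n ])) (cong -[1+_] (cong suc (ℕₚ.+-identityʳ n))))

  3k≢1 : ∀ k → + 3 *ᶻ k ≡ 1ℤ → ⊥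
  3k≢1 (+ zero) ()
  3k≢1 (+ suc n) p with trans (sym (ℕₚ.*-suc 3 n)) (ℤₚ.+-injective (trans (ℤₚ.pos-* 3 (suc n)) p))
  ... | ()
  3k≢1 -[1+ n ] ()

  3k≢2 : ∀ k → + 3 *ᶻ k ≡ + 2 → ⊥
  3k≢2 (+ zero) ()
  3k≢2 (+ suc n) p with trans (sym (ℕₚ.*-suc 3 n)) (ℤₚ.+-injective (trans (ℤₚ.pos-* 3 (suc n)) p))
  ... | ()
  3k≢2 -[1+ n ] ()

  private
    compose-injective : ∀ x y → compose x ≡ compose y → x ≡ y
    compose-injective (m , r) (m′ , r′) p = cases r r′ (gap (+ 3 *ᶻ m) (residue r) (+ 3 *ᶻ m′) (residue r′) p)
      where
      3*-cancel : ∀ {k l} → + 3 *ᶻ k ≡ + 3 *ᶻ l → k ≡ l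
      3*-cancel {k} {l} = ℤₚ.*-cancelˡ-≡ (+ 3) k l
      gap : ∀ a r b r′ → a -ᶻ r ≡ b -ᶻ r′ → a -ᶻ b ≡ r -ᶻ r′
      gap a r b r′ p = trans (lem₁ a r b) (trans (cong (λ z → z +ᶻ (r -ᶻ b)) p) (lem₂ b r r′))
        where
        lem₁ : ∀ a r b → a -ᶻ b ≡ (a -ᶻ r) +ᶻ (r -ᶻ b)
        lem₁ = ring-ℤ
        lem₂ : ∀ b r r′ → (b -ᶻ r′) +ᶻ (r -ᶻ b) ≡ r -ᶻ r′
        lem₂ = ring-ℤ
      sub : ∀ k l → + 3 *ᶻ k -ᶻ + 3 *ᶻ l ≡ + 3 *ᶻ (k -ᶻ l)
      sub = ring-ℤ
      bus : ∀ k l → + 3 *ᶻ (l -ᶻ k) ≡ -ᶻ (+ 3 *ᶻ k -ᶻ + 3 *ᶻ l)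
      bus = ring-ℤ
      P : Fin 3 → Fin 3 → Set
      P r r′ = + 3 *ᶻ m -ᶻ + 3 *ᶻ m′ ≡ residue r -ᶻ residue r′
      pos : ∀ {d} → (+ 3 *ᶻ (m -ᶻ m′) ≡ d → ⊥) → + 3 *ᶻ m -ᶻ + 3 *ᶻ m′ ≡ d → ∀ {A : Set} → A
      pos absurd e = ⊥-elim (absurd (trans (sym (sub m m′)) e))
      neg : ∀ {d} → (+ 3 *ᶻ (m′ -ᶻ m) ≡ -ᶻ d → ⊥) → + 3 *ᶻ m -ᶻ + 3 *ᶻ m′ ≡ d → ∀ {A : Set} → A
      neg absurd e = ⊥-elim (absurd (trans (bus m m′) (cong -ᶻ_ e)))
      equal : ∀ r → + 3 *ᶻ m -ᶻ + 3 *ᶻ m′ ≡ 0ℤ → (m , r) ≡ (m′ , r)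
      equal r e = cong (_, r) (3*-cancel (ℤₚ.i-j≡0⇒i≡j (+ 3 *ᶻ m) (+ 3 *ᶻ m′) e))
      cases : ∀ r r′ → P r r′ → (m , r) ≡ (m′ , r′)
      cases zero zero e = equal zero e
      cases zero (suc zero) e = neg (3k≢1 (m′ -ᶻ m)) e
      cases zero (suc (suc zero)) e = neg (3k≢2 (m′ -ᶻ m)) e
      cases (suc zero) zero e = pos (3k≢1 (m -ᶻ m′)) e
      cases (suc zero) (suc zero) e = equal (suc zero) e
      cases (suc zero) (suc (suc zero)) e = neg (3k≢1 (m′ -ᶻ m)) e
      cases (suc (suc zero)) zero e = pos (3k≢2 (m -ᶻ m′)) e
      cases (suc (suc zero)) (suc zero) e = pos (3k≢1 (m -ᶻ m′)) e
      cases (suc (suc zero)) (suc (suc zero)) e = equal (suc (suc zero)) e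

  div3 : ℤ ≃ (ℤ × Fin 3)
  div3 = record { to = decompose ; from = compose ; from-to = compose-decompose
                ; to-from = λ x → compose-injective (decompose (compose x)) x (compose-decompose (compose x)) }

  -- On the plane of coordinate sum 0 these are the cosets of the index-three sublattice that is a
  -- copy of the hexagonal lattice enlarged by √3.
  byDifference : ℤ² ≃ Σ (Fin 3) (λ _ → ℤ²)
  byDifference = record
    { to = λ { (y , z) → proj₂ (to div3 (y -ᶻ z)) , z , proj₁ (to div3 (y -ᶻ z)) }
    ; from = λ { (r , p , n) → p +ᶻ from div3 (n , r) , p }
    ; from-to = λ { (y , z) → cong (_, z) (trans (cong (z +ᶻ_) (from-to div3 (y -ᶻ z))) (lem₁ z y)) }
    ; to-from = λ { (r , p , n) → cong (λ { (n , r) → r , p , n }) (trans (cong (to div3) (lem₂ p (from div3 (n , r)))) (to-from div3 (n , r))) } }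
    where
    lem₁ : ∀ z y → z +ᶻ (y -ᶻ z) ≡ y
    lem₁ = ring-ℤ
    lem₂ : ∀ p d → (p +ᶻ d) -ᶻ p ≡ d
    lem₂ = ring-ℤ

  private
    :tri : ∀ {n} → Polynomial n → Polynomial n
    :tri j = j :* (j :+ con 1ℤ)

    :3 : ∀ {n} → Polynomial n
    :3 = con (+ 3)

  -- Points (x , y , z) of ℤ³ with coordinate sum −r, in the coordinates (y , z)
  wΣ : ℤ → ℤ → ℤ → ℤ
  wΣ r y z = tri₂ (-ᶻ r -ᶻ y -ᶻ z) +ᶻ (tri₂ y +ᶻ tri₂ z)

  -- The doubled exponent of κ, where 3κ is the sum of q^(m² + mn + n² + m + n) over all integers m
  -- and n: the points of one of the three cosets, in adapted coordinates.
  wK : ℤ → ℤ → ℤ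
  wK x y = + 2 *ᶻ (+ 3 *ᶻ (x *ᶻ x +ᶻ x *ᶻ y +ᶻ y *ᶻ y) +ᶻ + 2 *ᶻ x +ᶻ y)

  on² : (ℤ → ℤ → ℤ) → ℤ² → ℤ
  on² W (y , z) = W y z

  private
    :wΣ : ∀ {n} → Polynomial n → Polynomial n → Polynomial n → Polynomial n
    :wΣ r y z = :tri (:- r :- y :- z) :+ (:tri y :+ :tri z)

    :wK : ∀ {n} → Polynomial n → Polynomial n → Polynomial n
    :wK x y = con (+ 2) :* (:3 :* (x :* x :+ x :* y :+ y :* y) :+ con (+ 2) :* x :+ y)

  three : ∀ {A : Set} → A → A → A → Fin 3 → A
  three x y z zero             = x
  three x y z (suc zero)       = y
  three x y z (suc (suc zero)) = z

  gf-byDifference : ∀ (W : ℤ → ℤ → ℤ) (f : Fin 3 → Series) → (∀ r → GF ℤ² (λ { (p , n) → W (p +ᶻ from div3 (n , r)) p }) (f r)) →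
    GF ℤ² (on² W) (f zero ⊕ (f (suc zero) ⊕ f (suc (suc zero))))
  gf-byDifference W f G = gf-≃ byDifference (λ { (y , z) → cong (on² W) (sym (from-to byDifference (y , z))) }) (gf-Fin3 {f = f} G)

  -- This is a = a(q³) + 2c(q³) coset by coset. The trivial coset is the enlarged lattice; the other
  -- two are enlarged copies of the shifted lattice, with least exponent 1.
  A-by-class : ∀ {α ℓ} → GF ℤ² (on² (wΣ 0ℤ)) α → GF ℤ² (on² (wΣ 1ℤ)) ℓ → ∀ r →
    GF ℤ² (λ { (p , n) → wΣ 0ℤ (p +ᶻ from div3 (n , r)) p }) (three (V α) (q ⊛ V ℓ) (q ⊛ V ℓ) r)
  A-by-class Gα Gℓ zero = gf-≃
    (affine≃ (λ p n → p +ᶻ n) (λ p n → n) (λ x y → x -ᶻ y) (λ x y → y) ring-ℤ ring-ℤ ring-ℤ ring-ℤ)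
    (λ { (p , n) → solve 2 (λ p n → :wΣ (con 0ℤ) (p :+ (:3 :* n :- con 0ℤ)) p := :3 :* :wΣ (con 0ℤ) (p :+ n) n) refl p n }) (gf-V Gα)
  A-by-class Gα Gℓ (suc zero) = gf-≃
    (affine≃ (λ p n → p +ᶻ + 2 *ᶻ n -ᶻ 1ℤ) (λ p n → -ᶻ n) (λ x y → x +ᶻ + 2 *ᶻ y +ᶻ 1ℤ) (λ x y → -ᶻ y) ring-ℤ ring-ℤ ring-ℤ ring-ℤ)
    (λ { (p , n) → solve 2 (λ p n → :wΣ (con 0ℤ) (p :+ (:3 :* n :- con 1ℤ)) p := con (+ 2) :+ :3 :* :wΣ (con 1ℤ) (p :+ con (+ 2) :* n :- con 1ℤ) (:- n)) refl p n })
    (gf-q (gf-V Gℓ))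
  A-by-class Gα Gℓ (suc (suc zero)) = gf-≃
    (affine≃ (λ p n → p +ᶻ n -ᶻ 1ℤ) (λ p n → n -ᶻ 1ℤ) (λ x y → x -ᶻ y) (λ x y → y +ᶻ 1ℤ) ring-ℤ ring-ℤ ring-ℤ ring-ℤ)
    (λ { (p , n) → solve 2 (λ p n → :wΣ (con 0ℤ) (p :+ (:3 :* n :- con (+ 2))) p := con (+ 2) :+ :3 :* :wΣ (con 1ℤ) (p :+ n :- con 1ℤ) (n :- con 1ℤ)) refl p n })
    (gf-q (gf-V Gℓ))

  gf-A : ∀ {α ℓ} → GF ℤ² (on² (wΣ 0ℤ)) α → GF ℤ² (on² (wΣ 1ℤ)) ℓ → GF ℤ² (on² (wΣ 0ℤ)) (V α ⊕ (q ⊛ V ℓ ⊕ q ⊛ V ℓ))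
  gf-A {α} {ℓ} Gα Gℓ = gf-byDifference (wΣ 0ℤ) (three (V α) (q ⊛ V ℓ) (q ⊛ V ℓ)) (A-by-class Gα Gℓ)

  -- The three classes are permuted by the rotation (x , y , z) ↦ (z , x , y), hence have the same generating function.
  gf-B : ∀ {κ} → GF ℤ² (on² wK) κ → GF ℤ² (on² (wΣ 1ℤ)) (κ ⊕ (κ ⊕ κ))
  gf-B {κ} G = gf-byDifference (wΣ 1ℤ) (λ _ → κ) class
    where
    class : ∀ r → GF ℤ² (λ { (p , n) → wΣ 1ℤ (p +ᶻ from div3 (n , r)) p }) κ
    class zero = gf-≃
      (affine≃ (λ p n → p +ᶻ n) (λ p n → n) (λ x y → x -ᶻ y) (λ x y → y) ring-ℤ ring-ℤ ring-ℤ ring-ℤ)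
      (λ { (p , n) → solve 2 (λ p n → :wΣ (con 1ℤ) (p :+ (:3 :* n :- con 0ℤ)) p := :wK (p :+ n) n) refl p n }) G
    class (suc zero) = gf-≃
      (affine≃ (λ p n → -ᶻ p -ᶻ + 2 *ᶻ n) (λ p n → p +ᶻ n) (λ x y → x +ᶻ + 2 *ᶻ y) (λ x y → -ᶻ x -ᶻ y) ring-ℤ ring-ℤ ring-ℤ ring-ℤ)
      (λ { (p , n) → solve 2 (λ p n → :wΣ (con 1ℤ) (p :+ (:3 :* n :- con 1ℤ)) p := :wK (:- p :- con (+ 2) :* n) (p :+ n)) refl p n }) G
    class (suc (suc zero)) = gf-≃
      (affine≃ (λ p n → n -ᶻ 1ℤ) (λ p n → 1ℤ -ᶻ p -ᶻ + 2 *ᶻ n) (λ x y → -[1+ 0 ] -ᶻ + 2 *ᶻ x -ᶻ y) (λ x y → x +ᶻ 1ℤ) ring-ℤ ring-ℤ ring-ℤ ring-ℤ)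
      (λ { (p , n) → solve 2 (λ p n → :wΣ (con 1ℤ) (p :+ (:3 :* n :- con (+ 2))) p := :wK (n :- con 1ℤ) (con 1ℤ :- p :- con (+ 2) :* n)) refl p n }) G

  -- The reflection j ↦ -1 - j fixes j(j + 1) and takes coordinate sum -2 to -1.
  gf-B₂ : ∀ {ℓ} → GF ℤ² (on² (wΣ 1ℤ)) ℓ → GF ℤ² (on² (wΣ (+ 2))) ℓ
  gf-B₂ = gf-≃ (affine≃ (λ y z → -[1+ 0 ] -ᶻ y) (λ y z → -[1+ 0 ] -ᶻ z) (λ y z → -[1+ 0 ] -ᶻ y) (λ y z → -[1+ 0 ] -ᶻ z) ring-ℤ ring-ℤ ring-ℤ ring-ℤ)
    (λ { (y , z) → solve 2 (λ y z → :wΣ (con (+ 2)) y z := :wΣ (con 1ℤ) (con -[1+ 0 ] :- y) (con -[1+ 0 ] :- z)) refl y z })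

  -- ℤ³ by its coordinate sum 3m − r; m is then subtracted from each coordinate.
  ℤ³-by-sum : Tri ℤ ≃ Σ (Fin 3) (λ _ → ℤ × ℤ²)
  ℤ³-by-sum = record
    { to = λ j → let m , r = to div3 (s j) in r , m , (proj₁ (proj₂ j) -ᶻ m , proj₂ (proj₂ j) -ᶻ m)
    ; from = λ { (r , m , (y , z)) → m +ᶻ (-ᶻ residue r -ᶻ y -ᶻ z) , m +ᶻ y , m +ᶻ z }
    ; from-to = λ { j@(x , y , z) → cong₂ _,_ (trans (lem₁ (proj₁ (to div3 (s j))) (residue (proj₂ (to div3 (s j)))) y z) (trans (cong (λ t → t -ᶻ y -ᶻ z) (from-to div3 (s j))) (lem₂ x y z)))
        (cong₂ _,_ (lem₃ (proj₁ (to div3 (s j))) y) (lem₃ (proj₁ (to div3 (s j))) z)) }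
    ; to-from = λ { (r , m , (y , z)) → cong (λ { (n , r) → r , n , ((m +ᶻ y) -ᶻ n , (m +ᶻ z) -ᶻ n) })
          (trans (cong (to div3) (lem₄ m (residue r) y z)) (to-from div3 (m , r))) ⟫ cong (λ w → r , m , w) (cong₂ _,_ (lem₅ m y) (lem₅ m z)) } }
    where
    _⟫_ = trans
    s : Tri ℤ → ℤ
    s = Σ₃ (λ j → j)
    lem₁ : ∀ m r y z → m +ᶻ (-ᶻ r -ᶻ (y -ᶻ m) -ᶻ (z -ᶻ m)) ≡ (+ 3 *ᶻ m -ᶻ r) -ᶻ y -ᶻ z
    lem₁ = ring-ℤ
    lem₂ : ∀ x y z → (x +ᶻ (y +ᶻ z)) -ᶻ y -ᶻ z ≡ x
    lem₂ = ring-ℤ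
    lem₃ : ∀ m y → m +ᶻ (y -ᶻ m) ≡ y
    lem₃ = ring-ℤ
    lem₄ : ∀ m r y z → (m +ᶻ (-ᶻ r -ᶻ y -ᶻ z)) +ᶻ ((m +ᶻ y) +ᶻ (m +ᶻ z)) ≡ + 3 *ᶻ m -ᶻ r
    lem₄ = ring-ℤ
    lem₅ : ∀ m y → (m +ᶻ y) -ᶻ m ≡ y
    lem₅ = ring-ℤ

  wM : ℤ → ℤ → ℤ
  wM r m = + 3 *ᶻ tri₂ m -ᶻ + 2 *ᶻ (r *ᶻ m)

  ℤ³-by-sum-weight : ∀ r m y z → Σ₃ tri₂ (from ℤ³-by-sum (r , m , (y , z))) ≡ wM (residue r) m +ᶻ wΣ (residue r) y z
  ℤ³-by-sum-weight r m y z = solve 4 (λ r m y z → :tri (m :+ (:- r :- y :- z)) :+ (:tri (m :+ y) :+ :tri (m :+ z))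
    := (:3 :* :tri m :- con (+ 2) :* (r :* m)) :+ :wΣ r y z) refl (residue r) m y z

  Plane : ℤ → Set
  Plane c = Sub (Tri ℤ) (λ j → Σ₃ (λ k → k) j ≡ c)

  plane≃ : ∀ c → Plane c ≃ ℤ²
  plane≃ c = record
    { to = λ { ((x , y , z) ∥ p) → y , z }
    ; from = λ { (y , z) → (c -ᶻ y -ᶻ z , y , z) ∥ lem₁ c y z }
    ; from-to = λ { ((x , y , z) ∥ p) → Sub-≡ (cong (_, y , z) (trans (cong (λ t → t -ᶻ y -ᶻ z) (sym (recompute (_ ℤₚ.≟ c) p))) (lem₂ x y z))) }
    ; to-from = λ _ → refl }
    where
    lem₁ : ∀ c y z → (c -ᶻ y -ᶻ z) +ᶻ (y +ᶻ z) ≡ c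
    lem₁ = ring-ℤ
    lem₂ : ∀ x y z → (x +ᶻ (y +ᶻ z)) -ᶻ y -ᶻ z ≡ x
    lem₂ = ring-ℤ

  private
    tri : ℕ → ℕ
    tri zero    = 0
    tri (suc n) = suc n + tri n

    T : ℤ → ℕ
    T (+ n)    = tri n
    T -[1+ n ] = tri n

    tri₂-+ : ∀ n → tri₂ (+ n) ≡ + (2 * tri n)
    tri₂-+ zero    = refl
    tri₂-+ (suc n) = trans (lem (+ n)) (trans (cong (+ 2 *ᶻ + suc n +ᶻ_) (tri₂-+ n))
      (trans (cong (_+ᶻ + (2 * tri n)) (sym (ℤₚ.pos-* 2 (suc n)))) (trans (sym (ℤₚ.pos-+ (2 * suc n) _)) (cong +_ (sym (ℕₚ.*-distribˡ-+ 2 (suc n) (tri n)))))))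
      where
      lem : ∀ n → (1ℤ +ᶻ n) *ᶻ ((1ℤ +ᶻ n) +ᶻ 1ℤ) ≡ + 2 *ᶻ (1ℤ +ᶻ n) +ᶻ n *ᶻ (n +ᶻ 1ℤ)
      lem = ring-ℤ

    tri₂-T : ∀ j → tri₂ j ≡ + (2 * T j)
    tri₂-T (+ n)    = tri₂-+ n
    tri₂-T -[1+ n ] = trans (lem (+ n)) (tri₂-+ n)
      where
      lem : ∀ n → -ᶻ (1ℤ +ᶻ n) *ᶻ (-ᶻ (1ℤ +ᶻ n) +ᶻ 1ℤ) ≡ n *ᶻ (n +ᶻ 1ℤ)
      lem = ring-ℤ

    n≤tri : ∀ n → n ≤ tri n
    n≤tri zero    = z≤n
    n≤tri (suc n) = ℕₚ.m≤m+n (suc n) (tri n)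

    ∣j∣≤T : ∀ j → ∣ j ∣ ≤ suc (T j)
    ∣j∣≤T (+ n)    = ℕₚ.m≤n⇒m≤1+n (n≤tri n)
    ∣j∣≤T -[1+ n ] = s≤s (n≤tri n)

  -- The bound confines the integers of exponent n to a box of 2n + 4 candidates, among which they
  -- are counted.
  gf-ℤ : ∀ (W : ℤ → ℤ) (u : ℤ → ℕ) → (∀ j → W j ≡ + (2 * u j)) → (∀ j → ∣ j ∣ ≤ suc (u j)) → Σ[ f ∈ Series ] GF ℤ W f
  gf-ℤ W u W≡ bound = (λ n → + c n) , record
    { card = c
    ; iso = by-value ∙ Σ≃ (λ n → box n ∙ proj₂ (count n))
    ; weighs = W≡
    ; coeff = λ n → refl }
    where
    N : ℕ → ℕ
    N n = suc (suc n)
    code : ∀ n → Fin (N n) ⊎ Fin (N n) → ℤ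
    code n (inj₁ i) = + toℕ i
    code n (inj₂ i) = -[1+ toℕ i ]
    count : ∀ n → Σ[ k ∈ ℕ ] Sub (Fin (N n + N n)) (λ x → u (code n (to (+≃ (N n) (N n)) x)) ≡ n) ≃ Fin k
    count n = decidable-subset (N n + N n) _ (λ x → u (code n (to (+≃ (N n) (N n)) x)) ℕₚ.≟ n)
    c : ℕ → ℕ
    c n = proj₁ (count n)
    by-value : ℤ ≃ Σ ℕ (λ n → Sub ℤ (λ j → u j ≡ n))
    by-value = record { to = λ j → u j , (j ∥ refl) ; from = λ { (n , (j ∥ p)) → j } ; from-to = λ _ → refl
                      ; to-from = λ { (n , (j ∥ p)) → lem j n (recompute (u j ℕₚ.≟ n) p) } }
      where
      lem : ∀ j n (p : u j ≡ n) → _≡_ {A = Σ ℕ (λ n → Sub ℤ (λ j → u j ≡ n))} (u j , (j ∥ refl)) (n , (j ∥ p))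
      lem j .(u j) refl = refl
    box : ∀ n → Sub ℤ (λ j → u j ≡ n) ≃ Sub (Fin (N n + N n)) (λ x → u (code n (to (+≃ (N n) (N n)) x)) ≡ n)
    box n = boxed ∙ Sub≃ (≃-sym (+≃ (N n) (N n))) (λ x p → subst (λ z → u (code n z) ≡ n) (sym (to-from (+≃ (N n) (N n)) x)) p) (λ _ p → p)
      where
      small : ∀ {m} j → ∣ j ∣ ≡ m → u j ≡ n → m < N n
      small j refl refl = s≤s (bound j)
      small⁻ : ∀ m → u -[1+ m ] ≡ n → m < N n
      small⁻ m p = ℕₚ.<-trans (ℕₚ.n<1+n m) (small -[1+ m ] refl p)
      boxed : Sub ℤ (λ j → u j ≡ n) ≃ Sub (Fin (N n) ⊎ Fin (N n)) (λ x → u (code n x) ≡ n)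
      boxed = record
        { to = λ { ((+ m) ∥ p) → inj₁ (fromℕ< (small (+ m) refl p)) ∥ subst (λ k → u (+ k) ≡ n) (sym (Finₚ.toℕ-fromℕ< (small (+ m) refl p))) p
                 ; (-[1+ m ] ∥ p) → inj₂ (fromℕ< (small⁻ m p)) ∥ subst (λ k → u -[1+ k ] ≡ n) (sym (Finₚ.toℕ-fromℕ< (small⁻ m p))) p }
        ; from = λ { (x ∥ p) → code n x ∥ p }
        ; from-to = λ { ((+ m) ∥ p) → Sub-≡ (cong +_ (Finₚ.toℕ-fromℕ< (small (+ m) refl (recompute (u (+ m) ℕₚ.≟ n) p))))
                      ; (-[1+ m ] ∥ p) → Sub-≡ (cong -[1+_] (Finₚ.toℕ-fromℕ< (small⁻ m (recompute (u -[1+ m ] ℕₚ.≟ n) p)))) }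
        ; to-from = λ { (inj₁ i ∥ p) → Sub-≡ (cong inj₁ (Finₚ.fromℕ<-toℕ i (Finₚ.toℕ<n i)))
                      ; (inj₂ i ∥ p) → Sub-≡ (cong inj₂ (Finₚ.fromℕ<-toℕ i (Finₚ.toℕ<n i))) } }

  -- One-variable weights from which the binary forms are assembled on a plane. The coefficient
  -- `suc k` is positive, so every exponent occurs only finitely often.
  wℤ : ℕ → ℕ → ℤ → ℤ
  wℤ k c j = + suc k *ᶻ tri₂ j +ᶻ + c *ᶻ tri₂ (-ᶻ j)

  gf-wℤ : ∀ k c → Σ[ f ∈ Series ] GF ℤ (wℤ k c) f
  gf-wℤ k c = gf-ℤ (wℤ k c) u W≡ (λ j → ℕₚ.≤-trans (∣j∣≤T j) (s≤s (ℕₚ.≤-trans (ℕₚ.m≤m+n (T j) (k * T j)) (ℕₚ.m≤m+n (suc k * T j) _))))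
    where
    u : ℤ → ℕ
    u j = suc k * T j + c * T (-ᶻ j)
    W≡ : ∀ j → wℤ k c j ≡ + (2 * u j)
    W≡ j = trans (cong₂ (λ x y → + suc k *ᶻ x +ᶻ + c *ᶻ y) (trans (tri₂-T j) (ℤₚ.pos-* 2 (T j))) (trans (tri₂-T (-ᶻ j)) (ℤₚ.pos-* 2 (T (-ᶻ j)))))
      (trans (lem (+ suc k) (+ T j) (+ c) (+ T (-ᶻ j))) (trans (cong (+ 2 *ᶻ_) (trans (cong₂ _+ᶻ_ (sym (ℤₚ.pos-* (suc k) (T j))) (sym (ℤₚ.pos-* c (T (-ᶻ j)))))
        (sym (ℤₚ.pos-+ (suc k * T j) _)))) (sym (ℤₚ.pos-* 2 (u j)))))
      where
      lem : ∀ k x c y → k *ᶻ (+ 2 *ᶻ x) +ᶻ c *ᶻ (+ 2 *ᶻ y) ≡ + 2 *ᶻ (k *ᶻ x +ᶻ c *ᶻ y)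
      lem = ring-ℤ

  private
    w₃ : (ℤ → ℤ) → (ℤ → ℤ) → (ℤ → ℤ) → Tri ℤ → ℤ
    w₃ f g h (x , y , z) = f x +ᶻ (g y +ᶻ h z)

    gf-plane : ∀ k c k′ c′ k″ c″ → Σ[ f ∈ Series ] GF (Plane 0ℤ) (λ j → w₃ (wℤ k c) (wℤ k′ c′) (wℤ k″ c″) (val j)) f
    gf-plane k c k′ c′ k″ c″ = gf-Sub (λ j → Σ₃ (λ k → k) j ≡ 0ℤ) (λ j → Σ₃ (λ k → k) j ℤₚ.≟ 0ℤ)
      (gf-≃ ≃-refl (λ { (x , y , z) → refl }) (gf-× (proj₂ (gf-wℤ k c)) (gf-× (proj₂ (gf-wℤ k′ c′)) (proj₂ (gf-wℤ k″ c″)))))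

  A-exists : Σ[ α ∈ Series ] GF ℤ² (on² (wΣ 0ℤ)) α
  A-exists = proj₁ G , gf-≃ (≃-sym (plane≃ 0ℤ))
    (λ { (y , z) → solve 2 (λ y z → :wΣ (con 0ℤ) y z := :w (con 0ℤ :- y :- z) :+ (:w y :+ :w z)) refl y z }) (proj₂ G)
    where
    G = gf-plane 0 0 0 0 0 0
    :w : ∀ {n} → Polynomial n → Polynomial n
    :w j = con 1ℤ :* :tri j :+ con 0ℤ :* :tri (:- j)

  K-exists : Σ[ κ ∈ Series ] GF ℤ² (on² wK) κ
  K-exists = proj₁ G , gf-≃ (affine≃ (λ x y → -ᶻ y) (λ x y → x +ᶻ y) (λ y z → z +ᶻ y) (λ y z → -ᶻ y) ring-ℤ ring-ℤ ring-ℤ ring-ℤ ∙ ≃-sym (plane≃ 0ℤ))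
    (λ { (x , y) → solve 2 (λ x y → :wK x y := :w 1 2 (con 0ℤ :- (:- y) :- (x :+ y)) :+ (:w 2 1 (:- y) :+ :w 3 0 (x :+ y))) refl x y }) (proj₂ G)
    where
    -- On the plane with coordinates -x, -y, x + y, the weight `wK` is a sum of one-variable weights
    -- with coefficient pairs (1, 2), (2, 1) and (3, 0).
    G = gf-plane 0 2 1 1 2 0
    :w : ∀ {n} → ℕ → ℕ → Polynomial n → Polynomial n
    :w k c j = con (+ k) :* :tri j :+ con (+ c) :* :tri (:- j)

-- Triples of states: three-cores, and nine states as three triples.

module TripleStates where
  open PowerSeries using (Series; _⊕_; _⊛_; q; const)
  open Trisection using (V)
  open GeneratingFunctions
  open Streams
  open States
  open Lattices
  open import Data.Integer.Solver using (module +-*-Solver)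
  open +-*-Solver using (solve; con; _:=_; _:+_; _:*_; _:-_; :-_; Polynomial)

  gf-from : ∀ {I J W W′ f} (e : I ≃ J) → (∀ j → W (from e j) ≡ W′ j) → GF J W′ f → GF I W f
  gf-from {W = W} e p = gf-≃ e (λ i → trans (cong W (sym (from-to e i))) (p (to e i)))

  Sub-×ˡ : ∀ {A B : Set} {P : A → Set} → Sub (A × B) (λ x → P (proj₁ x)) ≃ (Sub A P × B)
  Sub-×ˡ = record { to = λ { ((a , b) ∥ p) → (a ∥ p) , b } ; from = λ { ((a ∥ p) , b) → (a , b) ∥ p } ; from-to = λ _ → refl ; to-from = λ _ → refl }

  gf-Tri : ∀ {I W f} → GF I W f → GF (Tri I) (Σ₃ W) (f ⊛ (f ⊛ f))
  gf-Tri G = gf-≃ ≃-refl (λ { (x , y , z) → refl }) (gf-× G (gf-× G G))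

  neutral≃ : Sub (Tri State) (λ x → Σ₃ charge x ≡ 0ℤ) ≃ (ℤ² × Tri State₀)
  neutral≃ = Sub≃ jacobi₃ (λ _ p → p) (λ y p → trans (cong (Σ₃ (λ k → k)) (sym (lem y))) (trans (cong (λ w → Σ₃ (λ k → k) (proj₁ w)) (to-from jacobi₃ y)) p)) ∙ Sub-×ˡ ∙ (plane≃ 0ℤ ×≃ ≃-refl)
    where
    lem : ∀ y → proj₁ (to jacobi₃ (from jacobi₃ y)) ≡ (let x₀ , x₁ , x₂ = from jacobi₃ y in charge x₀ , charge x₁ , charge x₂)
    lem y = refl

  -- The decomposition of a partition into its 3-core and 3-quotient. The three charges of total 0
  -- describe the core, counted by κ; the three neutral states are the quotient and weigh three
  -- times as much.
  gf-residues : ∀ {C κ} → GF State₀ weight₀ C → GF ℤ² (on² wK) κ → GF State₀ weight₀ (κ ⊛ (V C ⊛ (V C ⊛ V C)))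
  gf-residues {C} {κ} GC Gκ = gf-≃ (Sub≃ residues (λ x p → trans (charge-residues x) p)
      (λ y p → trans (sym (charge-residues (from residues y))) (trans (cong (Σ₃ charge) (to-from residues y)) p)) ∙ neutral≃)
    weigh (gf-× {W = λ { (y , z) → wK (z +ᶻ y) (-ᶻ y) }} {W′ = Σ₃ (λ x → + 3 *ᶻ weight₀ x)}
      (gf-≃ (affine≃ (λ y z → z +ᶻ y) (λ y z → -ᶻ y) (λ x y → -ᶻ y) (λ x y → x +ᶻ y) ring-ℤ ring-ℤ ring-ℤ ring-ℤ) (λ { (y , z) → refl }) Gκ)
      (gf-Tri (gf-V GC)))
    where
    :tri : ∀ {n} → Polynomial n → Polynomial n
    :tri j = j :* (j :+ con 1ℤ)
    polynomial : ∀ x y z a b c → x +ᶻ (y +ᶻ z) ≡ 0ℤ →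
      + 3 *ᶻ ((tri₂ x +ᶻ a) +ᶻ ((tri₂ y +ᶻ b) +ᶻ (tri₂ z +ᶻ c))) -ᶻ (+ 4 *ᶻ x +ᶻ + 2 *ᶻ y)
      ≡ wK (z +ᶻ y) (-ᶻ y) +ᶻ (+ 3 *ᶻ a +ᶻ (+ 3 *ᶻ b +ᶻ + 3 *ᶻ c))
    polynomial x y z a b c p = trans (cong (λ x → + 3 *ᶻ ((tri₂ x +ᶻ a) +ᶻ ((tri₂ y +ᶻ b) +ᶻ (tri₂ z +ᶻ c))) -ᶻ (+ 4 *ᶻ x +ᶻ + 2 *ᶻ y)) x≡)
      (solve 5 (λ y z a b c → let x = :- (y :+ z) ; X = z :+ y ; Y = :- y in
        con (+ 3) :* ((:tri x :+ a) :+ ((:tri y :+ b) :+ (:tri z :+ c))) :- (con (+ 4) :* x :+ con (+ 2) :* y)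
        := con (+ 2) :* (con (+ 3) :* (X :* X :+ X :* Y :+ Y :* Y) :+ con (+ 2) :* X :+ Y) :+ (con (+ 3) :* a :+ (con (+ 3) :* b :+ con (+ 3) :* c))) refl y z a b c)
      where
      lem : ∀ x u → x ≡ (x +ᶻ u) -ᶻ u
      lem = ring-ℤ
      x≡ : x ≡ -ᶻ (y +ᶻ z)
      x≡ = trans (lem x (y +ᶻ z)) (trans (cong (_-ᶻ (y +ᶻ z)) p) (ℤₚ.+-identityˡ _))
    weigh : ∀ i → _
    weigh (x ∥ p) = trans (weight-residues x) (trans (cong₂ (λ u v → + 3 *ᶻ u -ᶻ v)
        (cong₂ _+ᶻ_ (jacobi-weight x₀) (cong₂ _+ᶻ_ (jacobi-weight x₁) (jacobi-weight x₂))) refl)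
      (polynomial (charge x₀) (charge x₁) (charge x₂) (weight₀ (proj₂ (to jacobi x₀))) (weight₀ (proj₂ (to jacobi x₁))) (weight₀ (proj₂ (to jacobi x₂))) (trans (charge-residues x) (recompute (charge x ℤₚ.≟ 0ℤ) p))))
      where
      x₀ = proj₁ (to residues x)
      x₁ = proj₁ (proj₂ (to residues x))
      x₂ = proj₂ (proj₂ (to residues x))

  D : Set
  D = ℤ² × Tri State₀

  wD : Fin 3 → D → ℤ
  wD r (x , s) = on² (wΣ (residue r)) x +ᶻ Σ₃ weight₀ s

  bySum : Tri State ≃ Σ (Fin 3) (λ _ → ℤ × D)
  bySum = jacobi₃ ∙ (ℤ³-by-sum ×≃ ≃-refl) ∙ record
    { to = λ { ((r , m , x) , s) → r , m , (x , s) } ; from = λ { (r , m , (x , s)) → (r , m , x) , s } ; from-to = λ _ → refl ; to-from = λ _ → refl }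

  bySum-charge : ∀ x → Σ₃ charge x ≡ (let r , m , d = to bySum x in + 3 *ᶻ m -ᶻ residue r)
  bySum-charge x = sym (from-to div3 (Σ₃ charge x))

  bySum-weight : ∀ x → Σ₃ weight₂ x ≡ (let r , m , d = to bySum x in wM (residue r) m +ᶻ wD r d)
  bySum-weight x@(x₀ , x₁ , x₂) = trans (cong₂ _+ᶻ_ (jacobi-weight x₀) (cong₂ _+ᶻ_ (jacobi-weight x₁) (jacobi-weight x₂)))
    (trans (lem (tri₂ (charge x₀)) (tri₂ (charge x₁)) (tri₂ (charge x₂)) w₀ w₁ w₂)
    (trans (cong (_+ᶻ (w₀ +ᶻ (w₁ +ᶻ w₂))) (trans (cong (Σ₃ tri₂) (sym (from-to ℤ³-by-sum j))) (ℤ³-by-sum-weight r m y z)))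
      (ℤₚ.+-assoc (wM (residue r) m) (wΣ (residue r) y z) (w₀ +ᶻ (w₁ +ᶻ w₂)))))
    where
    j : Tri ℤ
    j = charge x₀ , charge x₁ , charge x₂
    w₀ = weight₀ (proj₂ (to jacobi x₀))
    w₁ = weight₀ (proj₂ (to jacobi x₁))
    w₂ = weight₀ (proj₂ (to jacobi x₂))
    r = proj₁ (to ℤ³-by-sum j)
    m = proj₁ (proj₂ (to ℤ³-by-sum j))
    y = proj₁ (proj₂ (proj₂ (to ℤ³-by-sum j)))
    z = proj₂ (proj₂ (proj₂ (to ℤ³-by-sum j)))
    lem : ∀ a b c x y z → (a +ᶻ x) +ᶻ ((b +ᶻ y) +ᶻ (c +ᶻ z)) ≡ (a +ᶻ (b +ᶻ c)) +ᶻ (x +ᶻ (y +ᶻ z))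
    lem = ring-ℤ

  gf-D : ∀ {C α ℓ} → GF State₀ weight₀ C → GF ℤ² (on² (wΣ 0ℤ)) α → GF ℤ² (on² (wΣ 1ℤ)) ℓ → ∀ r → GF D (wD r) (three α ℓ ℓ r ⊛ (C ⊛ (C ⊛ C)))
  gf-D GC Gα Gℓ zero             = gf-≃ ≃-refl (λ { (x , s) → refl }) (gf-× Gα (gf-Tri GC))
  gf-D GC Gα Gℓ (suc zero)       = gf-≃ ≃-refl (λ { (x , s) → refl }) (gf-× Gℓ (gf-Tri GC))
  gf-D GC Gα Gℓ (suc (suc zero)) = gf-≃ ≃-refl (λ { (x , s) → refl }) (gf-× (gf-B₂ Gℓ) (gf-Tri GC))

  -- Three triples of states have charges 3mᵢ − rᵢ; Λ collects the m for which the total vanishes.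
  ΣcΛ : Fin 3 → Fin 3 → Fin 3 → Tri ℤ → ℤ
  ΣcΛ r₁ r₂ r₃ (m₁ , m₂ , m₃) = (+ 3 *ᶻ m₁ -ᶻ residue r₁) +ᶻ ((+ 3 *ᶻ m₂ -ᶻ residue r₂) +ᶻ (+ 3 *ᶻ m₃ -ᶻ residue r₃))

  Λ : Fin 3 → Fin 3 → Fin 3 → Set
  Λ r₁ r₂ r₃ = Sub (Tri ℤ) (λ m → ΣcΛ r₁ r₂ r₃ m ≡ 0ℤ)

  wΛ : ∀ r₁ r₂ r₃ → Λ r₁ r₂ r₃ → ℤ
  wΛ r₁ r₂ r₃ ((m₁ , m₂ , m₃) ∥ p) = wM (residue r₁) m₁ +ᶻ (wM (residue r₂) m₂ +ᶻ wM (residue r₃) m₃)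

  private
    3Σ : ∀ r₁ r₂ r₃ m₁ m₂ m₃ → + 3 *ᶻ (m₁ +ᶻ (m₂ +ᶻ m₃)) ≡ ((+ 3 *ᶻ m₁ -ᶻ r₁) +ᶻ ((+ 3 *ᶻ m₂ -ᶻ r₂) +ᶻ (+ 3 *ᶻ m₃ -ᶻ r₃))) +ᶻ (r₁ +ᶻ (r₂ +ᶻ r₃))
    3Σ = ring-ℤ

    Λ-sum : ∀ r₁ r₂ r₃ m → ΣcΛ r₁ r₂ r₃ m ≡ 0ℤ → + 3 *ᶻ Σ₃ (λ k → k) m ≡ Σ₃ residue (r₁ , r₂ , r₃)
    Λ-sum r₁ r₂ r₃ (m₁ , m₂ , m₃) p = trans (3Σ (residue r₁) (residue r₂) (residue r₃) m₁ m₂ m₃) (trans (cong (_+ᶻ Σ₃ residue (r₁ , r₂ , r₃)) p) (ℤₚ.+-identityˡ _))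

    Λ-plane : ∀ r₁ r₂ r₃ c → Σ₃ residue (r₁ , r₂ , r₃) ≡ + 3 *ᶻ c → Λ r₁ r₂ r₃ ≃ ℤ²
    Λ-plane r₁ r₂ r₃ c e = Sub≃ ≃-refl
        (λ m p → ℤₚ.*-cancelˡ-≡ (+ 3) (Σ₃ (λ k → k) m) c (trans (Λ-sum r₁ r₂ r₃ m p) e))
        (λ { m@(m₁ , m₂ , m₃) p → trans (lem (residue r₁) (residue r₂) (residue r₃) m₁ m₂ m₃) (trans (cong₂ (λ u v → + 3 *ᶻ u -ᶻ v) p e) (ℤₚ.+-inverseʳ (+ 3 *ᶻ c))) })
      ∙ plane≃ c
      where
      lem : ∀ r₁ r₂ r₃ m₁ m₂ m₃ → (+ 3 *ᶻ m₁ -ᶻ r₁) +ᶻ ((+ 3 *ᶻ m₂ -ᶻ r₂) +ᶻ (+ 3 *ᶻ m₃ -ᶻ r₃)) ≡ + 3 *ᶻ (m₁ +ᶻ (m₂ +ᶻ m₃)) -ᶻ (r₁ +ᶻ (r₂ +ᶻ r₃))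
      lem = ring-ℤ

    Λ-empty : ∀ r₁ r₂ r₃ c {d} → (∀ k → + 3 *ᶻ k ≡ d → ⊥) → Σ₃ residue (r₁ , r₂ , r₃) ≡ + 3 *ᶻ c +ᶻ d → Λ r₁ r₂ r₃ → ⊥
    Λ-empty r₁ r₂ r₃ c {d} absurd e (m ∥ p) = absurd (Σ₃ (λ k → k) m -ᶻ c) (trans (lem₁ (Σ₃ (λ k → k) m) c)
      (trans (cong (_-ᶻ + 3 *ᶻ c) (trans (Λ-sum r₁ r₂ r₃ m (recompute (ΣcΛ r₁ r₂ r₃ m ℤₚ.≟ 0ℤ) p)) e)) (lem₂ (+ 3 *ᶻ c) d)))
      where
      lem₁ : ∀ s c → + 3 *ᶻ (s -ᶻ c) ≡ + 3 *ᶻ s -ᶻ + 3 *ᶻ c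
      lem₁ = ring-ℤ
      lem₂ : ∀ c d → (c +ᶻ d) -ᶻ c ≡ d
      lem₂ = ring-ℤ

    :tri : ∀ {n} → Polynomial n → Polynomial n
    :tri j = j :* (j :+ con 1ℤ)

    :wM : ∀ {n} → Polynomial n → Polynomial n → Polynomial n
    :wM r m = con (+ 3) :* :tri m :- con (+ 2) :* (r :* m)

    :wΣ : ∀ {n} → Polynomial n → Polynomial n → Polynomial n → Polynomial n
    :wΣ r y z = :tri (:- r :- y :- z) :+ (:tri y :+ :tri z)

    :wK : ∀ {n} → Polynomial n → Polynomial n → Polynomial n
    :wK x y = con (+ 2) :* (con (+ 3) :* (x :* x :+ x :* y :+ y :* y) :+ con (+ 2) :* x :+ y)

    :Λ : ∀ {n} → ℤ → ℤ → ℤ → ℤ → Polynomial n → Polynomial n → Polynomial n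
    :Λ r₁ r₂ r₃ c y z = :wM (con r₁) (con c :- y :- z) :+ (:wM (con r₂) y :+ :wM (con r₃) z)

  pattern 0F = zero
  pattern 1F = suc zero
  pattern 2F = suc (suc zero)

  module LambdaTable {α ℓ κ : Series} (Gα : GF ℤ² (on² (wΣ 0ℤ)) α) (Gℓ : GF ℤ² (on² (wΣ 1ℤ)) ℓ) (Gκ : GF ℤ² (on² wK) κ) where

    -- A vanishing total forces 3 to divide r₁ + r₂ + r₃, so the residues are all equal or all
    -- distinct. Residues 0, 0, 0 give the enlarged hexagonal lattice, equal nonzero ones an
    -- enlarged shifted lattice with least exponent 2, and each of the six distinct orders gives q
    -- κ.
    fΛ : Fin 3 → Fin 3 → Fin 3 → Series
    fΛ = three (three (three (V α) O O) (three O O Q) (three O Q O))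
               (three (three O O Q) (three O R O) (three Q O O))
               (three (three O Q O) (three Q O O) (three O O R))
      where
      O Q R : Series
      O = const 0ℤ
      Q = q ⊛ κ
      R = q ⊛ (q ⊛ V ℓ)

    gf-Λ : ∀ r₁ r₂ r₃ → GF (Λ r₁ r₂ r₃) (wΛ r₁ r₂ r₃) (fΛ r₁ r₂ r₃)
    gf-Λ 0F 0F 0F = gf-from (Λ-plane 0F 0F 0F 0ℤ refl)
      (λ { (y , z) → solve 2 (λ y z → :Λ 0ℤ 0ℤ 0ℤ 0ℤ y z := con (+ 3) :* :wΣ (con 0ℤ) y z) refl y z }) (gf-V Gα)
    gf-Λ 1F 1F 1F = gf-from (Λ-plane 1F 1F 1F 1ℤ refl ∙ affine≃ (λ y z → -ᶻ y) (λ y z → -ᶻ z) (λ y z → -ᶻ y) (λ y z → -ᶻ z) ring-ℤ ring-ℤ ring-ℤ ring-ℤ)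
      (λ { (y , z) → solve 2 (λ y z → :Λ 1ℤ 1ℤ 1ℤ 1ℤ (:- y) (:- z) := con (+ 2) :+ (con (+ 2) :+ con (+ 3) :* :wΣ (con 1ℤ) y z)) refl y z }) (gf-q (gf-q (gf-V Gℓ)))
    gf-Λ 2F 2F 2F = gf-from (Λ-plane 2F 2F 2F (+ 2) refl ∙ affine≃ (λ y z → y -ᶻ 1ℤ) (λ y z → z -ᶻ 1ℤ) (λ y z → y +ᶻ 1ℤ) (λ y z → z +ᶻ 1ℤ) ring-ℤ ring-ℤ ring-ℤ ring-ℤ)
      (λ { (y , z) → solve 2 (λ y z → :Λ (+ 2) (+ 2) (+ 2) (+ 2) (y :+ con 1ℤ) (z :+ con 1ℤ) := con (+ 2) :+ (con (+ 2) :+ con (+ 3) :* :wΣ (con 1ℤ) y z)) refl y z }) (gf-q (gf-q (gf-V Gℓ)))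
    gf-Λ 0F 1F 2F = gf-from (Λ-plane 0F 1F 2F 1ℤ refl ∙ affine≃ (λ y z → -ᶻ y) (λ y z → z +ᶻ y -ᶻ 1ℤ) (λ x y → -ᶻ x) (λ x y → x +ᶻ y +ᶻ 1ℤ) ring-ℤ ring-ℤ ring-ℤ ring-ℤ)
      (λ { (x , y) → solve 2 (λ x y → :Λ 0ℤ 1ℤ (+ 2) 1ℤ (:- x) (x :+ y :+ con 1ℤ) := con (+ 2) :+ :wK x y) refl x y }) (gf-q Gκ)
    gf-Λ 0F 2F 1F = gf-from (Λ-plane 0F 2F 1F 1ℤ refl ∙ affine≃ (λ y z → -ᶻ z) (λ y z → z +ᶻ y -ᶻ 1ℤ) (λ x y → x +ᶻ y +ᶻ 1ℤ) (λ x y → -ᶻ x) ring-ℤ ring-ℤ ring-ℤ ring-ℤ)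
      (λ { (x , y) → solve 2 (λ x y → :Λ 0ℤ (+ 2) 1ℤ 1ℤ (x :+ y :+ con 1ℤ) (:- x) := con (+ 2) :+ :wK x y) refl x y }) (gf-q Gκ)
    gf-Λ 1F 0F 2F = gf-from (Λ-plane 1F 0F 2F 1ℤ refl ∙ affine≃ (λ y z → z +ᶻ y -ᶻ 1ℤ) (λ y z → -ᶻ y) (λ x y → -ᶻ y) (λ x y → x +ᶻ y +ᶻ 1ℤ) ring-ℤ ring-ℤ ring-ℤ ring-ℤ)
      (λ { (x , y) → solve 2 (λ x y → :Λ 1ℤ 0ℤ (+ 2) 1ℤ (:- y) (x :+ y :+ con 1ℤ) := con (+ 2) :+ :wK x y) refl x y }) (gf-q Gκ)
    gf-Λ 2F 0F 1F = gf-from (Λ-plane 2F 0F 1F 1ℤ refl ∙ affine≃ (λ y z → -ᶻ z) (λ y z → -ᶻ y) (λ x y → -ᶻ y) (λ x y → -ᶻ x) ring-ℤ ring-ℤ ring-ℤ ring-ℤ)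
      (λ { (x , y) → solve 2 (λ x y → :Λ (+ 2) 0ℤ 1ℤ 1ℤ (:- y) (:- x) := con (+ 2) :+ :wK x y) refl x y }) (gf-q Gκ)
    gf-Λ 1F 2F 0F = gf-from (Λ-plane 1F 2F 0F 1ℤ refl ∙ affine≃ (λ y z → y +ᶻ z -ᶻ 1ℤ) (λ y z → -ᶻ z) (λ x y → x +ᶻ y +ᶻ 1ℤ) (λ x y → -ᶻ y) ring-ℤ ring-ℤ ring-ℤ ring-ℤ)
      (λ { (x , y) → solve 2 (λ x y → :Λ 1ℤ (+ 2) 0ℤ 1ℤ (x :+ y :+ con 1ℤ) (:- y) := con (+ 2) :+ :wK x y) refl x y }) (gf-q Gκ)
    gf-Λ 2F 1F 0F = gf-from (Λ-plane 2F 1F 0F 1ℤ refl ∙ affine≃ (λ y z → -ᶻ y) (λ y z → -ᶻ z) (λ x y → -ᶻ x) (λ x y → -ᶻ y) ring-ℤ ring-ℤ ring-ℤ ring-ℤ)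
      (λ { (x , y) → solve 2 (λ x y → :Λ (+ 2) 1ℤ 0ℤ 1ℤ (:- x) (:- y) := con (+ 2) :+ :wK x y) refl x y }) (gf-q Gκ)
    gf-Λ 0F 0F 1F = gf-⊥ (Λ-empty 0F 0F 1F 0ℤ 3k≢1 refl)
    gf-Λ 0F 0F 2F = gf-⊥ (Λ-empty 0F 0F 2F 0ℤ 3k≢2 refl)
    gf-Λ 0F 1F 0F = gf-⊥ (Λ-empty 0F 1F 0F 0ℤ 3k≢1 refl)
    gf-Λ 0F 1F 1F = gf-⊥ (Λ-empty 0F 1F 1F 0ℤ 3k≢2 refl)
    gf-Λ 0F 2F 0F = gf-⊥ (Λ-empty 0F 2F 0F 0ℤ 3k≢2 refl)
    gf-Λ 0F 2F 2F = gf-⊥ (Λ-empty 0F 2F 2F 1ℤ 3k≢1 refl)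
    gf-Λ 1F 0F 0F = gf-⊥ (Λ-empty 1F 0F 0F 0ℤ 3k≢1 refl)
    gf-Λ 1F 0F 1F = gf-⊥ (Λ-empty 1F 0F 1F 0ℤ 3k≢2 refl)
    gf-Λ 1F 1F 0F = gf-⊥ (Λ-empty 1F 1F 0F 0ℤ 3k≢2 refl)
    gf-Λ 1F 1F 2F = gf-⊥ (Λ-empty 1F 1F 2F 1ℤ 3k≢1 refl)
    gf-Λ 1F 2F 1F = gf-⊥ (Λ-empty 1F 2F 1F 1ℤ 3k≢1 refl)
    gf-Λ 1F 2F 2F = gf-⊥ (Λ-empty 1F 2F 2F 1ℤ 3k≢2 refl)
    gf-Λ 2F 0F 0F = gf-⊥ (Λ-empty 2F 0F 0F 0ℤ 3k≢2 refl)
    gf-Λ 2F 0F 2F = gf-⊥ (Λ-empty 2F 0F 2F 1ℤ 3k≢1 refl)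
    gf-Λ 2F 1F 1F = gf-⊥ (Λ-empty 2F 1F 1F 1ℤ 3k≢1 refl)
    gf-Λ 2F 1F 2F = gf-⊥ (Λ-empty 2F 1F 2F 1ℤ 3k≢2 refl)
    gf-Λ 2F 2F 0F = gf-⊥ (Λ-empty 2F 2F 0F 1ℤ 3k≢1 refl)
    gf-Λ 2F 2F 1F = gf-⊥ (Λ-empty 2F 2F 1F 1ℤ 3k≢2 refl)

    sum-Fin3 : (Fin 3 → Series) → Series
    sum-Fin3 f = f zero ⊕ (f (suc zero) ⊕ f (suc (suc zero)))

    private
      N₉ : Set
      N₉ = Sub (Tri (Tri State)) (λ x → Σ₃ (Σ₃ charge) x ≡ 0ℤ)

      Blocks : Set
      Blocks = Σ (Fin 3) (λ r₁ → Σ (Fin 3) (λ r₂ → Σ (Fin 3) (λ r₃ → Λ r₁ r₂ r₃ × (D × (D × D)))))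

      chargeOf : Σ (Fin 3) (λ _ → ℤ × D) → ℤ
      chargeOf (r , m , d) = + 3 *ᶻ m -ᶻ residue r

      charge≡ : ∀ x → Σ₃ (Σ₃ charge) x ≡ Σ₃ chargeOf (to (tri≃ bySum) x)
      charge≡ (x , y , z) = cong₂ _+ᶻ_ (bySum-charge x) (cong₂ _+ᶻ_ (bySum-charge y) (bySum-charge z))

      blocks : N₉ ≃ Blocks
      blocks = Sub≃ (tri≃ bySum) (λ x p → trans (sym (charge≡ x)) p)
                 (λ y p → trans (charge≡ (from (tri≃ bySum) y)) (trans (cong (Σ₃ chargeOf) (to-from (tri≃ bySum) y)) p)) ∙ record
        { to = λ { (((r₁ , m₁ , d₁) , (r₂ , m₂ , d₂) , (r₃ , m₃ , d₃)) ∥ p) → r₁ , r₂ , r₃ , (((m₁ , m₂ , m₃) ∥ p) , (d₁ , d₂ , d₃)) }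
        ; from = λ { (r₁ , r₂ , r₃ , (((m₁ , m₂ , m₃) ∥ p) , (d₁ , d₂ , d₃))) → ((r₁ , m₁ , d₁) , (r₂ , m₂ , d₂) , (r₃ , m₃ , d₃)) ∥ p }
        ; from-to = λ _ → refl ; to-from = λ _ → refl }

      wBlocks : Blocks → ℤ
      wBlocks (r₁ , r₂ , r₃ , (m , (d₁ , d₂ , d₃))) = wΛ r₁ r₂ r₃ m +ᶻ (wD r₁ d₁ +ᶻ (wD r₂ d₂ +ᶻ wD r₃ d₃))

      weight≡ : ∀ x → Σ₃ (Σ₃ weight₂) (val x) ≡ wBlocks (to blocks x)
      weight≡ ((x , y , z) ∥ p) = trans (cong₂ _+ᶻ_ (bySum-weight x) (cong₂ _+ᶻ_ (bySum-weight y) (bySum-weight z))) (lem (M x) (M y) (M z) (E x) (E y) (E z))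
        where
        M E : Tri State → ℤ
        M x = let r , m , d = to bySum x in wM (residue r) m
        E x = let r , m , d = to bySum x in wD r d
        lem : ∀ a b c x y z → (a +ᶻ x) +ᶻ ((b +ᶻ y) +ᶻ (c +ᶻ z)) ≡ (a +ᶻ (b +ᶻ c)) +ᶻ (x +ᶻ (y +ᶻ z))
        lem = ring-ℤ

    -- Given its residue r, each triple splits into an integer m and centred data counted by `d r`.
    -- The total charge constrains the three m alone, and these are counted by `fΛ`.
    gf-nine : ∀ {C} → GF State₀ weight₀ C → let d = λ r → three α ℓ ℓ r ⊛ (C ⊛ (C ⊛ C)) in
      GF (Sub (Tri (Tri State)) (λ x → Σ₃ (Σ₃ charge) x ≡ 0ℤ)) (λ x → Σ₃ (Σ₃ weight₂) (val x))
         (sum-Fin3 (λ r₁ → sum-Fin3 (λ r₂ → sum-Fin3 (λ r₃ → fΛ r₁ r₂ r₃ ⊛ (d r₁ ⊛ (d r₂ ⊛ d r₃))))))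
    gf-nine {C} GC = gf-≃ blocks weight≡ (gf-≃ ≃-refl (λ _ → refl) (gf-Fin3 {f = λ r₁ → sum-Fin3 (λ r₂ → sum-Fin3 (λ r₃ → fΛ r₁ r₂ r₃ ⊛ (d r₁ ⊛ (d r₂ ⊛ d r₃))))}
      (λ r₁ → gf-≃ ≃-refl (λ _ → refl) (gf-Fin3 {f = λ r₂ → sum-Fin3 (λ r₃ → fΛ r₁ r₂ r₃ ⊛ (d r₁ ⊛ (d r₂ ⊛ d r₃)))}
        (λ r₂ → gf-≃ ≃-refl (λ _ → refl) (gf-Fin3 {f = λ r₃ → fΛ r₁ r₂ r₃ ⊛ (d r₁ ⊛ (d r₂ ⊛ d r₃))}
          (λ r₃ → gf-≃ ≃-refl (λ _ → refl) (gf-× (gf-Λ r₁ r₂ r₃) (gf-× (gf-D GC Gα Gℓ r₁) (gf-× (gf-D GC Gα Gℓ r₂) (gf-D GC Gα Gℓ r₃)))))))))))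
      where
      d : Fin 3 → Series
      d r = three α ℓ ℓ r ⊛ (C ⊛ (C ⊛ C))

-- The rotation of three colours behind C³ (a(q³) - 3q κ(q³)) = C(q³).

module ColourRotation where
  open PowerSeries using (_⊕_; _⊛_)
  open Trisection using (V)
  open GeneratingFunctions
  open Streams
  open States
  open Lattices
  open TripleStates
  open import Data.Bool using (Bool; true; false)
  open import Data.List using ([]; _∷_)
  import Data.Fin.Properties as Finₚ

  class : ℤ → Fin 3
  class s = proj₂ (to div3 s)

  next prev : Fin 3 → Fin 3
  next 0F = 1F
  next 1F = 2F
  next 2F = 0F
  prev 0F = 2F
  prev 1F = 0F
  prev 2F = 1F

  class-compose : ∀ m r s → from div3 (m , r) ≡ s → class s ≡ r
  class-compose m r s p = trans (cong class (sym p)) (cong proj₂ (to-from div3 (m , r)))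

  -- Residues are taken in the form s = 3m - r, so lowering s by one raises the class.
  class-step : ∀ s k → class (s +ᶻ (+ 3 *ᶻ k -ᶻ 1ℤ)) ≡ next (class s)
  class-step s k = subst (λ u → class (u +ᶻ (+ 3 *ᶻ k -ᶻ 1ℤ)) ≡ next (class s)) (from-to div3 s) (go (proj₁ (to div3 s)) (class s))
    where
    lem₀ : ∀ m k → + 3 *ᶻ (m +ᶻ k) -ᶻ 1ℤ ≡ (+ 3 *ᶻ m -ᶻ 0ℤ) +ᶻ (+ 3 *ᶻ k -ᶻ 1ℤ)
    lem₀ = ring-ℤ
    lem₁ : ∀ m k → + 3 *ᶻ (m +ᶻ k) -ᶻ + 2 ≡ (+ 3 *ᶻ m -ᶻ 1ℤ) +ᶻ (+ 3 *ᶻ k -ᶻ 1ℤ)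
    lem₁ = ring-ℤ
    lem₂ : ∀ m k → + 3 *ᶻ (m +ᶻ k -ᶻ 1ℤ) -ᶻ 0ℤ ≡ (+ 3 *ᶻ m -ᶻ + 2) +ᶻ (+ 3 *ᶻ k -ᶻ 1ℤ)
    lem₂ = ring-ℤ
    go : ∀ m r → class (from div3 (m , r) +ᶻ (+ 3 *ᶻ k -ᶻ 1ℤ)) ≡ next r
    go m 0F = class-compose (m +ᶻ k) 1F _ (lem₀ m k)
    go m 1F = class-compose (m +ᶻ k) 2F _ (lem₁ m k)
    go m 2F = class-compose (m +ᶻ k -ᶻ 1ℤ) 0F _ (lem₂ m k)

  colourClass : Tri State → Fin 3
  colourClass (x₀ , x₁ , x₂) = class (charge x₁ -ᶻ charge x₂)

  Neutral : Fin 3 → Tri State → Set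
  Neutral r x = (Σ₃ charge x ≡ 0ℤ) × (colourClass x ≡ r)

  private
    PlaneClass : Fin 3 → Tri ℤ → Set
    PlaneClass r j = (Σ₃ (λ k → k) j ≡ 0ℤ) × (class (proj₁ (proj₂ j) -ᶻ proj₂ (proj₂ j)) ≡ r)

    planeClass : ∀ r → Sub (Tri ℤ) (PlaneClass r) ≃ ℤ²
    planeClass r = record
      { to = λ { ((x , y , z) ∥ p) → z , proj₁ (to div3 (y -ᶻ z)) }
      ; from = λ { (p , n) → let y = p +ᶻ from div3 (n , r) in (0ℤ -ᶻ y -ᶻ p , y , p) ∥ (lem₁ y p , class-compose n r _ (lem₂ p (from div3 (n , r)))) }
      ; from-to = λ { ((x , y , z) ∥ p) → Sub-≡ (back x y z (recompute (_ ℤₚ.≟ 0ℤ) (proj₁ p)) (recompute (_ Finₚ.≟ r) (proj₂ p))) }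
      ; to-from = λ { (p , n) → cong (λ w → p , proj₁ w) (trans (cong (to div3) (sym (lem₂ p (from div3 (n , r))))) (to-from div3 (n , r))) } }
      where
      lem₁ : ∀ y z → (0ℤ -ᶻ y -ᶻ z) +ᶻ (y +ᶻ z) ≡ 0ℤ
      lem₁ = ring-ℤ
      lem₂ : ∀ p d → d ≡ (p +ᶻ d) -ᶻ p
      lem₂ = ring-ℤ
      lem₃ : ∀ y z → z +ᶻ (y -ᶻ z) ≡ y
      lem₃ = ring-ℤ
      lem₄ : ∀ x y z → (x +ᶻ (y +ᶻ z)) -ᶻ y -ᶻ z ≡ x
      lem₄ = ring-ℤ
      back : ∀ x y z → x +ᶻ (y +ᶻ z) ≡ 0ℤ → class (y -ᶻ z) ≡ r →
        (let y′ = z +ᶻ from div3 (proj₁ (to div3 (y -ᶻ z)) , r) in (0ℤ -ᶻ y′ -ᶻ z , y′ , z)) ≡ (x , y , z)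
      back x y z p e = trans (cong (λ y → (0ℤ -ᶻ y -ᶻ z , y , z)) y≡) (cong (_, y , z) (trans (cong (λ s → s -ᶻ y -ᶻ z) (sym p)) (lem₄ x y z)))
        where
        y≡ : z +ᶻ from div3 (proj₁ (to div3 (y -ᶻ z)) , r) ≡ y
        y≡ = trans (cong (λ r → z +ᶻ from div3 (proj₁ (to div3 (y -ᶻ z)) , r)) (sym e)) (trans (cong (z +ᶻ_) (from-to div3 (y -ᶻ z))) (lem₃ y z))

  gf-Neutral : ∀ {C f} → GF State₀ weight₀ C → ∀ r → GF ℤ² (λ { (p , n) → wΣ 0ℤ (p +ᶻ from div3 (n , r)) p }) f →
    GF (Sub (Tri State) (Neutral r)) (λ x → Σ₃ weight₂ (val x)) (f ⊛ (C ⊛ (C ⊛ C)))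
  gf-Neutral GC r G = gf-≃
    (Sub≃ {P = Neutral r} {Q = λ w → PlaneClass r (proj₁ w)} jacobi₃ (λ _ p → p) (λ y p → subst (λ w → PlaneClass r (proj₁ w)) (sym (to-from jacobi₃ y)) p)
     ∙ Sub-×ˡ)
    (λ { ((x₀ , x₁ , x₂) ∥ p) → trans (cong₂ _+ᶻ_ (jacobi-weight x₀) (cong₂ _+ᶻ_ (jacobi-weight x₁) (jacobi-weight x₂)))
         (lem (tri₂ (charge x₀)) (tri₂ (charge x₁)) (tri₂ (charge x₂)) (weight₀ (proj₂ (to jacobi x₀))) (weight₀ (proj₂ (to jacobi x₁))) (weight₀ (proj₂ (to jacobi x₂)))) })
    (gf-× {W = λ j → Σ₃ tri₂ (val j)} (gf-from (planeClass r) (λ { (p , n) → refl }) G) (gf-Tri GC))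
    where
    lem : ∀ a b c x y z → (a +ᶻ x) +ᶻ ((b +ᶻ y) +ᶻ (c +ᶻ z)) ≡ (a +ᶻ (b +ᶻ c)) +ᶻ (x +ᶻ (y +ᶻ z))
    lem = ring-ℤ

  private
    w₃ wδ : Letter → ℤ
    w₃ full           = + 3
    w₃ (part false c) = 1ℤ
    w₃ (part true c)  = + 2
    wδ full       = 0ℤ
    wδ (part b 0F) = 0ℤ
    wδ (part b 1F) = 1ℤ
    wδ (part b 2F) = -[1+ 0 ]

    total : (ℕ → ℤ) → Seq Letter → ℤ
    total = sumSeq w₃

    δ : Seq Letter → ℤ
    δ = sumSeq wδ (λ _ → 1ℤ)

    sumSeq-weights : ∀ {L} (u v w : L → ℤ) c d → (∀ l → u l ≡ c *ᶻ v l +ᶻ d *ᶻ w l) → ∀ φ s → sumSeq u φ s ≡ c *ᶻ sumSeq v φ s +ᶻ d *ᶻ sumSeq w φ s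
    sumSeq-weights u v w c d p φ []            = sym (cong₂ _+ᶻ_ (ℤₚ.*-zeroʳ c) (ℤₚ.*-zeroʳ d))
    sumSeq-weights u v w c d p φ ((g , l) ∷ s) =
      trans (cong₂ (λ x y → x *ᶻ φ g +ᶻ y) (p l) (sumSeq-weights u v w c d p (λ n → φ (suc (g + n))) s))
        (lem c d (v l) (w l) (φ g) (sumSeq v (λ n → φ (suc (g + n))) s) (sumSeq w (λ n → φ (suc (g + n))) s))
      where
      lem : ∀ c d v w x y z → (c *ᶻ v +ᶻ d *ᶻ w) *ᶻ x +ᶻ (c *ᶻ y +ᶻ d *ᶻ z) ≡ c *ᶻ (v *ᶻ x +ᶻ y) +ᶻ d *ᶻ (w *ᶻ x +ᶻ z)
      lem = ring-ℤ

    total-parallel : ∀ φ x → total φ (to parallel x) ≡ Σ₃ (sumRow φ) x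
    total-parallel φ x@(r₀ , r₁ , r₂) = trans (sumSeq-weights w₃ (mwone bit₀) u 1ℤ 1ℤ split₁ φ (to parallel x))
      (trans (cong (λ z → 1ℤ *ᶻ sumSeq (mwone bit₀) φ (to parallel x) +ᶻ 1ℤ *ᶻ z) (sumSeq-weights u (mwone bit₁) (mwone bit₂) 1ℤ 1ℤ (λ _ → refl) φ (to parallel x)))
      (trans (lem (sumSeq (mwone bit₀) φ (to parallel x)) (sumSeq (mwone bit₁) φ (to parallel x)) (sumSeq (mwone bit₂) φ (to parallel x))) (cong₂ _+ᶻ_ (proj₁ (sum-parallel φ x)) (cong₂ _+ᶻ_ (proj₁ (proj₂ (sum-parallel φ x))) (proj₂ (proj₂ (sum-parallel φ x)))))))
      where
      u : Letter → ℤ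
      u l = 1ℤ *ᶻ mwone bit₁ l +ᶻ 1ℤ *ᶻ mwone bit₂ l
      split₁ : ∀ l → w₃ l ≡ 1ℤ *ᶻ mwone bit₀ l +ᶻ 1ℤ *ᶻ u l
      split₁ full = refl
      split₁ (part false 0F) = refl
      split₁ (part false 1F) = refl
      split₁ (part false 2F) = refl
      split₁ (part true 0F) = refl
      split₁ (part true 1F) = refl
      split₁ (part true 2F) = refl
      lem : ∀ a b c → 1ℤ *ᶻ a +ᶻ 1ℤ *ᶻ (1ℤ *ᶻ b +ᶻ 1ℤ *ᶻ c) ≡ a +ᶻ (b +ᶻ c)
      lem = ring-ℤ

    δ-parallel : ∀ x → δ (to parallel x) ≡ len (proj₁ (proj₂ x)) -ᶻ len (proj₂ (proj₂ x))
    δ-parallel x@(r₀ , r₁ , r₂) = trans (sumSeq-weights wδ (mwone bit₁) (mwone bit₂) 1ℤ (-[1+ 0 ]) split₁ (λ _ → 1ℤ) (to parallel x))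
      (trans (lem (sumSeq (mwone bit₁) (λ _ → 1ℤ) (to parallel x)) (sumSeq (mwone bit₂) (λ _ → 1ℤ) (to parallel x))) (cong₂ _-ᶻ_ (proj₁ (proj₂ (sum-parallel (λ _ → 1ℤ) x))) (proj₂ (proj₂ (sum-parallel (λ _ → 1ℤ) x)))))
      where
      split₁ : ∀ l → wδ l ≡ 1ℤ *ᶻ mwone bit₁ l +ᶻ -[1+ 0 ] *ᶻ mwone bit₂ l
      split₁ full = refl
      split₁ (part false 0F) = refl
      split₁ (part false 1F) = refl
      split₁ (part false 2F) = refl
      split₁ (part true 0F) = refl
      split₁ (part true 1F) = refl
      split₁ (part true 2F) = refl
      lem : ∀ a b → 1ℤ *ᶻ a +ᶻ -[1+ 0 ] *ᶻ b ≡ a -ᶻ b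
      lem = ring-ℤ

    Rest : Set
    Rest = Row × (ℕ × Bool) × Seq Letter

    -- A word either consists of full letters or has a first partial letter; in the latter case its
    -- colour is split off as an independent coordinate.
    Cases : Set
    Cases = Row ⊎ (Rest × Fin 3)

    cons : ℕ → Cases → Cases
    cons g (inj₁ r)               = inj₁ ((g , tt) ∷ r)
    cons g (inj₂ ((r , x , s) , c)) = inj₂ (((g , tt) ∷ r , x , s) , c)

    analyse : Seq Letter → Cases
    analyse []                    = inj₁ []
    analyse ((g , full) ∷ s)      = cons g (analyse s)
    analyse ((g , part b c) ∷ s)  = inj₂ (([] , (g , b) , s) , c)

    fulls : Row → Seq Letter → Seq Letter
    fulls []             s = s
    fulls ((g , tt) ∷ r) s = (g , full) ∷ fulls r s

    build : Cases → Seq Letter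
    build (inj₁ r)                     = fulls r []
    build (inj₂ ((r , (g , b) , s) , c)) = fulls r ((g , part b c) ∷ s)

    build-cons : ∀ g x → build (cons g x) ≡ (g , full) ∷ build x
    build-cons g (inj₁ r) = refl
    build-cons g (inj₂ _) = refl

    cases≃ : Seq Letter ≃ Cases
    cases≃ = record { to = analyse ; from = build ; from-to = build-analyse ; to-from = analyse-build }
      where
      build-analyse : ∀ s → build (analyse s) ≡ s
      build-analyse []                   = refl
      build-analyse ((g , full) ∷ s)     = trans (build-cons g (analyse s)) (cong ((g , full) ∷_) (build-analyse s))
      build-analyse ((g , part b c) ∷ s) = refl
      analyse-build : ∀ x → analyse (build x) ≡ x
      analyse-build (inj₁ [])             = refl
      analyse-build (inj₁ ((g , tt) ∷ r)) = cong (cons g) (analyse-build (inj₁ r))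
      analyse-build (inj₂ (([] , x , s) , c)) = refl
      analyse-build (inj₂ (((g , tt) ∷ r , x , s) , c)) = cong (cons g) (analyse-build (inj₂ ((r , x , s) , c)))

    total-full : ∀ φ r → total φ (build (inj₁ r)) ≡ + 3 *ᶻ sumRow φ r
    total-full φ []             = refl
    total-full φ ((g , tt) ∷ r) = trans (cong (+ 3 *ᶻ φ g +ᶻ_) (total-full (λ n → φ (suc (g + n))) r)) (lem (φ g) (sumRow (λ n → φ (suc (g + n))) r))
      where
      lem : ∀ x y → + 3 *ᶻ x +ᶻ + 3 *ᶻ y ≡ + 3 *ᶻ (1ℤ *ᶻ x +ᶻ y)
      lem = ring-ℤ

    δ-full : ∀ r → δ (build (inj₁ r)) ≡ 0ℤ
    δ-full []             = refl
    δ-full ((g , tt) ∷ r) = trans (ℤₚ.+-identityˡ _) (δ-full r)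

    -- For fixed b the three letters `part b c` occupy equally many rows, so neither charge nor
    -- weight sees the colour.
    total-rest : ∀ φ x c c′ → total φ (build (inj₂ (x , c))) ≡ total φ (build (inj₂ (x , c′)))
    total-rest φ ([] , (g , false) , s) c c′ = refl
    total-rest φ ([] , (g , true) , s) c c′ = refl
    total-rest φ ((g , tt) ∷ r , x , s) c c′ = cong (+ 3 *ᶻ φ g +ᶻ_) (total-rest (λ n → φ (suc (g + n))) (r , x , s) c c′)

    wδ-part : ∀ b c → wδ (part b c) ≡ wδ (part false c)
    wδ-part b 0F = refl
    wδ-part b 1F = refl
    wδ-part b 2F = refl

    δ-rest : ∀ x c c′ → δ (build (inj₂ (x , c))) ≡ δ (build (inj₂ (x , c′))) +ᶻ (wδ (part false c) -ᶻ wδ (part false c′))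
    δ-rest ([] , (g , b) , s) c c′ rewrite wδ-part b c | wδ-part b c′ = lem (wδ (part false c)) (wδ (part false c′)) (δ s)
      where
      lem : ∀ x y z → x *ᶻ 1ℤ +ᶻ z ≡ (y *ᶻ 1ℤ +ᶻ z) +ᶻ (x -ᶻ y)
      lem = ring-ℤ
    δ-rest ((g , tt) ∷ r , x , s) c c′ = trans (ℤₚ.+-identityˡ _) (trans (δ-rest (r , x , s) c c′) (cong (_+ᶻ (wδ (part false c) -ᶻ wδ (part false c′))) (sym (ℤₚ.+-identityˡ (δ (build (inj₂ ((r , x , s) , c′))))))))

    Z² : Set
    Z² = Seq Letter × Seq Letter

    NeutralZ : Fin 3 → Z² → Set
    NeutralZ r (t , b) = (total (λ _ → 1ℤ) t -ᶻ total (λ _ → 1ℤ) b ≡ 0ℤ) × (class (δ t -ᶻ δ b) ≡ r)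

    weightZ : Z² → ℤ
    weightZ (t , b) = + 2 *ᶻ (total (λ n → + suc n) t +ᶻ total (λ n → + n) b)

    words : Tri State ≃ Z²
    words = ≃-sym zip₃ ∙ (parallel ×≃ parallel)

    charge-words : ∀ x → (let t , b = to words x in total (λ _ → 1ℤ) t -ᶻ total (λ _ → 1ℤ) b) ≡ Σ₃ charge x
    charge-words ((t₀ , b₀) , (t₁ , b₁) , (t₂ , b₂)) = trans (cong₂ _-ᶻ_ (total-parallel (λ _ → 1ℤ) (t₀ , t₁ , t₂)) (total-parallel (λ _ → 1ℤ) (b₀ , b₁ , b₂)))
      (lem (len t₀) (len t₁) (len t₂) (len b₀) (len b₁) (len b₂))
      where
      lem : ∀ a b c x y z → (a +ᶻ (b +ᶻ c)) -ᶻ (x +ᶻ (y +ᶻ z)) ≡ (a -ᶻ x) +ᶻ ((b -ᶻ y) +ᶻ (c -ᶻ z))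
      lem = ring-ℤ

    class-words : ∀ x → (let t , b = to words x in class (δ t -ᶻ δ b)) ≡ colourClass x
    class-words ((t₀ , b₀) , (t₁ , b₁) , (t₂ , b₂)) = cong class (trans (cong₂ _-ᶻ_ (δ-parallel (t₀ , t₁ , t₂)) (δ-parallel (b₀ , b₁ , b₂)))
      (lem (len t₁) (len t₂) (len b₁) (len b₂)))
      where
      lem : ∀ b c y z → (b -ᶻ c) -ᶻ (y -ᶻ z) ≡ (b -ᶻ y) -ᶻ (c -ᶻ z)
      lem = ring-ℤ

    weight-words : ∀ x → Σ₃ weight₂ x ≡ weightZ (to words x)
    weight-words ((t₀ , b₀) , (t₁ , b₁) , (t₂ , b₂)) = trans (lem (sum⁺ t₀) (sum⁺ t₁) (sum⁺ t₂) (sum⁰ b₀) (sum⁰ b₁) (sum⁰ b₂))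
      (cong₂ (λ u v → + 2 *ᶻ (u +ᶻ v)) (sym (total-parallel (λ n → + suc n) (t₀ , t₁ , t₂))) (sym (total-parallel (λ n → + n) (b₀ , b₁ , b₂))))
      where
      lem : ∀ a b c x y z → + 2 *ᶻ (a +ᶻ x) +ᶻ (+ 2 *ᶻ (b +ᶻ y) +ᶻ + 2 *ᶻ (c +ᶻ z)) ≡ + 2 *ᶻ ((a +ᶻ (b +ᶻ c)) +ᶻ (x +ᶻ (y +ᶻ z)))
      lem = ring-ℤ

    neutralWords : ∀ r → Sub (Tri State) (Neutral r) ≃ Sub Z² (NeutralZ r)
    neutralWords r = Sub≃ words (λ { x (p , e) → trans (charge-words x) p , trans (class-words x) e })
      (λ { y (p , e) → trans (sym (charge-words (from words y))) (trans (cong (λ { (t , b) → total (λ _ → 1ℤ) t -ᶻ total (λ _ → 1ℤ) b }) (to-from words y)) p)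
                     , trans (sym (class-words (from words y))) (trans (cong (λ { (t , b) → class (δ t -ᶻ δ b) }) (to-from words y)) e) })

    -- The letter to be rotated is the first partial one of the top word; the bottom word is
    -- consulted when the top word is full. Rotation preserves this choice and is therefore
    -- invertible.
    Rotatable : Set
    Rotatable = ((Rest × Fin 3) × Cases) ⊎ (Row × (Rest × Fin 3))

    embed : Rotatable → Z²
    embed (inj₁ (x , y)) = build (inj₂ x) , build y
    embed (inj₂ (r , x)) = build (inj₁ r) , build (inj₂ x)

    fullPair : Row × Row → Z²
    fullPair (r , s) = build (inj₁ r) , build (inj₁ s)

    splitZ : Z² ≃ ((Row × Row) ⊎ Rotatable)
    splitZ = (cases≃ ×≃ cases≃) ∙ record
      { to = λ { (inj₁ r , inj₁ s) → inj₁ (r , s) ; (inj₁ r , inj₂ x) → inj₂ (inj₂ (r , x)) ; (inj₂ x , y) → inj₂ (inj₁ (x , y)) }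
      ; from = λ { (inj₁ (r , s)) → inj₁ r , inj₁ s ; (inj₂ (inj₂ (r , x))) → inj₁ r , inj₂ x ; (inj₂ (inj₁ (x , y))) → inj₂ x , y }
      ; from-to = λ { (inj₁ r , inj₁ s) → refl ; (inj₁ r , inj₂ x) → refl ; (inj₂ x , y) → refl }
      ; to-from = λ { (inj₁ (r , s)) → refl ; (inj₂ (inj₂ (r , x))) → refl ; (inj₂ (inj₁ (x , y))) → refl } }

    Sub-⊎ : ∀ {X A B : Set} {P : X → Set} (e : X ≃ (A ⊎ B)) → Sub X P ≃ (Sub A (λ a → P (from e (inj₁ a))) ⊎ Sub B (λ b → P (from e (inj₂ b))))
    Sub-⊎ {P = P} e = Sub≃ {Q = λ y → P (from e y)} e (λ x p → subst P (sym (from-to e x)) p) (λ y p → p) ∙ record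
      { to = λ { (inj₁ a ∥ p) → inj₁ (a ∥ p) ; (inj₂ b ∥ p) → inj₂ (b ∥ p) }
      ; from = λ { (inj₁ (a ∥ p)) → inj₁ a ∥ p ; (inj₂ (b ∥ p)) → inj₂ b ∥ p }
      ; from-to = λ { (inj₁ a ∥ p) → refl ; (inj₂ b ∥ p) → refl }
      ; to-from = λ { (inj₁ (a ∥ p)) → refl ; (inj₂ (b ∥ p)) → refl } }

    rotate : Rotatable ≃ Rotatable
    rotate = record
      -- The class belongs to δ t - δ b and rises when this difference falls, so a top letter turns
      -- backward and a bottom letter forward.
      { to = λ { (inj₁ ((x , c) , y)) → inj₁ ((x , prev c) , y) ; (inj₂ (r , (x , c))) → inj₂ (r , (x , next c)) }
      ; from = λ { (inj₁ ((x , c) , y)) → inj₁ ((x , next c) , y) ; (inj₂ (r , (x , c))) → inj₂ (r , (x , prev c)) }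
      ; from-to = λ { (inj₁ ((x , c) , y)) → cong (λ c → inj₁ ((x , c) , y)) (next-prev c) ; (inj₂ (r , (x , c))) → cong (λ c → inj₂ (r , (x , c))) (prev-next c) }
      ; to-from = λ { (inj₁ ((x , c) , y)) → cong (λ c → inj₁ ((x , c) , y)) (prev-next c) ; (inj₂ (r , (x , c))) → cong (λ c → inj₂ (r , (x , c))) (next-prev c) } }
      where
      next-prev : ∀ c → next (prev c) ≡ c
      next-prev 0F = refl
      next-prev 1F = refl
      next-prev 2F = refl
      prev-next : ∀ c → prev (next c) ≡ c
      prev-next 0F = refl
      prev-next 1F = refl
      prev-next 2F = refl

    chargeZ weightR : Rotatable → ℤ
    chargeZ x = let t , b = embed x in total (λ _ → 1ℤ) t -ᶻ total (λ _ → 1ℤ) b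
    weightR x = weightZ (embed x)

    classR : Rotatable → Fin 3
    classR x = let t , b = embed x in class (δ t -ᶻ δ b)

    charge-rotate : ∀ x → chargeZ (to rotate x) ≡ chargeZ x
    charge-rotate (inj₁ ((x , c) , y)) = cong (_-ᶻ total (λ _ → 1ℤ) (build y)) (total-rest (λ _ → 1ℤ) x (prev c) c)
    charge-rotate (inj₂ (r , (x , c))) = cong (λ u → total (λ _ → 1ℤ) (build (inj₁ r)) -ᶻ u) (total-rest (λ _ → 1ℤ) x (next c) c)

    weight-rotate : ∀ x → weightR (to rotate x) ≡ weightR x
    weight-rotate (inj₁ ((x , c) , y)) = cong (λ u → + 2 *ᶻ (u +ᶻ total (λ n → + n) (build y))) (total-rest (λ n → + suc n) x (prev c) c)
    weight-rotate (inj₂ (r , (x , c))) = cong (λ u → + 2 *ᶻ (total (λ n → + suc n) (build (inj₁ r)) +ᶻ u)) (total-rest (λ n → + n) x (next c) c)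

    class-rotate : ∀ x → classR (to rotate x) ≡ next (classR x)
    class-rotate (inj₁ ((x , c) , y)) = trans (cong (λ u → class (u -ᶻ δ (build y))) (δ-rest x (prev c) c))
      (trans (cong class (trans (lem (δ (build (inj₂ (x , c)))) (wδ (part false (prev c)) -ᶻ wδ (part false c)) (δ (build y))) (cong ((δ (build (inj₂ (x , c))) -ᶻ δ (build y)) +ᶻ_) (proj₂ (turn c)))))
        (class-step (δ (build (inj₂ (x , c))) -ᶻ δ (build y)) (proj₁ (turn c))))
      where
      turn : ∀ c → Σ[ k ∈ ℤ ] wδ (part false (prev c)) -ᶻ wδ (part false c) ≡ + 3 *ᶻ k -ᶻ 1ℤ
      turn 0F = 0ℤ , refl
      turn 1F = 0ℤ , refl
      turn 2F = 1ℤ , refl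
      lem : ∀ a b c → (a +ᶻ b) -ᶻ c ≡ (a -ᶻ c) +ᶻ b
      lem = ring-ℤ
    class-rotate (inj₂ (r , (x , c))) = trans (cong (λ u → class (δ (build (inj₁ r)) -ᶻ u)) (δ-rest x (next c) c))
      (trans (cong class (trans (lem (δ (build (inj₁ r))) (δ (build (inj₂ (x , c)))) (wδ (part false (next c)) -ᶻ wδ (part false c)))
          (cong ((δ (build (inj₁ r)) -ᶻ δ (build (inj₂ (x , c)))) +ᶻ_) (proj₂ (turn c)))))
        (class-step (δ (build (inj₁ r)) -ᶻ δ (build (inj₂ (x , c)))) (proj₁ (turn c))))
      where
      turn : ∀ c → Σ[ k ∈ ℤ ] -ᶻ (wδ (part false (next c)) -ᶻ wδ (part false c)) ≡ + 3 *ᶻ k -ᶻ 1ℤ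
      turn 0F = 0ℤ , refl
      turn 1F = 1ℤ , refl
      turn 2F = 0ℤ , refl
      lem : ∀ a b c → a -ᶻ (b +ᶻ c) ≡ (a -ᶻ b) +ᶻ -ᶻ c
      lem = ring-ℤ

    RotNeutral : Fin 3 → Set
    RotNeutral r = Sub Rotatable (λ x → NeutralZ r (from splitZ (inj₂ x)))

    embed≡ : ∀ x → from splitZ (inj₂ x) ≡ embed x
    embed≡ (inj₁ _) = refl
    embed≡ (inj₂ _) = refl

    rotated : RotNeutral 0F ≃ RotNeutral 1F
    rotated = Sub≃ rotate
      (λ x p → transport 0F 1F (to rotate x) x (charge-rotate x) (λ e → trans (class-rotate x) (cong next e)) p)
      (λ y p → transport 1F 0F (from rotate y) y (sym (trans (cong chargeZ (sym (to-from rotate y))) (charge-rotate (from rotate y))))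
        (λ e → next-injective (trans (sym (class-rotate (from rotate y))) (trans (cong classR (to-from rotate y)) e))) p)
      where
      transport : ∀ r r′ y x → chargeZ y ≡ chargeZ x → (classR x ≡ r → classR y ≡ r′) → NeutralZ r (from splitZ (inj₂ x)) → NeutralZ r′ (from splitZ (inj₂ y))
      transport r r′ y x c k p = subst (NeutralZ r′) (sym (embed≡ y)) (let p₁ , p₂ = subst (NeutralZ r) (embed≡ x) p in trans c p₁ , k p₂)
      next-injective : ∀ {c} → next c ≡ 1F → c ≡ 0F
      next-injective {0F} e = refl
      next-injective {1F} ()
      next-injective {2F} ()

    FullNeutral : Fin 3 → Set
    FullNeutral r = Sub (Row × Row) (λ x → NeutralZ r (from splitZ (inj₁ x)))

    class-fullPair : ∀ x → class (δ (proj₁ (fullPair x)) -ᶻ δ (proj₂ (fullPair x))) ≡ 0F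
    class-fullPair (r , s) = cong class (cong₂ _-ᶻ_ (δ-full r) (δ-full s))

    no-full : FullNeutral 1F → ⊥
    no-full (x ∥ p) with trans (sym (class-fullPair x)) (recompute (_ Finₚ.≟ 1F) (proj₂ p))
    ... | ()

    charge-fullPair : ∀ x → total (λ _ → 1ℤ) (proj₁ (fullPair x)) -ᶻ total (λ _ → 1ℤ) (proj₂ (fullPair x)) ≡ + 3 *ᶻ charge x
    charge-fullPair (r , s) = trans (cong₂ _-ᶻ_ (total-full (λ _ → 1ℤ) r) (total-full (λ _ → 1ℤ) s)) (lem (len r) (len s))
      where
      lem : ∀ a b → + 3 *ᶻ a -ᶻ + 3 *ᶻ b ≡ + 3 *ᶻ (a -ᶻ b)
      lem = ring-ℤ

    full≃ : FullNeutral 0F ≃ State₀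
    full≃ = Sub≃ ≃-refl (λ { x (p , _) → ℤₚ.*-cancelˡ-≡ (+ 3) (charge x) 0ℤ (trans (sym (charge-fullPair x)) p) })
      (λ x p → trans (charge-fullPair x) (cong (+ 3 *ᶻ_) p) , class-fullPair x)

    weight-full : ∀ x → weightZ (fullPair x) ≡ + 3 *ᶻ weight₂ x
    weight-full (r , s) = trans (cong₂ (λ u v → + 2 *ᶻ (u +ᶻ v)) (total-full (λ n → + suc n) r) (total-full (λ n → + n) s)) (lem (sum⁺ r) (sum⁰ s))
      where
      lem : ∀ a b → + 2 *ᶻ (+ 3 *ᶻ a +ᶻ + 3 *ᶻ b) ≡ + 3 *ᶻ (+ 2 *ᶻ (a +ᶻ b))
      lem = ring-ℤ

  -- Rotating the colours of the first position not occupied by all colours or none changes the class by one,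
  -- so the classes are equinumerous except for the configurations in which the three states agree.
  gf-rotation : ∀ {C f} → GF State₀ weight₀ C → GF (Sub (Tri State) (Neutral 1F)) (λ x → Σ₃ weight₂ (val x)) f →
    GF (Sub (Tri State) (Neutral 0F)) (λ x → Σ₃ weight₂ (val x)) (V C ⊕ f)
  gf-rotation GC G = gf-≃ (neutralWords 0F ∙ Sub-⊎ splitZ) weigh
    (gf-⊎ {W = λ x → weightZ (fullPair (val x))} {W′ = λ x → weightZ (embed (val x))}
      (gf-≃ full≃ (λ x → weight-full (val x)) (gf-V GC))
      (gf-≃ rotated (λ { (x ∥ p) → sym (weight-rotate x) }) rot₁))
    where
    split-weight : ∀ (y : Sub Z² (NeutralZ 0F)) → weightZ (val y) ≡ ⊎-wt (λ x → weightZ (fullPair (val x))) (λ x → weightZ (embed (val x))) (to (Sub-⊎ splitZ) y)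
    split-weight y = trans (cong (λ z → weightZ (val z)) (sym (from-to (Sub-⊎ {P = NeutralZ 0F} splitZ) y))) (case (to (Sub-⊎ splitZ) y))
      where
      case : ∀ w → weightZ (val (from (Sub-⊎ {P = NeutralZ 0F} splitZ) w)) ≡ ⊎-wt (λ x → weightZ (fullPair (val x))) (λ x → weightZ (embed (val x))) w
      case (inj₁ (x ∥ p)) = refl
      case (inj₂ (x ∥ p)) = cong weightZ (embed≡ x)
    weigh : ∀ i → Σ₃ weight₂ (val i) ≡ ⊎-wt (λ x → weightZ (fullPair (val x))) (λ x → weightZ (embed (val x))) (to (neutralWords 0F ∙ Sub-⊎ splitZ) i)
    weigh i = trans (weight-words (val i)) (split-weight (to (neutralWords 0F) i))
    rot₁ : GF (RotNeutral 1F) (λ x → weightZ (embed (val x))) _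
    rot₁ = gf-≃ (record { to = inj₂ ; from = λ { (inj₁ x) → ⊥-elim (no-full x) ; (inj₂ x) → x } ; from-to = λ _ → refl ; to-from = λ { (inj₁ x) → ⊥-elim (no-full x) ; (inj₂ x) → refl } }
        ∙ ≃-sym (neutralWords 1F ∙ Sub-⊎ splitZ))
      (λ { (x ∥ p) → trans (cong weightZ (sym (trans (to-from words _) (embed≡ x)))) (sym (weight-words (from words (from splitZ (inj₂ x))))) }) G

-- From the finite lists counted by `cφ` to pairs of rows.

module Enumeration where
  open GeneratingFunctions
  open import Data.Nat using (_∸_; _≡ᵇ_; _<ᵇ_; _%_; NonZero)
  open Streams using (Row; sumRow)
  open States using (len; charge)
  open import Data.Bool using (Bool; true; T; _∧_)
  open import Data.Bool.Properties using (T?; T-∧; T-∨)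
  import Data.Fin.Properties as Finₚ
  open import Data.List using (List; []; _∷_; _++_; length; map; concatMap; upTo; allFin; filterᵇ; cartesianProduct; reverse; lookup)
  import Data.List.Properties as Lₚ
  open import Data.List.Membership.Propositional using (_∈_; find; lose)
  open import Data.List.Membership.Propositional.Properties using (∈-map⁺; ∈-map⁻; ∈-concatMap⁺; ∈-concatMap⁻; ∈-cartesianProduct⁺; ∈-cartesianProduct⁻; ∈-upTo⁺; ∈-filter⁺; ∈-filter⁻; ∈-lookup; ∈-allFin)
  open import Data.List.Relation.Unary.Any using (here; any?; index)
  open import Data.List.Relation.Unary.Any.Properties using (lookup-index)
  open import Data.List.Relation.Unary.All using (All; []; _∷_)
  import Data.List.Relation.Unary.All as All
  open import Data.List.Relation.Unary.AllPairs using ([]; _∷_)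
  open import Data.List.Relation.Unary.Unique.Propositional using (Unique)
  import Data.List.Relation.Unary.Unique.Propositional.Properties as Uₚ
  import Data.Product.Properties as ×ₚ
  open import Function.Bundles using (Equivalence)
  open import Relation.Binary.Definitions using (DecidableEquality; tri<; tri≈; tri>)

  lookup-injective : ∀ {A : Set} {xs : List A} → Unique xs → ∀ i j → lookup xs i ≡ lookup xs j → i ≡ j
  lookup-injective (x∉ ∷ u) zero    zero    p = refl
  lookup-injective (x∉ ∷ u) zero    (suc j) p = ⊥-elim (All.lookup x∉ (∈-lookup j) p)
  lookup-injective (x∉ ∷ u) (suc i) zero    p = ⊥-elim (All.lookup x∉ (∈-lookup i) (sym p))
  lookup-injective (x∉ ∷ u) (suc i) (suc j) p = cong suc (lookup-injective u i j p)

  enumerate : ∀ {A : Set} → DecidableEquality A → (xs : List A) → Unique xs → Sub A (_∈ xs) ≃ Fin (length xs)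
  enumerate _≟_ xs u = record
    { to = λ { (x ∥ p) → index (member x p) } ; from = λ i → lookup xs i ∥ ∈-lookup i
    ; from-to = λ { (x ∥ p) → Sub-≡ (sym (lookup-index (member x p))) }
    ; to-from = λ i → lookup-injective u _ i (sym (lookup-index (member (lookup xs i) (∈-lookup i)))) }
    where
    member : ∀ x → .(x ∈ xs) → x ∈ xs
    member x p = recompute (any? (x ≟_) xs) p

  unique-concatMap : ∀ {A B : Set} (f : A → List B) → (∀ x → Unique (f x)) → (∀ {x y z} → z ∈ f x → z ∈ f y → x ≡ y) →
    ∀ {xs} → Unique xs → Unique (concatMap f xs)
  unique-concatMap f uf disjoint []       = []
  unique-concatMap f uf disjoint {x ∷ xs} (x∉ ∷ u) = Uₚ.++⁺ (uf x) (unique-concatMap f uf disjoint u)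
    λ { (z∈fx , z∈rest) → let y , y∈xs , z∈fy = find (∈-concatMap⁻ f z∈rest) in All.lookup x∉ y∈xs (disjoint z∈fx z∈fy) }

  private
    module ×∧ {x y} = Equivalence (T-∧ {x} {y})

  module Rows (k : ℕ) where

    atLevel : ℕ → List (ColInt k)
    atLevel a = map (λ c → (a , c)) (allFin k)

    prepend : ∀ {A : Set} → ℕ → List A → A → List (List A)
    prepend r xs x = map (x ∷_) (listsOfLength r xs)

    unique-cols : ∀ n → Unique (colsUpTo k n)
    unique-cols n = unique-concatMap atLevel (λ a → Uₚ.map⁺ (cong proj₂) (Uₚ.allFin⁺ k))
      (λ p r → let _ , _ , e = ∈-map⁻ _ p ; _ , _ , e′ = ∈-map⁻ _ r in trans (sym (cong proj₁ e)) (cong proj₁ e′)) (Uₚ.upTo⁺ (suc n))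

    ∈-cols : ∀ n a (c : Fin k) → a ≤ n → (a , c) ∈ colsUpTo k n
    ∈-cols n a c a≤n = ∈-concatMap⁺ atLevel (lose (∈-upTo⁺ (s≤s a≤n)) (∈-map⁺ _ (∈-allFin c)))

    unique-lists : ∀ {A : Set} r {xs : List A} → Unique xs → Unique (listsOfLength r xs)
    unique-lists zero    u = [] ∷ []
    unique-lists (suc r) {xs} u = unique-concatMap (prepend r xs) (λ x → Uₚ.map⁺ Lₚ.∷-injectiveʳ (unique-lists r u))
      (λ p s → let _ , _ , e = ∈-map⁻ _ p ; _ , _ , e′ = ∈-map⁻ _ s in Lₚ.∷-injectiveˡ (trans (sym e) e′)) u

    ∈-lists : ∀ {A : Set} {xs : List A} ys → All (_∈ xs) ys → ys ∈ listsOfLength (length ys) xs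
    ∈-lists []       []       = here refl
    ∈-lists {xs = xs} (y ∷ ys) (p ∷ ps) = ∈-concatMap⁺ (prepend (length ys) xs) (lose p (∈-map⁺ _ (∈-lists ys ps)))

    length-lists : ∀ {A : Set} r {xs : List A} {ys} → ys ∈ listsOfLength r xs → length ys ≡ r
    length-lists zero    (here refl) = refl
    length-lists (suc r) {xs} p = let x , _ , r∈ = find (∈-concatMap⁻ (prepend r xs) {xs = xs} p) ; zs , zs∈ , e = ∈-map⁻ (x ∷_) r∈ in trans (cong length e) (cong suc (length-lists r zs∈))

    rowsOfLength : ℕ → ℕ → List (List (ColInt k))
    rowsOfLength n r = listsOfLength r (colsUpTo k n)

    unique-rows : ∀ n → Unique (rows k n)
    unique-rows n = Uₚ.filter⁺ (λ x → T? (strictDecᵇ x)) (unique-concatMap (rowsOfLength n) (λ r → unique-lists r (unique-cols n))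
      (λ p s → trans (sym (length-lists _ p)) (length-lists _ s)) (Uₚ.upTo⁺ (suc n)))

    bounded : ∀ n (xs : List (ColInt k)) → weight xs ≤ n → All (_∈ colsUpTo k n) xs
    bounded n []             p = []
    bounded n ((a , c) ∷ xs) p = ∈-cols n a c (ℕₚ.≤-trans (ℕₚ.m≤m+n a _) p) ∷ bounded n xs (ℕₚ.≤-trans (ℕₚ.m≤n+m _ a) p)

    ∈-rows : ∀ n xs → T (strictDecᵇ xs) → length xs ≤ n → weight xs ≤ n → xs ∈ rows k n
    ∈-rows n xs dec l w = ∈-filter⁺ (λ x → T? (strictDecᵇ x)) (∈-concatMap⁺ (rowsOfLength n) (lose (∈-upTo⁺ (s≤s l)) (∈-lists xs (bounded n xs w)))) dec

    Pair : Set
    Pair = List (ColInt k) × List (ColInt k)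

    size : Pair → ℕ
    size (t , b) = length t + weight t + weight b

    Valid : ℕ → Pair → Set
    Valid n (t , b) = T (strictDecᵇ t) × T (strictDecᵇ b) × length t ≡ length b × size (t , b) ≡ n

    partitions : ℕ → List Pair
    partitions n = filterᵇ (isCFP n) (cartesianProduct (rows k n) (rows k n))

    unique-partitions : ∀ n → Unique (partitions n)
    unique-partitions n = Uₚ.filter⁺ (λ x → T? (isCFP n x)) (Uₚ.cartesianProduct⁺ (unique-rows n) (unique-rows n))

    -- The cut-offs in `rows` lose nothing: the size bounds both weights and the common length, and
    -- a weight bounds each entry of its row.
    valid→∈ : ∀ n x → Valid n x → x ∈ partitions n
    valid→∈ n (t , b) (dt , db , l , refl) = ∈-filter⁺ (λ x → T? (isCFP n x))
      (∈-cartesianProduct⁺ (∈-rows n t dt lt wt) (∈-rows n b db (ℕₚ.≤-trans (ℕₚ.≤-reflexive (sym l)) lt) wb))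
      (×∧.from (ℕₚ.≡⇒≡ᵇ (length t) (length b) l , ℕₚ.≡⇒≡ᵇ (size (t , b)) n refl))
      where
      wt : weight t ≤ size (t , b)
      wt = ℕₚ.≤-trans (ℕₚ.m≤n+m _ (length t)) (ℕₚ.m≤m+n _ _)
      wb : weight b ≤ size (t , b)
      wb = ℕₚ.m≤n+m _ (length t + weight t)
      lt : length t ≤ size (t , b)
      lt = ℕₚ.≤-trans (ℕₚ.m≤m+n _ _) (ℕₚ.m≤m+n _ _)

    ∈→valid : ∀ n x → x ∈ partitions n → Valid n x
    ∈→valid n (t , b) p = let p₁ , p₂ = ∈-filter⁻ (λ x → T? (isCFP n x)) p ; p₃ , p₄ = ∈-cartesianProduct⁻ (rows k n) (rows k n) p₁ ; p₅ , p₆ = ×∧.to p₂ in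
      proj₂ (∈-filter⁻ (λ x → T? (strictDecᵇ x)) {xs = concatMap (rowsOfLength n) (upTo (suc n))} p₃) ,
      proj₂ (∈-filter⁻ (λ x → T? (strictDecᵇ x)) {xs = concatMap (rowsOfLength n) (upTo (suc n))} p₄) ,
      ℕₚ.≡ᵇ⇒≡ (length t) (length b) p₅ , ℕₚ.≡ᵇ⇒≡ (size (t , b)) n p₆

    _≟Pair_ : DecidableEquality Pair
    _≟Pair_ = ×ₚ.≡-dec (Lₚ.≡-dec (×ₚ.≡-dec ℕₚ._≟_ Finₚ._≟_)) (Lₚ.≡-dec (×ₚ.≡-dec ℕₚ._≟_ Finₚ._≟_))

    Balanced : Pair → Set
    Balanced (t , b) = T (strictDecᵇ t) × T (strictDecᵇ b) × length t ≡ length b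

    gf-partitions : GF (Sub Pair Balanced) (λ x → + (2 * size (val x))) (λ n → + cφ k n)
    gf-partitions = record
      { card = cφ k
      ; iso = bySize ∙ Σ≃ (λ n → Sub≃ ≃-refl (valid→∈ n) (∈→valid n) ∙ enumerate _≟Pair_ (partitions n) (unique-partitions n))
      ; weighs = λ x → refl
      ; coeff = λ n → refl }
      where
      bySize : Sub Pair Balanced ≃ Σ ℕ (λ n → Sub Pair (Valid n))
      bySize = record
        { to = λ { (x ∥ p) → size x , (x ∥ (proj₁ p , proj₁ (proj₂ p) , proj₂ (proj₂ p) , refl)) }
        ; from = λ { (n , (x ∥ p)) → x ∥ (proj₁ p , proj₁ (proj₂ p) , proj₁ (proj₂ (proj₂ p))) }
        ; from-to = λ _ → refl
        ; to-from = λ { (n , (x ∥ p)) → lem n x (recompute (size x ℕₚ.≟ n) (proj₂ (proj₂ (proj₂ p)))) p } }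
        where
        lem : ∀ n x → size x ≡ n → .(p : Valid n x) → _≡_ {A = Σ ℕ (λ n → Sub Pair (Valid n))} (size x , (x ∥ _)) (n , (x ∥ p))
        lem .(size x) x refl p = refl

  decᵇ : List ℕ → Bool
  decᵇ []           = true
  decᵇ (x ∷ [])     = true
  decᵇ (x ∷ y ∷ xs) = (y <ᵇ x) ∧ decᵇ (y ∷ xs)

  base : List ℕ → ℕ
  base []      = 0
  base (y ∷ _) = suc y

  fromGaps : List ℕ → List ℕ
  fromGaps []       = []
  fromGaps (g ∷ gs) = base (fromGaps gs) + g ∷ fromGaps gs

  toGaps : List ℕ → List ℕ
  toGaps []       = []
  toGaps (x ∷ xs) = x ∸ base xs ∷ toGaps xs

  private
    dec-head : ∀ x xs → T (decᵇ (x ∷ xs)) → base xs ≤ x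
    dec-head x []       p = z≤n
    dec-head x (y ∷ xs) p = ℕₚ.<ᵇ⇒< y x (proj₁ (×∧.to p))

    dec-tail : ∀ x xs → T (decᵇ (x ∷ xs)) → T (decᵇ xs)
    dec-tail x []       p = tt
    dec-tail x (y ∷ xs) p = proj₂ (×∧.to p)

    dec-cons : ∀ x xs → base xs ≤ x → T (decᵇ xs) → T (decᵇ (x ∷ xs))
    dec-cons x []       p d = tt
    dec-cons x (y ∷ xs) p d = ×∧.from (ℕₚ.<⇒<ᵇ p , d)

  gaps≃ : Sub (List ℕ) (λ xs → T (decᵇ xs)) ≃ List ℕ
  gaps≃ = record
    { to = λ { (xs ∥ p) → toGaps xs } ; from = λ gs → fromGaps gs ∥ decreasing gs
    ; from-to = λ { (xs ∥ p) → Sub-≡ (from-to′ xs (recompute (T? (decᵇ xs)) p)) } ; to-from = to-from′ }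
    where
    decreasing : ∀ gs → T (decᵇ (fromGaps gs))
    decreasing []       = tt
    decreasing (g ∷ gs) = dec-cons _ (fromGaps gs) (ℕₚ.m≤m+n _ g) (decreasing gs)
    from-to′ : ∀ xs → T (decᵇ xs) → fromGaps (toGaps xs) ≡ xs
    from-to′ []       p = refl
    from-to′ (x ∷ xs) p = cong₂ _∷_ (trans (cong (λ ys → base ys + (x ∸ base xs)) (from-to′ xs (dec-tail x xs p))) (ℕₚ.m+[n∸m]≡n (dec-head x xs p))) (from-to′ xs (dec-tail x xs p))
    to-from′ : ∀ gs → toGaps (fromGaps gs) ≡ gs
    to-from′ []       = refl
    to-from′ (g ∷ gs) = cong₂ _∷_ (ℕₚ.m+n∸m≡n (base (fromGaps gs)) g) (to-from′ gs)

  rowGaps : Row ≃ List ℕ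
  rowGaps = record
    { to = map proj₁ ; from = map (_, tt)
    ; from-to = λ r → trans (sym (Lₚ.map-∘ r)) (Lₚ.map-id r)
    ; to-from = λ gs → trans (sym (Lₚ.map-∘ gs)) (Lₚ.map-id gs) }

  reverse≃ : ∀ {A : Set} → List A ≃ List A
  reverse≃ = record { to = reverse ; from = reverse ; from-to = Lₚ.reverse-involutive ; to-from = Lₚ.reverse-involutive }

  -- A `Row` stores its gaps from the smallest element upward, whereas the rows of the array
  -- decrease; hence the reversal.
  elements : Row → List ℕ
  elements r = fromGaps (reverse (map proj₁ r))

  decRow : Row ≃ Sub (List ℕ) (λ xs → T (decᵇ xs))
  decRow = rowGaps ∙ reverse≃ ∙ ≃-sym gaps≃

  sumL : (ℕ → ℤ) → List ℕ → ℤ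
  sumL φ []       = 0ℤ
  sumL φ (x ∷ xs) = φ x +ᶻ sumL φ xs

  -- A new smallest element g lifts all others by g + 1, the same shift as in the recursion of
  -- `sumSeq`.
  fromGaps-snoc : ∀ gs g → fromGaps (gs ++ g ∷ []) ≡ map (λ n → suc (g + n)) (fromGaps gs) ++ g ∷ []
  fromGaps-snoc []       g = refl
  fromGaps-snoc (h ∷ gs) g = cong₂ _∷_ (trans (cong (λ xs → base xs + h) (fromGaps-snoc gs g)) (trans (cong (_+ h) (base-snoc (fromGaps gs))) (cong suc (ℕₚ.+-assoc g (base (fromGaps gs)) h))))
    (fromGaps-snoc gs g)
    where
    base-snoc : ∀ xs → base (map (λ n → suc (g + n)) xs ++ g ∷ []) ≡ suc (g + base xs)
    base-snoc []       = cong suc (sym (ℕₚ.+-identityʳ g))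
    base-snoc (x ∷ xs) = cong suc (sym (ℕₚ.+-suc g x))

  sumL-snoc : ∀ φ xs g → sumL φ (xs ++ g ∷ []) ≡ φ g +ᶻ sumL φ xs
  sumL-snoc φ []       g = refl
  sumL-snoc φ (x ∷ xs) g = trans (cong (φ x +ᶻ_) (sumL-snoc φ xs g)) (lem (φ x) (φ g) (sumL φ xs))
    where
    lem : ∀ a b c → a +ᶻ (b +ᶻ c) ≡ b +ᶻ (a +ᶻ c)
    lem = ring-ℤ

  sumL-map : ∀ φ (f : ℕ → ℕ) xs → sumL φ (map f xs) ≡ sumL (λ n → φ (f n)) xs
  sumL-map φ f []       = refl
  sumL-map φ f (x ∷ xs) = cong (φ (f x) +ᶻ_) (sumL-map φ f xs)

  sum-elements : ∀ φ r → sumL φ (elements r) ≡ sumRow φ r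
  sum-elements φ []             = refl
  sum-elements φ ((g , tt) ∷ r) = trans (cong (λ gs → sumL φ (fromGaps gs)) (Lₚ.unfold-reverse g (map proj₁ r)))
    (trans (cong (sumL φ) (fromGaps-snoc (reverse (map proj₁ r)) g)) (trans (sumL-snoc φ (map (λ n → suc (g + n)) (elements r)) g)
      (cong₂ _+ᶻ_ (sym (ℤₚ.*-identityˡ (φ g))) (trans (sumL-map φ (λ n → suc (g + n)) (elements r)) (sum-elements (λ n → φ (suc (g + n))) r)))))

  -- The coloured integer a_c occupies position a k + (c − 1); this is the lexicographic order.
  module Colours (k : ℕ) .{{_ : NonZero k}} where
    open Rows k

    position : ColInt k → ℕ
    position (a , c) = a * k + toℕ c

    position≃ : ColInt k ≃ ℕ
    position≃ = record
      { to = position ; from = λ p → p / k , fromℕ< (DM.m%n<n p k)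
      ; from-to = λ { (a , c) → cong₂ _,_ (quot a c) (Finₚ.toℕ-injective (trans (Finₚ.toℕ-fromℕ< _) (rem a c))) }
      ; to-from = λ p → trans (cong (λ u → p / k * k + u) (Finₚ.toℕ-fromℕ< (DM.m%n<n p k))) (trans (ℕₚ.+-comm (p / k * k) (p % k)) (sym (DM.m≡m%n+[m/n]*n p k))) }
      where
      rem : ∀ a (c : Fin k) → (a * k + toℕ c) % k ≡ toℕ c
      rem a c = trans (cong (_% k) (ℕₚ.+-comm (a * k) (toℕ c))) (trans (DM.[m+kn]%n≡m%n (toℕ c) a k) (DM.m<n⇒m%n≡m (Finₚ.toℕ<n c)))
      quot : ∀ a (c : Fin k) → (a * k + toℕ c) / k ≡ a
      quot a c = ℕₚ.*-cancelʳ-≡ _ a k (ℕₚ.+-cancelˡ-≡ ((a * k + toℕ c) % k) _ _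
        (trans (sym (DM.m≡m%n+[m/n]*n (a * k + toℕ c) k)) (trans (ℕₚ.+-comm (a * k) (toℕ c)) (cong (λ u → u + a * k) (sym (rem a c))))))

    ≺→< : ∀ x y → T (x ≺ᵇ y) → position x < position y
    ≺→< (a , c) (b , d) p with Equivalence.to (T-∨ {a <ᵇ b}) p
    ... | inj₁ q = ℕₚ.<-≤-trans (ℕₚ.+-monoʳ-< (a * k) (Finₚ.toℕ<n c)) (ℕₚ.≤-trans (ℕₚ.≤-trans (ℕₚ.≤-reflexive (ℕₚ.+-comm (a * k) k)) (ℕₚ.*-monoˡ-≤ k (ℕₚ.<ᵇ⇒< a b q))) (ℕₚ.m≤m+n _ _))
    ... | inj₂ q with ℕₚ.≡ᵇ⇒≡ a b (proj₁ (×∧.to q))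
    ... | refl = ℕₚ.+-monoʳ-< (a * k) (ℕₚ.<ᵇ⇒< (toℕ c) (toℕ d) (proj₂ (×∧.to {a ≡ᵇ a} q)))

    <→≺ : ∀ x y → position x < position y → T (x ≺ᵇ y)
    <→≺ (a , c) (b , d) p with ℕₚ.<-cmp a b
    ... | tri< a<b _ _ = Equivalence.from (T-∨ {a <ᵇ b}) (inj₁ (ℕₚ.<⇒<ᵇ a<b))
    ... | tri≈ _ refl _ = Equivalence.from (T-∨ {a <ᵇ a}) (inj₂ (×∧.from {a ≡ᵇ a} (ℕₚ.≡⇒≡ᵇ a a refl , ℕₚ.<⇒<ᵇ (ℕₚ.+-cancelˡ-< (a * k) _ _ p))))
    ... | tri> _ _ b<a = ⊥-elim (ℕₚ.<-asym p (≺→< (b , d) (a , c) (Equivalence.from (T-∨ {b <ᵇ a}) (inj₁ (ℕₚ.<⇒<ᵇ b<a)))))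

    dec→ : ∀ xs → T (strictDecᵇ xs) → T (decᵇ (map position xs))
    dec→ []           p = tt
    dec→ (x ∷ [])     p = tt
    dec→ (x ∷ y ∷ xs) p = let p₁ , p₂ = ×∧.to {y ≺ᵇ x} p in ×∧.from (ℕₚ.<⇒<ᵇ (≺→< y x p₁) , dec→ (y ∷ xs) p₂)

    dec← : ∀ xs → T (decᵇ (map position xs)) → T (strictDecᵇ xs)
    dec← []           p = tt
    dec← (x ∷ [])     p = tt
    dec← (x ∷ y ∷ xs) p = let p₁ , p₂ = ×∧.to {position y <ᵇ position x} p in ×∧.from {y ≺ᵇ x} (<→≺ y x (ℕₚ.<ᵇ⇒< _ _ p₁) , dec← (y ∷ xs) p₂)

    positions≃ : List (ColInt k) ≃ List ℕ
    positions≃ = record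
      { to = map position ; from = map (from position≃)
      ; from-to = λ xs → trans (sym (Lₚ.map-∘ xs)) (trans (Lₚ.map-cong (from-to position≃) xs) (Lₚ.map-id xs))
      ; to-from = λ ys → trans (sym (Lₚ.map-∘ ys)) (trans (Lₚ.map-cong (to-from position≃) ys) (Lₚ.map-id ys)) }

    colouredRow : Row ≃ Sub (List (ColInt k)) (λ xs → T (strictDecᵇ xs))
    colouredRow = decRow ∙ ≃-sym (Sub≃ positions≃ dec→ (λ ys p → dec← (from positions≃ ys) (subst (λ zs → T (decᵇ zs)) (sym (to-from positions≃ ys)) p)))

    level : ℕ → ℤ
    level p = + (p / k)

    length-row : ∀ r → + length (val (to colouredRow r)) ≡ len r
    length-row r = trans (go (elements r)) (sum-elements (λ _ → 1ℤ) r)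
      where
      go : ∀ xs → + length (map (from position≃) xs) ≡ sumL (λ _ → 1ℤ) xs
      go []       = refl
      go (x ∷ xs) = cong (1ℤ +ᶻ_) (go xs)

    weight-row : ∀ r → + weight (val (to colouredRow r)) ≡ sumRow level r
    weight-row r = trans (go (elements r)) (sum-elements level r)
      where
      go : ∀ xs → + weight (map (from position≃) xs) ≡ sumL level xs
      go []       = refl
      go (x ∷ xs) = trans (ℤₚ.pos-+ (x / k) _) (cong (level x +ᶻ_) (go xs))

    colouredWeight : Row × Row → ℤ
    colouredWeight (t , b) = + 2 *ᶻ (len t +ᶻ sumRow level t +ᶻ sumRow level b)

    gf-coloured : GF (Sub (Row × Row) (λ x → charge x ≡ 0ℤ)) (λ x → colouredWeight (val x)) (λ n → + cφ k n)
    gf-coloured = gf-≃ pairs weigh gf-partitions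
      where
      pairs : Sub (Row × Row) (λ x → charge x ≡ 0ℤ) ≃ Sub Pair Balanced
      pairs = Sub≃ {Q = λ { ((t ∥ _) , (b ∥ _)) → length t ≡ length b }} (colouredRow ×≃ colouredRow)
          (λ { (t , b) p → ℤₚ.+-injective (trans (length-row t) (trans (ℤₚ.i-j≡0⇒i≡j (len t) (len b) p) (sym (length-row b)))) })
          (λ { (t , b) p → trans (cong₂ _-ᶻ_ (trans (sym (length-row (from colouredRow t))) (cong (λ t → + length (val t)) (to-from colouredRow t)))
                                             (trans (sym (length-row (from colouredRow b))) (cong (λ b → + length (val b)) (to-from colouredRow b))))
                            (trans (cong (λ l → + length (val t) -ᶻ + l) (sym p)) (ℤₚ.+-inverseʳ (+ length (val t)))) })
        ∙ record
          { to = λ { (((t ∥ p) , (b ∥ r)) ∥ e) → (t , b) ∥ (p , r , e) }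
          ; from = λ { ((t , b) ∥ p) → ((t ∥ proj₁ p) , (b ∥ proj₁ (proj₂ p))) ∥ proj₂ (proj₂ p) }
          ; from-to = λ _ → refl ; to-from = λ _ → refl }
      weigh : ∀ x → colouredWeight (val x) ≡ + (2 * size (val (to pairs x)))
      weigh ((t , b) ∥ p) = sym (trans (ℤₚ.pos-* 2 (size (t′ , b′))) (cong (+ 2 *ᶻ_) (trans (ℤₚ.pos-+ (length t′ + weight t′) (weight b′))
        (cong₂ _+ᶻ_ (trans (ℤₚ.pos-+ (length t′) (weight t′)) (cong₂ _+ᶻ_ (length-row t) (weight-row t))) (weight-row b)))))
        where
        t′ = val (to colouredRow t)
        b′ = val (to colouredRow b)

-- The series of coloured Frobenius partitions and the arithmetic progressions.

module FrobeniusSeries where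
  open PowerSeries
  open Trisection
  open CubicTheta using (_³; _·_; _:·_; 1#)
  open Congruences
  open GeneratingFunctions
  open Streams using (Tri; triple; split3; sumRow; sum-split3; sumSeq-cong; one)
  open States
  open Lattices
  open TripleStates
  open ColourRotation
  open Enumeration using (module Colours)

  C Φ κ a : Series
  C n = + cφ 1 n
  Φ n = + cφ 9 n
  κ = proj₁ K-exists
  a = proj₁ A-exists

  gf-κ : GF ℤ² (on² wK) κ
  gf-κ = proj₂ K-exists

  gf-a : GF ℤ² (on² (wΣ 0ℤ)) a
  gf-a = proj₂ A-exists

  ℓ : Series
  ℓ = κ ⊕ (κ ⊕ κ)

  gf-ℓ : GF ℤ² (on² (wΣ 1ℤ)) ℓ
  gf-ℓ = gf-B gf-κ

  -- The r in n = r + Σ (aᵢ + bᵢ) is absorbed by the top row: adding its length to the sum of its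
  -- positions counts position a as a + 1.
  gf-C : GF State₀ weight₀ C
  gf-C = gf-≃ ≃-refl (λ x → weigh (val x)) (Colours.gf-coloured 1)
    where
    lem : ∀ s l b → + 2 *ᶻ ((s +ᶻ l) +ᶻ b) ≡ + 2 *ᶻ (l +ᶻ s +ᶻ b)
    lem = ring-ℤ
    level₁ : ∀ r → sum⁰ r ≡ sumRow (Colours.level 1) r
    level₁ r = sumSeq-cong one (λ n → cong +_ (sym (DM.n/1≡n n))) r
    weigh : ∀ x → weight₂ x ≡ Colours.colouredWeight 1 x
    weigh (t , b) = trans (cong (λ u → + 2 *ᶻ (u +ᶻ sum⁰ b)) (sum⁺-sum⁰ t)) (trans (lem (sum⁰ t) (len t) (sum⁰ b))
      (cong₂ (λ u v → + 2 *ᶻ (len t +ᶻ u +ᶻ v)) (level₁ t) (level₁ b)))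

  Vℓ≈ : V ℓ ≈ 3 · V κ
  Vℓ≈ = ≈trans (V-⊕ κ (κ ⊕ κ)) (≈trans (⊕-cong ≈refl (V-⊕ κ κ)) (solve 1 (λ k → k :+ (k :+ k) := 3 :· k) (λ _ → refl) (V κ)))

  C-split : C ≈ V C ³ ⊛ κ
  C-split = ≈trans (gf-unique gf-C (gf-residues gf-C gf-κ)) (solve 2 (λ k c → k :* (c :* (c :* c)) := c :* c :* c :* k) (λ _ → refl) κ (V C))

  a-split : a ≈ V a ⊕ 6 · (q ⊛ V κ)
  a-split = ≈trans (gf-unique gf-a (gf-A gf-a gf-ℓ)) (lincomb₁ (2 · q) Vℓ≈
    (solve 4 (λ A q l k → (A :+ (q :* l :+ q :* l)) :- (A :+ 6 :· (q :* k)) := 2 :· q :* (l :- 3 :· k)) (λ _ → refl) (V a) q (V ℓ) (V κ)))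

  -- Neutral triples of class 0 have series C³ V a and those of class 1 have C³ q V ℓ; by rotation
  -- the first exceeds the second by V C. This is the product formula for b = a(q³) - c(q³).
  C³-split : C ³ ⊛ (V a ⊝ 3 · (q ⊛ V κ)) ≈ V C
  C³-split = lincomb₂ 1# classes (q ⊛ C ³) Vℓ≈
    (solve 6 (λ c A q l k c′ → c :* c :* c :* (A :- 3 :· (q :* k)) :- c′
       := con 1ℤ :* (A :* (c :* (c :* c)) :- (c′ :+ (q :* l) :* (c :* (c :* c)))) :+ q :* (c :* c :* c) :* (l :- 3 :· k)) (λ _ → refl) C (V a) q (V ℓ) (V κ) (V C))
    where
    classes : V a ⊛ (C ⊛ (C ⊛ C)) ≈ V C ⊕ (q ⊛ V ℓ) ⊛ (C ⊛ (C ⊛ C))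
    classes = gf-unique (gf-Neutral gf-C zero (A-by-class gf-a gf-ℓ zero)) (gf-rotation gf-C (gf-Neutral gf-C (suc zero) (A-by-class gf-a gf-ℓ (suc zero))))

  -- Positions p of the nine-coloured rows are split twice according to p modulo 3.
  byColour : State ≃ Tri State
  byColour = (split3 ×≃ split3) ∙ zip₃

  leveled : (ℕ → ℤ) → State → ℤ
  leveled φ (t , b) = + 2 *ᶻ (len t +ᶻ sumRow φ t +ᶻ sumRow φ b)

  private
    split-sum : ∀ {φ ψ : ℕ → ℤ} → (∀ n → φ (triple n) ≡ ψ n) → (∀ n → φ (suc (triple n)) ≡ ψ n) → (∀ n → φ (suc (suc (triple n))) ≡ ψ n) →
      ∀ r → sumRow φ r ≡ Σ₃ (sumRow ψ) (to split3 r)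
    split-sum {φ} p₀ p₁ p₂ r = trans (sym (sum-split3 φ r)) (cong₂ _+ᶻ_ (sumSeq-cong one p₀ (proj₁ (to split3 r)))
      (cong₂ _+ᶻ_ (sumSeq-cong one p₁ (proj₁ (proj₂ (to split3 r)))) (sumSeq-cong one p₂ (proj₂ (proj₂ (to split3 r))))))

    charge-byColour : ∀ x → charge x ≡ Σ₃ charge (to byColour x)
    charge-byColour (t , b) = trans (cong₂ _-ᶻ_ (split-sum {ψ = λ _ → 1ℤ} (λ _ → refl) (λ _ → refl) (λ _ → refl) t) (split-sum {ψ = λ _ → 1ℤ} (λ _ → refl) (λ _ → refl) (λ _ → refl) b))
      (lem (len t₀) (len t₁) (len t₂) (len b₀) (len b₁) (len b₂))
      where
      t₀ = proj₁ (to split3 t)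
      t₁ = proj₁ (proj₂ (to split3 t))
      t₂ = proj₂ (proj₂ (to split3 t))
      b₀ = proj₁ (to split3 b)
      b₁ = proj₁ (proj₂ (to split3 b))
      b₂ = proj₂ (proj₂ (to split3 b))
      lem : ∀ a b c x y z → (a +ᶻ (b +ᶻ c)) -ᶻ (x +ᶻ (y +ᶻ z)) ≡ (a -ᶻ x) +ᶻ ((b -ᶻ y) +ᶻ (c -ᶻ z))
      lem = ring-ℤ

    leveled-byColour : ∀ {φ ψ : ℕ → ℤ} → (∀ n → φ (triple n) ≡ ψ n) → (∀ n → φ (suc (triple n)) ≡ ψ n) → (∀ n → φ (suc (suc (triple n))) ≡ ψ n) →
      ∀ x → leveled φ x ≡ Σ₃ (leveled ψ) (to byColour x)
    leveled-byColour {φ} {ψ} p₀ p₁ p₂ (t , b) = trans (cong₂ (λ u v → + 2 *ᶻ (u +ᶻ v)) (cong₂ _+ᶻ_ (split-sum {ψ = λ _ → 1ℤ} (λ _ → refl) (λ _ → refl) (λ _ → refl) t) (split-sum p₀ p₁ p₂ t)) (split-sum p₀ p₁ p₂ b))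
      (lem (len t₀) (len t₁) (len t₂) (sumRow ψ t₀) (sumRow ψ t₁) (sumRow ψ t₂) (sumRow ψ b₀) (sumRow ψ b₁) (sumRow ψ b₂))
      where
      t₀ = proj₁ (to split3 t)
      t₁ = proj₁ (proj₂ (to split3 t))
      t₂ = proj₂ (proj₂ (to split3 t))
      b₀ = proj₁ (to split3 b)
      b₁ = proj₁ (proj₂ (to split3 b))
      b₂ = proj₂ (proj₂ (to split3 b))
      lem : ∀ a b c u v w x y z → + 2 *ᶻ (((a +ᶻ (b +ᶻ c)) +ᶻ (u +ᶻ (v +ᶻ w))) +ᶻ (x +ᶻ (y +ᶻ z))) ≡ + 2 *ᶻ (a +ᶻ u +ᶻ x) +ᶻ (+ 2 *ᶻ (b +ᶻ v +ᶻ y) +ᶻ + 2 *ᶻ (c +ᶻ w +ᶻ z))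
      lem = ring-ℤ

    triple≡ : ∀ n → triple n ≡ n * 3
    triple≡ zero    = refl
    triple≡ (suc n) = cong (λ m → suc (suc (suc m))) (triple≡ n)

    /3 : ∀ c n → c / 3 ≡ 0 → (c + triple n) / 3 ≡ n
    /3 c n p = trans (cong (λ m → (c + m) / 3) (triple≡ n)) (trans (DM.+-distrib-/-∣ʳ c (n∣m*n n)) (cong₂ _+_ p (DM.m*n/n≡m n 3)))

    /9 : ∀ c n → c / 3 ≡ 0 → (c + triple n) / 9 ≡ n / 3
    /9 c n p = trans (sym (DM.m/n/o≡m/[n*o] (c + triple n) 3 3)) (cong (_/ 3) (/3 c n p))

  gf-Φ : ∀ {f} → GF (Sub (Tri (Tri State)) (λ x → Σ₃ (Σ₃ charge) x ≡ 0ℤ)) (λ x → Σ₃ (Σ₃ weight₂) (val x)) f → f ≈ Φ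
  gf-Φ G = gf-unique (gf-≃ (Sub≃ nine (λ x p → trans (sym (charges x)) p) (λ y p → trans (charges (from nine y)) (trans (cong (Σ₃ (Σ₃ charge)) (to-from nine y)) p))) (λ x → weighs₉ (val x)) G)
    (Colours.gf-coloured 9)
    where
    nine : State ≃ Tri (Tri State)
    nine = byColour ∙ tri≃ byColour
    charges : ∀ x → charge x ≡ Σ₃ (Σ₃ charge) (to nine x)
    charges x = trans (charge-byColour x) (cong₂ _+ᶻ_ (charge-byColour (proj₁ y)) (cong₂ _+ᶻ_ (charge-byColour (proj₁ (proj₂ y))) (charge-byColour (proj₂ (proj₂ y)))))
      where y = to byColour x
    leveled₁ : ∀ x → leveled (λ n → + n) x ≡ weight₂ x
    leveled₁ (t , b) = trans (cong (λ u → + 2 *ᶻ (u +ᶻ sum⁰ b)) (ℤₚ.+-comm (len t) (sum⁰ t))) (cong (λ u → + 2 *ᶻ (u +ᶻ sum⁰ b)) (sym (sum⁺-sum⁰ t)))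
    step : ∀ x → leveled (λ n → + (n / 3)) x ≡ Σ₃ weight₂ (to byColour x)
    step x = trans (leveled-byColour {ψ = λ n → + n} (λ n → cong +_ (/3 0 n refl)) (λ n → cong +_ (/3 1 n refl)) (λ n → cong +_ (/3 2 n refl)) x)
      (cong₂ _+ᶻ_ (leveled₁ (proj₁ y)) (cong₂ _+ᶻ_ (leveled₁ (proj₁ (proj₂ y))) (leveled₁ (proj₂ (proj₂ y)))))
      where y = to byColour x
    weighs₉ : ∀ x → Colours.colouredWeight 9 x ≡ Σ₃ (Σ₃ weight₂) (to nine x)
    weighs₉ x = trans (leveled-byColour {ψ = λ n → + (n / 3)} (λ n → cong +_ (/9 0 n refl)) (λ n → cong +_ (/9 1 n refl)) (λ n → cong +_ (/9 2 n refl)) x)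
      (cong₂ _+ᶻ_ (step (proj₁ y)) (cong₂ _+ᶻ_ (step (proj₁ (proj₂ y))) (step (proj₂ (proj₂ y)))))
      where y = to byColour x

  -- Of the 27 residue patterns nine survive: 0, 0, 0 gives a³ V a; six orders of 0, 1, 2 give 6 q κ
  -- a ℓ² = 54 a q κ³; the two constant nonzero ones give 2 q² ℓ³ V ℓ = 162 q² κ³ V κ, because ℓ =
  -- 3κ.
  Φ≈ : Φ ≈ (C ³) ³ ⊛ (a ³ ⊛ V a ⊕ 54 · (a ⊛ (q ⊛ κ ³)) ⊕ 162 · (q ⊛ κ ³ ⊛ (q ⊛ V κ)))
  Φ≈ = ≈trans (≈sym (gf-Φ (LambdaTable.gf-nine gf-a gf-ℓ gf-κ gf-C))) (lincomb₁ (54 · (q ⊛ q ⊛ (κ ³ ⊛ (D³ ⊛ D³ ⊛ D³)))) Vℓ≈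
    (≈trans (⊕-congˡ′ (solve 7 (λ A a k q l d v →
       let O = con 0ℤ ; Q = q :* k ; R = q :* (q :* l) ; ℓ = k :+ (k :+ k) ; x = a :* d ; y = ℓ :* d
           s3 = λ u v w → u :+ (v :+ w)
           term = λ f r₁ r₂ r₃ → f :* (r₁ :* (r₂ :* r₃)) in
       s3 (s3 (s3 (term A x x x) (term O x x y) (term O x x y)) (s3 (term O x y x) (term O x y y) (term Q x y y)) (s3 (term O x y x) (term Q x y y) (term O x y y)))
          (s3 (s3 (term O y x x) (term O y x y) (term Q y x y)) (s3 (term O y y x) (term R y y y) (term O y y y)) (s3 (term Q y y x) (term O y y y) (term O y y y)))
          (s3 (s3 (term O y x x) (term Q y x y) (term O y x y)) (s3 (term Q y y x) (term O y y y) (term O y y y)) (s3 (term O y y x) (term O y y y) (term R y y y)))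
         := d :* d :* d :* (a :* a :* a :* A :+ 54 :· (a :* (q :* (k :* k :* k))) :+ 54 :· (q :* (k :* k :* k) :* (q :* l)))) (λ _ → refl) (V a) a κ q (V ℓ) D³ (V κ)))
      (solve 7 (λ A a k q l c v → let d = c :* (c :* c) ; d′ = c :* c :* c in
         (d :* d :* d :* (a :* a :* a :* A :+ 54 :· (a :* (q :* (k :* k :* k))) :+ 54 :· (q :* (k :* k :* k) :* (q :* l))))
         :- (d′ :* d′ :* d′ :* (a :* a :* a :* A :+ 54 :· (a :* (q :* (k :* k :* k))) :+ 162 :· (q :* (k :* k :* k) :* (q :* v))))
         := 54 :· (q :* q :* (k :* k :* k :* (d :* d :* d))) :* (l :- 3 :· v)) (λ _ → refl) (V a) a κ q (V ℓ) C (V κ))))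
    where
    D³ : Series
    D³ = C ⊛ (C ⊛ C)
    ⊕-congˡ′ : ∀ {x y z} → x ≈ y → x ⊝ z ≈ y ⊝ z
    ⊕-congˡ′ p = ⊕-cong p ≈refl

  open Divisibility C a κ Φ refl C-split a-split C³-split Φ≈ public
    using (F; H; F-divisible; H-divisible; F-divisible-3n; H-divisible-3n+1)

  Index : ℤ → ℕ → Set
  Index f d = Σ[ x ∈ ℕ ] (f ≡ + cφ 9 x) × 8 * x ≡ d + 3

  -- The argument `suc n` skips the coefficient at 0, where 8x = 3 - 3^(2k+1) has no natural
  -- solution once k ≥ 1.
  F-index : ∀ k n → Index (F k (suc n)) (3 ^ (2 * k + 1) * (8 * n + 7))
  H-index : ∀ k n → Index (H k n) (3 ^ (2 * k + 2) * (8 * n + 5))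
  F-index zero    n = suc n * 3 , refl , lem n
    where
    lem : ∀ n → 8 * (suc n * 3) ≡ 3 * (8 * n + 7) + 3
    lem = ring-ℕ
  F-index (suc k) n = let x , e , p = H-index k (suc (suc (n * 3))) in
    x , trans (q⊛ (H k) (suc n * 3)) e , trans p (trans (lem (3 ^ (2 * k + 2)) n) (cong (λ m → 3 ^ m * (8 * n + 7) + 3) (exponent k)))
    where
    lem : ∀ m n → m * (8 * suc (suc (n * 3)) + 5) + 3 ≡ 3 * m * (8 * n + 7) + 3
    lem = ring-ℕ
    exponent : ∀ k → suc (2 * k + 2) ≡ 2 * suc k + 1
    exponent = ring-ℕ
  H-index k n = let x , e , p = F-index k (suc (n * 3)) in
    x , e , trans p (trans (lem (3 ^ (2 * k + 1)) n) (cong (λ m → 3 ^ m * (8 * n + 5) + 3) (sym (ℕₚ.+-suc (2 * k) 1))))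
    where
    lem : ∀ m n → m * (8 * suc (n * 3) + 7) + 3 ≡ 3 * m * (8 * n + 5) + 3
    lem = ring-ℕ

  solution : ∀ {m c d n x x₀} → 8 * x₀ ≡ c + 3 → 8 * x ≡ d + 3 → d ≡ 8 * (m * n) + c → m * n + (c + 3) / 8 ≡ x
  solution {m} {c} {d} {n} {x} {x₀} p₀ p r = ℕₚ.*-cancelˡ-≡ _ x 8
    (trans (cong (λ u → 8 * (m * n + u)) (trans (cong (_/ 8) (trans (sym p₀) (ℕₚ.*-comm 8 x₀))) (DM.m*n/n≡m x₀ 8)))
    (trans (ℕₚ.*-distribˡ-+ 8 (m * n) x₀) (trans (cong (λ u → 8 * (m * n) + u) p₀) (trans (sym (ℕₚ.+-assoc (8 * (m * n)) c 3)) (trans (cong (_+ 3) (sym r)) (sym p))))))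

  3^∣ : ∀ {a b} j → b ≡ a + j → 3 ^ a ∣ 3 ^ b
  3^∣ {a} j refl = divides (3 ^ j) (trans (ℕₚ.^-distribˡ-+-* 3 a j) (ℕₚ.*-comm (3 ^ a) (3 ^ j)))

  -- The index of `f₀` is the start of the progression; it certifies that 8 divides c + 3, so that
  -- the truncated division is exact.
  conclude : ∀ {a b m c c₀ d n f f₀} j → b ≡ a + j → 3 ^ b ∣ ∣ f ∣ → Index f₀ c₀ → c₀ ≡ c → Index f d → d ≡ 8 * (m * n) + c → 3 ^ a ∣ cφ 9 (m * n + (c + 3) / 8)
  conclude {a} {b} {m} {c} {d = d} {n} {f} j e div (x₀ , _ , p₀) refl (x , p , r) r′ =
    subst (λ y → 3 ^ a ∣ cφ 9 y) (sym (solution {m} {c} {d} {n} {x} {x₀} p₀ r r′)) (∣-trans (3^∣ {a} {b} j e) (subst (λ z → 3 ^ b ∣ ∣ z ∣) p div))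

-- The four congruences.

open FrobeniusSeries

theorem1p4 : (k n : ℕ) → 3 ≤ k →
    (3 ^ (4 * k + 5) ∣ cφ 9 (3 ^ (2 * k + 1) * n + (7 * 3 ^ (2 * k + 1) + 3) / 8))
    × (3 ^ (4 * k + 6) ∣ cφ 9 (3 ^ (2 * k + 2) * n + (5 * 3 ^ (2 * k + 2) + 3) / 8))
    × (3 ^ (4 * k + 7) ∣ cφ 9 (3 ^ (2 * k + 2) * n + (23 * 3 ^ (2 * k + 1) + 3) / 8))
    × (3 ^ (4 * k + 8) ∣ cφ 9 (3 ^ (2 * k + 3) * n + (13 * 3 ^ (2 * k + 2) + 3) / 8))
theorem1p4 (suc (suc (suc j))) n (s≤s (s≤s (s≤s z≤n))) = part₁ , part₂ , part₃ , part₄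
  where
  k = suc (suc (suc j))
  M = 3 ^ (2 * k + 1)
  M′ = 3 ^ (2 * k + 2)
  M′≡ : M′ ≡ 3 * M
  M′≡ = cong (3 ^_) (ℕₚ.+-suc (2 * k) 1)
  M″≡ : 3 ^ (2 * k + 3) ≡ 3 * M′
  M″≡ = cong (3 ^_) (ℕₚ.+-suc (2 * k) 2)

  comm₀ : ∀ p c → p * (8 * 0 + c) ≡ c * p
  comm₀ = ring-ℕ

  part₁ : 3 ^ (4 * k + 5) ∣ cφ 9 (M * n + (7 * M + 3) / 8)
  -- The available exponent is 5(k - 1) + 7 = 5k + 2; its surplus over 4k + 5 is j = k - 3. The
  -- surplus is the same in the other three parts.
  part₁ = conclude {4 * k + 5} {m = M} j (e j) (F-divisible (suc (suc j)) (suc n)) (F-index k 0) (comm₀ M 7) (F-index k n) (lem M n)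
    where
    e : ∀ j → 5 * (2 + j) + 7 ≡ 4 * (3 + j) + 5 + j
    e = ring-ℕ
    lem : ∀ p n → p * (8 * n + 7) ≡ 8 * (p * n) + 7 * p
    lem = ring-ℕ

  part₂ : 3 ^ (4 * k + 6) ∣ cφ 9 (M′ * n + (5 * M′ + 3) / 8)
  part₂ = conclude {4 * k + 6} {m = M′} j (e j) (H-divisible k n) (H-index k 0) (comm₀ M′ 5) (H-index k n) (lem M′ n)
    where
    e : ∀ j → 5 * (3 + j) + 3 ≡ 4 * (3 + j) + 6 + j
    e = ring-ℕ
    lem : ∀ p n → p * (8 * n + 5) ≡ 8 * (p * n) + 5 * p
    lem = ring-ℕ

  part₃ : 3 ^ (4 * k + 7) ∣ cφ 9 (M′ * n + (23 * M + 3) / 8)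
  -- 23 = 8 × 2 + 7: the progression is the subsequence 3n + 2 of the first one, whose coefficients
  -- of F sit at the multiples 3(n + 1).
  part₃ = conclude {4 * k + 7} {m = M′} j (e j) (F-divisible-3n (suc (suc j)) (suc n)) (F-index k 2) (ℕₚ.*-comm M 23) (F-index k (suc (suc (n * 3)))) (trans (lem M n) (cong (λ p → 8 * (p * n) + 23 * M) (sym M′≡)))
    where
    e : ∀ j → 5 * (2 + j) + 9 ≡ 4 * (3 + j) + 7 + j
    e = ring-ℕ
    lem : ∀ p n → p * (8 * suc (suc (n * 3)) + 7) ≡ 8 * (3 * p * n) + 23 * p
    lem = ring-ℕ

  part₄ : 3 ^ (4 * k + 8) ∣ cφ 9 (3 ^ (2 * k + 3) * n + (13 * M′ + 3) / 8)
  -- 13 = 8 × 1 + 5: the subsequence 3n + 1 of the second progression.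
  part₄ = conclude {4 * k + 8} {m = 3 ^ (2 * k + 3)} j (e j) (H-divisible-3n+1 k n) (H-index k 1) (ℕₚ.*-comm M′ 13) (H-index k (suc (n * 3))) (trans (lem M′ n) (cong (λ p → 8 * (p * n) + 13 * M′) (sym M″≡)))
    where
    e : ∀ j → 5 * (3 + j) + 5 ≡ 4 * (3 + j) + 8 + j
    e = ring-ℕ
    lem : ∀ p n → p * (8 * suc (n * 3) + 5) ≡ 8 * (3 * p * n) + 13 * p
    lem = ring-ℕ
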